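{- If there is a polynomial-time algorithm for Interval Scheduling with Colors, then there is a polynomial-time algorithm for $\lambda$-Robust Interval Scheduling.
   Context: $\lambda$-Robust Interval Scheduling: the input is a set $I=\{i_1,\dots,i_n\}$ of jobs, job $i_j$ being a half-open interval $[a_j,b_j)$ with $a_j,b_j\in\mathbb{N}$, $a_j\le b_j$, weights $w:I\to\mathbb{R}_{\ge0}$, and $\lambda\in\mathbb{R}$. Let $\mathcal{F}$ be the family of subsets of $I$ of pairwise disjoint intervals and $w$ of a set the sum of weights. For $S\in\mathcal{F}$ and $i\in I\cup\{\emptyset\}$ let $$\Delta(i,S)=\min_{\substack{e\in (I\setminus(S\cup\{i\}))\cup\{\emptyset\}\\ (S\setminus\{i\})\cup\{e\}\in\mathcal{F}}}\Big(w(S)-w\big((S\setminus\{i\})\cup\{e\}\big)\Big)$$ (with $\emptyset$ meaning no deletion/addition). The task is to find $S\in\mathcal{F}$ maximizing $w(S)$ subject to $\Delta(i,S)\le\lambda$ for all $i\in I\cup\{\emptyset\}$. Interval Scheduling with Colors: the input is a set of jobs with weights $w\ge0$, where each job $j$ has two half-open intervals $[\ell_j,r_j)$ and $[a_j,b_j)$ with $\ell_j\le a_j<b_j\le r_j$; the inner interval $[a_j,b_j)$ is red and $[\ell_j,r_j)\setminus[a_j,b_j)$ is blue. A set $S$ of jobs is feasible if for any two distinct jobs $j,k\in S$, $[a_j,b_j)\cap[\ell_k,r_k)=\emptyset$ and $[a_k,b_k)\cap[\ell_j,r_j)=\emptyset$. The task is to find a feasible set of maximum total weight.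
   Formalization: The weights w (in both problems) and λ are rational numbers, given in binary, instead of real numbers. -}

module Defs where

open import Data.Bool.Base using (Bool; true; false; if_then_else_)
open import Data.Fin.Base using (Fin)
open import Data.Fin.Properties using (all?) renaming (_≟_ to _≟ᶠ_)
open import Data.Fin.Subset using (Subset; _∈_; _∉_; _∪_; ⁅_⁆; _-_)
open import Data.Fin.Subset.Properties using (_∈?_)
open import Data.Integer.Base using (ℤ; ∣_∣; sign)
open import Data.List.Base using (List; _∷_; map; filter; allFin)
open import Data.Maybe.Base using (Maybe; just; nothing; maybe′)
open import Data.Maybe.Relation.Unary.All using (All) renaming (dec to all-dec)
open import Data.Nat.Base using (ℕ; suc; _+_; _*_; _^_; _≤_; _<_; _⊔_; _⊓_)
open import Data.Nat.Binary.Base using (ℕᵇ; 2[1+_]; 1+[2_]; fromℕ) renaming (zero to zeroᵇ)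
open import Data.Nat.Properties using (_<?_; ≤-<-trans; <-≤-trans; ⊔-lub; ⊓-glb; m≤m⊔n; m≤n⊔m; m⊓n≤m; m⊓n≤n)
open import Data.Product.Base using (Σ; ∃; _×_; _,_)
open import Data.Rational.Base using (ℚ; 0ℚ; ↥_; ↧ₙ_) renaming (_≤_ to _≤ℚ_; _-_ to _-ℚ_)
open import Data.Rational.Properties using (+-0-commutativeMonoid; ≤-decTotalOrder)
open import Data.Sign.Base using (Sign)
open import Data.Vec.Base using (Vec; []; _∷_; lookup)
open import Level using (0ℓ)
open import Relation.Binary.Bundles using (DecTotalOrder)
open import Relation.Binary.PropositionalEquality using (_≢_)
open import Relation.Nullary.Decidable using (Dec; map′; ¬?; _×-dec_; _→-dec_)
open import Relation.Nullary.Negation using (¬_)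
open import Relation.Unary using (Pred; Decidable; _⊥_)

open import Algebra.Properties.CommutativeMonoid.Sum +-0-commutativeMonoid using (sum)
open import Data.List.Extrema (DecTotalOrder.totalOrder ≤-decTotalOrder) using (min)

------------------------------------------------------------------------
-- Model of computation: Jones's WHILE language over binary trees ("Computability
-- and Complexity from a Programming Perspective"), written with expressions and
-- lexically scoped variables instead of commands and a store.  As there, every
-- elementary operation costs one unit and the only test is whether a tree is a
-- leaf, so polynomial time here is polynomial time on Turing machines.

data Tree : Set where
  leaf : Tree
  node : Tree → Tree → Tree

size : Tree → ℕ
size leaf       = 1
size (node l r) = 1 + size l + size r

data Exp (n : ℕ) : Set where
  var   : Fin n → Exp n
  nil   : Exp n
  cons  : Exp n → Exp n → Exp n
  hd tl : Exp n → Exp n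
  -- A leaf is false, any other tree is true.
  cond  : Exp n → Exp n → Exp n → Exp n
  bind  : Exp n → Exp (suc n) → Exp n
  -- while e c b:  x := e; while c(x) do x := b(x); return x
  while : Exp n → Exp (suc n) → Exp (suc n) → Exp n

left right : Tree → Tree
left leaf        = leaf
left (node l _)  = l
right leaf       = leaf
right (node _ r) = r

infix 4 _⊢_⇓_⟨_⟩ _⊢while_,_from_⇓_⟨_⟩

mutual

  -- ρ ⊢ e ⇓ v ⟨ t ⟩: in the environment ρ, e evaluates to v in t steps.
  data _⊢_⇓_⟨_⟩ {n : ℕ} (ρ : Vec Tree n) : Exp n → Tree → ℕ → Set where
    ⇓var   : ∀ {x} → ρ ⊢ var x ⇓ lookup ρ x ⟨ 1 ⟩
    ⇓nil   : ρ ⊢ nil ⇓ leaf ⟨ 1 ⟩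
    ⇓cons  : ∀ {e f u v s t} → ρ ⊢ e ⇓ u ⟨ s ⟩ → ρ ⊢ f ⇓ v ⟨ t ⟩ →
             ρ ⊢ cons e f ⇓ node u v ⟨ 1 + s + t ⟩
    ⇓hd    : ∀ {e v t} → ρ ⊢ e ⇓ v ⟨ t ⟩ → ρ ⊢ hd e ⇓ left v ⟨ 1 + t ⟩
    ⇓tl    : ∀ {e v t} → ρ ⊢ e ⇓ v ⟨ t ⟩ → ρ ⊢ tl e ⇓ right v ⟨ 1 + t ⟩
    ⇓true  : ∀ {c e f l r v s t} → ρ ⊢ c ⇓ node l r ⟨ s ⟩ → ρ ⊢ e ⇓ v ⟨ t ⟩ →
             ρ ⊢ cond c e f ⇓ v ⟨ 1 + s + t ⟩
    ⇓false : ∀ {c e f v s t} → ρ ⊢ c ⇓ leaf ⟨ s ⟩ → ρ ⊢ f ⇓ v ⟨ t ⟩ →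
             ρ ⊢ cond c e f ⇓ v ⟨ 1 + s + t ⟩
    ⇓bind  : ∀ {e f u v s t} → ρ ⊢ e ⇓ u ⟨ s ⟩ → (u ∷ ρ) ⊢ f ⇓ v ⟨ t ⟩ →
             ρ ⊢ bind e f ⇓ v ⟨ 1 + s + t ⟩
    ⇓while : ∀ {e c b u v s t} → ρ ⊢ e ⇓ u ⟨ s ⟩ → ρ ⊢while c , b from u ⇓ v ⟨ t ⟩ →
             ρ ⊢ while e c b ⇓ v ⟨ 1 + s + t ⟩

  data _⊢while_,_from_⇓_⟨_⟩ {n : ℕ} (ρ : Vec Tree n) (c b : Exp (suc n)) :
                              Tree → Tree → ℕ → Set where
    stop : ∀ {u s} → (u ∷ ρ) ⊢ c ⇓ leaf ⟨ s ⟩ →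
           ρ ⊢while c , b from u ⇓ u ⟨ 1 + s ⟩
    step : ∀ {u v w l r s t k} → (u ∷ ρ) ⊢ c ⇓ node l r ⟨ s ⟩ →
           (u ∷ ρ) ⊢ b ⇓ v ⟨ t ⟩ → ρ ⊢while c , b from v ⇓ w ⟨ k ⟩ →
           ρ ⊢while c , b from u ⇓ w ⟨ 1 + s + t + k ⟩

Program : Set
Program = Exp 1

_on_⇓_⟨_⟩ : Program → Tree → Tree → ℕ → Set
p on x ⇓ y ⟨ t ⟩ = (x ∷ []) ⊢ p ⇓ y ⟨ t ⟩

------------------------------------------------------------------------
-- Encodings; all numbers are written in binary.

encodeBool : Bool → Tree
encodeBool false = leaf
encodeBool true  = node leaf leaf

encodeℕᵇ : ℕᵇ → Tree
encodeℕᵇ zeroᵇ    = leaf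
encodeℕᵇ 2[1+ x ] = node (encodeBool false) (encodeℕᵇ x)
encodeℕᵇ 1+[2 x ] = node (encodeBool true) (encodeℕᵇ x)

encodeℕ : ℕ → Tree
encodeℕ n = encodeℕᵇ (fromℕ n)

encodeSign : Sign → Tree
encodeSign Sign.+ = encodeBool false
encodeSign Sign.- = encodeBool true

encodeℤ : ℤ → Tree
encodeℤ i = node (encodeSign (sign i)) (encodeℕ ∣ i ∣)

encodeℚ : ℚ → Tree
encodeℚ q = node (encodeℤ (↥ q)) (encodeℕ (↧ₙ q))

encodeVec : ∀ {A : Set} {n} → (A → Tree) → Vec A n → Tree
encodeVec enc []       = leaf
encodeVec enc (x ∷ xs) = node (enc x) (encodeVec enc xs)

encodeSubset : ∀ {n} → Subset n → Tree
encodeSubset = encodeVec encodeBool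

encodeMaybe : {A : Set} → (A → Tree) → Maybe A → Tree
encodeMaybe enc = maybe′ (λ x → node leaf (enc x)) leaf

------------------------------------------------------------------------
-- Maximization problems and their polynomial-time solvability

record MaximizationProblem : Set₁ where
  field
    Instance       : Set
    encodeInstance : Instance → Tree
    Solution       : Instance → Set
    encodeSolution : ∀ {I} → Solution I → Tree
    Feasible       : ∀ {I} → Solution I → Set
    value          : ∀ {I} → Solution I → ℚ

  Optimal : ∀ {I} → Solution I → Set
  Optimal {I} S = Feasible S × (∀ (T : Solution I) → Feasible T → value T ≤ℚ value S)

  -- The answer nothing reports that there is no feasible solution.
  Correct : (I : Instance) → Maybe (Solution I) → Set
  Correct I (just S) = Optimal S
  Correct I nothing  = ∀ (S : Solution I) → ¬ Feasible S

PolynomialTimeSolvable : MaximizationProblem → Set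
PolynomialTimeSolvable P =
  ∃ λ (p : Program) → ∃ λ (c : ℕ) → ∃ λ (k : ℕ) → (I : Instance) →
    Σ (Maybe (Solution I)) λ answer → ∃ λ (t : ℕ) →
      (p on encodeInstance I ⇓ encodeMaybe encodeSolution answer ⟨ t ⟩)
      × t ≤ c * size (encodeInstance I) ^ k
      × Correct I answer
  where open MaximizationProblem P

------------------------------------------------------------------------
-- Intervals and weights

-- The endpoints are naturals, so two such intervals of the real line meet
-- exactly when they share a natural number.
[_,_⟩ : ℕ → ℕ → Pred ℕ 0ℓ
[ a , b ⟩ x = a ≤ x × x < b

disjoint? : ∀ a b c d → Dec ([ a , b ⟩ ⊥ [ c , d ⟩)
disjoint? a b c d = map′ to from (¬? (a ⊔ c <? b ⊓ d))
  where
  to : ¬ (a ⊔ c < b ⊓ d) → [ a , b ⟩ ⊥ [ c , d ⟩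
  to ≮ ((a≤x , x<b) , (c≤x , x<d)) = ≮ (≤-<-trans (⊔-lub a≤x c≤x) (⊓-glb x<b x<d))
  from : [ a , b ⟩ ⊥ [ c , d ⟩ → ¬ (a ⊔ c < b ⊓ d)
  from dis lt = dis ((m≤m⊔n a c , <-≤-trans lt (m⊓n≤m b d)) , (m≤n⊔m a c , <-≤-trans lt (m⊓n≤n b d)))

totalWeight : ∀ {n} → (Fin n → ℚ) → Subset n → ℚ
totalWeight w S = sum (λ i → if lookup S i then w i else 0ℚ)

------------------------------------------------------------------------
-- λ-Robust Interval Scheduling

record Job : Set where
  field
    a b      : ℕ
    a≤b      : a ≤ b
    weight   : ℚ
    0≤weight : 0ℚ ≤ℚ weight

record RobustInstance : Set where
  field
    n    : ℕ
    jobs : Vec Job n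
    Λ    : ℚ

encodeJob : Job → Tree
encodeJob j = node (encodeℕ a) (node (encodeℕ b) (encodeℚ weight))
  where open Job j

encodeRobustInstance : RobustInstance → Tree
encodeRobustInstance I = node (encodeVec encodeJob jobs) (encodeℚ Λ)
  where open RobustInstance I

-- S ⊖ i and S ⊕ i are S ∖ {i} and S ∪ {i}, where i may be ∅ (nothing).
infixl 6 _⊖_ _⊕_

_⊖_ _⊕_ : ∀ {n} → Subset n → Maybe (Fin n) → Subset n
S ⊖ i = maybe′ (λ j → S - j) S i
S ⊕ i = maybe′ (λ j → S ∪ ⁅ j ⁆) S i

module Robust (I : RobustInstance) where
  open RobustInstance I

  interval : Fin n → Pred ℕ 0ℓ
  interval i = [ Job.a (lookup jobs i) , Job.b (lookup jobs i) ⟩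

  w : Subset n → ℚ
  w = totalWeight (λ i → Job.weight (lookup jobs i))

  𝓕 : Pred (Subset n) 0ℓ
  𝓕 S = ∀ i j → i ∈ S → j ∈ S → i ≢ j → interval i ⊥ interval j

  𝓕? : Decidable 𝓕
  𝓕? S = all? λ i → all? λ j →
    (i ∈? S) →-dec ((j ∈? S) →-dec (¬? (i ≟ᶠ j) →-dec disjoint? _ _ _ _))

  Replacement : Maybe (Fin n) → Subset n → Pred (Maybe (Fin n)) 0ℓ
  Replacement i S e = All (_∉ S ⊕ i) e × 𝓕 (S ⊖ i ⊕ e)

  replacement? : ∀ i S → Decidable (Replacement i S)
  replacement? i S e = all-dec (λ j → ¬? (j ∈? (S ⊕ i))) e ×-dec 𝓕? (S ⊖ i ⊕ e)

  loss : Maybe (Fin n) → Subset n → Maybe (Fin n) → ℚ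
  loss i S e = w S -ℚ w (S ⊖ i ⊕ e)

  replacements : Maybe (Fin n) → Subset n → List (Maybe (Fin n))
  replacements i S = filter (replacement? i S) (nothing ∷ map just (allFin n))

  -- For S in 𝓕, e = ∅ is always a replacement, so the starting value
  -- loss i S nothing of min is one of the values minimized over.
  Δ : Maybe (Fin n) → Subset n → ℚ
  Δ i S = min (loss i S nothing) (map (loss i S) (replacements i S))

  Feasible : Pred (Subset n) 0ℓ
  Feasible S = 𝓕 S × (∀ (i : Maybe (Fin n)) → Δ i S ≤ℚ Λ)

RobustIntervalScheduling : MaximizationProblem
RobustIntervalScheduling = record
  { Instance       = RobustInstance
  ; encodeInstance = encodeRobustInstance
  ; Solution       = λ I → Subset (RobustInstance.n I)
  ; encodeSolution = encodeSubset
  ; Feasible       = λ {I} → Robust.Feasible I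
  ; value          = λ {I} → Robust.w I
  }

------------------------------------------------------------------------
-- Interval Scheduling with Colors

record ColoredJob : Set where
  field
    ℓ a b r  : ℕ
    ℓ≤a      : ℓ ≤ a
    a<b      : a < b
    b≤r      : b ≤ r
    weight   : ℚ
    0≤weight : 0ℚ ≤ℚ weight

  whole red : Pred ℕ 0ℓ
  whole = [ ℓ , r ⟩
  red   = [ a , b ⟩

record ColoredInstance : Set where
  field
    n    : ℕ
    jobs : Vec ColoredJob n

encodeColoredJob : ColoredJob → Tree
encodeColoredJob j =
  node (encodeℕ ℓ) (node (encodeℕ a) (node (encodeℕ b) (node (encodeℕ r) (encodeℚ weight))))
  where open ColoredJob j

encodeColoredInstance : ColoredInstance → Tree
encodeColoredInstance I = encodeVec encodeColoredJob (ColoredInstance.jobs I)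

module Colored (I : ColoredInstance) where
  open ColoredInstance I

  whole red : Fin n → Pred ℕ 0ℓ
  whole j = ColoredJob.whole (lookup jobs j)
  red   j = ColoredJob.red (lookup jobs j)

  w : Subset n → ℚ
  w = totalWeight (λ j → ColoredJob.weight (lookup jobs j))

  Feasible : Pred (Subset n) 0ℓ
  Feasible S = ∀ j k → j ∈ S → k ∈ S → j ≢ k → red j ⊥ whole k × red k ⊥ whole j

IntervalSchedulingWithColors : MaximizationProblem
IntervalSchedulingWithColors = record
  { Instance       = ColoredInstance
  ; encodeInstance = encodeColoredInstance
  ; Solution       = λ I → Subset (ColoredInstance.n I)
  ; encodeSolution = encodeSubset
  ; Feasible       = λ {I} → Colored.Feasible I
  ; value          = λ {I} → Colored.w I
  }

{-# OPTIONS --safe #-}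
module Submission where

-- Let S be a robust solution and g₁ a heaviest job that can be added to S. A replacement of i ∈ S that is
-- disjoint from i can itself be added to S, so g₁ will do instead; any other replacement e meets i, and then
-- the union of i and e is an interval. If λ < 0, a second job g₂ that can be added to S is needed, for the
-- case that g₁ is the job that breaks down. Hence, once g₁ and g₂ are guessed, the robust solutions are the
-- solutions of a colored instance that has, for every admissible replacement e of i, a copy of i with red
-- interval i and whole interval i ∪ e. Two copies of the same job are incompatible, so weights are preserved.
--
-- All comparisons that this needs (of endpoints, and of sums of weights) are delegated to the algorithm for
-- the colored problem, so the only operation on binary numbers that has to be programmed is juxtaposition.

-- Blue parts may overlap each other because only one job breaks down at a time: two chosen jobs may
-- share a replacement, but a replacement has to avoid every chosen job except the one it stands in
-- for. The obstacle is that a whole interval has no holes: the hull of `i` and a distant `e` would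
-- swallow the chosen jobs between them. Hence only an `e` that meets `i` gets a copy of its own;
-- all other cases are left to `g₁` and encoded by the copy `(i , i)`, which has no blue part. If
-- `i` is ∅ or lies outside `S`, nothing is lost, yet for λ < 0 some job of weight at least -λ must
-- still be addable, and it must not be `i` itself. This is what the two guesses provide. That `g₁`
-- is heaviest matters only for completeness: every guess that passes `Good` leads to robust
-- solutions, so the best result over all guesses is optimal. As the empty set solves every colored
-- instance, each such guess yields a solution, and none passes exactly if no robust solution
-- exists.

open import Defs

open import Data.Bool.Base using (Bool; true; false; if_then_else_; _∧_; _∨_; not)
open import Data.Fin.Base using (Fin; zero; suc; lift)
import Data.Fin.Properties as Fin
open import Data.Fin.Subset using (Subset; _∈_; _∉_; _∪_; _─_; _-_; ⁅_⁆) renaming (⊥ to ∅)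
open import Data.Fin.Subset.Properties using (_∈?_; x∈p∪q⁻; x∈p∪q⁺; x∈⁅x⁆; x∈⁅y⁆⇒x≡y; x∈p∧x∉q⇒x∈p─q; p─q⊆p; ∉⊥)
open import Data.Integer.Base as ℤ using (+_; -[1+_])
import Data.Integer.Properties as ℤ
import Data.Integer.Tactic.RingSolver as ℤ-Solver
open import Data.List.Base using (List; []; _∷_; _++_; _ʳ++_; reverse; map; concat; length; filter; filterᵇ; null; allFin; tabulate; cartesianProduct)
import Data.List.Membership.Propositional as List
open import Data.List.Membership.Propositional.Properties using (∈-map⁻; ∈-map⁺; ∈-allFin; ∈-filter⁺; ∈-filter⁻; ∈-cartesianProduct⁺)
open import Data.List.Properties using (map-++; map-∘; map-tabulate; filter-all; reverse-involutive)
open import Data.List.Relation.Binary.Sublist.Propositional using (_⊆_; []; _∷_; _∷ʳ_; ⊆-refl; ⊆-reflexive; ⊆-trans; from∈)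
open import Data.List.Relation.Binary.Sublist.Propositional.Properties using (map⁺; ++⁺; ++⁺ˡ; ++⁺ʳ; filter⁺; All-resp-⊆)
open import Data.List.Relation.Unary.All as All using (All; []; _∷_)
import Data.List.Relation.Unary.All.Properties as All
open import Data.List.Relation.Unary.AllPairs as AllPairs using (AllPairs; []; _∷_)
import Data.List.Relation.Unary.AllPairs.Properties as AllPairs
open import Data.List.Relation.Unary.Any using (here; there)
import Data.List.Relation.Unary.Any.Properties as Any
open import Data.Maybe.Base as Maybe using (Maybe; just; nothing; maybe′)
open import Data.Maybe.Properties using (just-injective)
import Data.Maybe.Relation.Unary.All as MaybeAll
open import Data.Nat.Base hiding (_/_)
open import Data.Nat.Binary.Base using (ℕᵇ; 2[1+_]; 1+[2_]; fromℕ; toℕ) renaming (zero to zeroᵇ)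
open import Data.Nat.Binary.Properties using (fromℕ-toℕ; toℕ-fromℕ)
import Data.Nat.Coprimality as Coprimality
open import Data.Nat.Properties
open import Data.Nat.Tactic.RingSolver using (solve-∀)
open import Data.Product.Base using (Σ; ∃; _×_; _,_; proj₁; proj₂; swap)
open import Data.Rational.Base as ℚ using (ℚ; 0ℚ; mkℚ; ↥_; ↧ₙ_; toℚᵘ) renaming (_≤_ to _≤ℚ_; _<_ to _<ℚ_; _+_ to _+ℚ_; _-_ to _-ℚ_)
import Data.Rational.Properties as ℚ
open import Data.Rational.Solver using (module +-*-Solver)
import Data.Rational.Unnormalised.Base as ℚᵘ
import Data.Rational.Unnormalised.Properties as ℚᵘ
open import Data.Sum.Base using (_⊎_; inj₁; inj₂; [_,_]′) renaming (swap to swap⊎)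
open import Data.Vec.Base as Vec using (Vec; lookup; fromList; toList; here; there) renaming ([] to []ᵛ; _∷_ to _∷ᵛ_; tabulate to tabulateᵛ)
open import Data.Vec.Properties using ([]=⇒lookup; lookup∘tabulate)
open import Function.Base using (_∘_; _on_; id)
open import Function.Bundles using (mk⇔)
open import Relation.Binary.Bundles using (DecTotalOrder)
open import Relation.Binary.PropositionalEquality using (_≡_; _≢_; refl; sym; trans; cong; cong₂; subst; subst₂; module ≡-Reasoning)
open import Relation.Nullary.Decidable using (Dec; yes; no; does; T?; dec-true; dec-false; does-⇔; ¬?; _×-dec_; _⊎-dec_; _→-dec_)
open import Relation.Nullary.Negation using (¬_; contradiction)
open import Relation.Unary using (Decidable; _⊥_)

open import Algebra.Properties.CommutativeMonoid.Sum ℚ.+-0-commutativeMonoid using (sum; sum-cong-≗; ∑-distrib-+; sum-replicate-zero)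
open import Data.List.Extrema (DecTotalOrder.totalOrder ℚ.≤-decTotalOrder) using (min≤v⁺; argmin-sel)

-- Polynomial bounds

infixl 6 _⊞_
infixl 7 _⊠_
infixr 9 _⊚_

data Poly : Set where
  con         : ℕ → Poly
  𝕏           : Poly
  _⊞_ _⊠_ _⊚_ : Poly → Poly → Poly

⟦_⟧ : Poly → ℕ → ℕ
⟦ con c ⟧ x = c
⟦ 𝕏 ⟧     x = x
⟦ P ⊞ Q ⟧ x = ⟦ P ⟧ x + ⟦ Q ⟧ x
⟦ P ⊠ Q ⟧ x = ⟦ P ⟧ x * ⟦ Q ⟧ x
⟦ P ⊚ Q ⟧ x = ⟦ P ⟧ (⟦ Q ⟧ x)

⟦⟧-mono : ∀ P {x y} → x ≤ y → ⟦ P ⟧ x ≤ ⟦ P ⟧ y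
⟦⟧-mono (con c) le = ≤-refl
⟦⟧-mono 𝕏       le = le
⟦⟧-mono (P ⊞ Q) le = +-mono-≤ (⟦⟧-mono P le) (⟦⟧-mono Q le)
⟦⟧-mono (P ⊠ Q) le = *-mono-≤ (⟦⟧-mono P le) (⟦⟧-mono Q le)
⟦⟧-mono (P ⊚ Q) le = ⟦⟧-mono P (⟦⟧-mono Q le)

interchange : ∀ a b c d → a * b * (c * d) ≡ a * c * (b * d)
interchange = solve-∀

^-distribʳ-* : ∀ m n k → (m * n) ^ k ≡ m ^ k * n ^ k
^-distribʳ-* m n zero    = refl
^-distribʳ-* m n (suc k) = trans (cong (m * n *_) (^-distribʳ-* m n k)) (interchange m n (m ^ k) (n ^ k))

-- Powers of `suc x` are at least 1 and grow with the exponent even for x = 0, so a single monomial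
-- absorbs constants, sums and products. Under composition, `suc (⟦ Q ⟧ x)` is at most
-- `suc d * suc x ^ l`, where the extra 1 is absorbed in the same way.
⟦⟧-bound : ∀ P → ∃ λ c → ∃ λ k → ∀ x → ⟦ P ⟧ x ≤ c * suc x ^ k
⟦⟧-bound (con c) = c , 0 , λ x → ≤-reflexive (sym (*-identityʳ c))
⟦⟧-bound 𝕏       = 1 , 1 , λ x → ≤-trans (n≤1+n x) (≤-reflexive (sym (trans (*-identityˡ _) (*-identityʳ _))))
⟦⟧-bound (P ⊞ Q) with ⟦⟧-bound P | ⟦⟧-bound Q
... | c , k , p | d , l , q = c + d , k + l , λ x → begin
  ⟦ P ⟧ x + ⟦ Q ⟧ x                          ≤⟨ +-mono-≤ (p x) (q x) ⟩
  c * suc x ^ k + d * suc x ^ l              ≤⟨ +-mono-≤ (*-monoʳ-≤ c (^-monoʳ-≤ (suc x) (m≤m+n k l)))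
                                                           (*-monoʳ-≤ d (^-monoʳ-≤ (suc x) (m≤n+m l k))) ⟩
  c * suc x ^ (k + l) + d * suc x ^ (k + l)  ≡⟨ sym (*-distribʳ-+ (suc x ^ (k + l)) c d) ⟩
  (c + d) * suc x ^ (k + l)                  ∎
  where open ≤-Reasoning
⟦⟧-bound (P ⊠ Q) with ⟦⟧-bound P | ⟦⟧-bound Q
... | c , k , p | d , l , q = c * d , k + l , λ x → begin
  ⟦ P ⟧ x * ⟦ Q ⟧ x                    ≤⟨ *-mono-≤ (p x) (q x) ⟩
  (c * suc x ^ k) * (d * suc x ^ l)    ≡⟨ interchange c (suc x ^ k) d (suc x ^ l) ⟩
  c * d * (suc x ^ k * suc x ^ l)      ≡⟨ cong (c * d *_) (sym (^-distribˡ-+-* (suc x) k l)) ⟩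
  c * d * suc x ^ (k + l)              ∎
  where open ≤-Reasoning
⟦⟧-bound (P ⊚ Q) with ⟦⟧-bound P | ⟦⟧-bound Q
... | c , k , p | d , l , q = c * suc d ^ k , l * k , λ x → begin
  ⟦ P ⟧ (⟦ Q ⟧ x)                      ≤⟨ p _ ⟩
  c * suc (⟦ Q ⟧ x) ^ k                ≤⟨ *-monoʳ-≤ c (^-monoˡ-≤ k (+-mono-≤ (m^n>0 (suc x) l) (q x))) ⟩
  c * (suc d * suc x ^ l) ^ k          ≡⟨ cong (c *_) (^-distribʳ-* (suc d) (suc x ^ l) k) ⟩
  c * (suc d ^ k * (suc x ^ l) ^ k)    ≡⟨ cong (λ z → c * (suc d ^ k * z)) (^-*-assoc (suc x) l k) ⟩
  c * (suc d ^ k * suc x ^ (l * k))    ≡⟨ sym (*-assoc c _ _) ⟩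
  c * suc d ^ k * suc x ^ (l * k)      ∎
  where open ≤-Reasoning

1≤size : ∀ t → 1 ≤ size t
1≤size leaf       = s≤s z≤n
1≤size (node _ _) = s≤s z≤n

size-encodeBool : ∀ b → size (encodeBool b) ≤ 3
size-encodeBool false = s≤s z≤n
size-encodeBool true  = ≤-refl

-- Polynomial-time programs

rename : ∀ {m n} → (Fin m → Fin n) → Exp m → Exp n
rename r (var x)       = var (r x)
rename r nil           = nil
rename r (cons e f)    = cons (rename r e) (rename r f)
rename r (hd e)        = hd (rename r e)
rename r (tl e)        = tl (rename r e)
rename r (cond c e f)  = cond (rename r c) (rename r e) (rename r f)
rename r (bind e f)    = bind (rename r e) (rename (lift 1 r) f)
rename r (while e c b) = while (rename r e) (rename (lift 1 r) c)
                               (rename (lift 1 r) b)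

mutual

  -- Looking up a variable costs 1 wherever it stands, so the time does not change. In use, `r`
  -- sends everything to `zero`: a program runs inside a larger environment and sees only the
  -- innermost variable.
  rename-⇓ : ∀ {m n} {ρ : Vec Tree m} {σ : Vec Tree n} (r : Fin m → Fin n) →
             (∀ x → lookup σ (r x) ≡ lookup ρ x) →
             ∀ {e v t} → ρ ⊢ e ⇓ v ⟨ t ⟩ → σ ⊢ rename r e ⇓ v ⟨ t ⟩
  rename-⇓ {σ = σ} r ok (⇓var {x}) = subst (λ v → σ ⊢ var (r x) ⇓ v ⟨ 1 ⟩) (ok x) ⇓var
  rename-⇓ r ok ⇓nil         = ⇓nil
  rename-⇓ r ok (⇓cons d f)  = ⇓cons (rename-⇓ r ok d) (rename-⇓ r ok f)
  rename-⇓ r ok (⇓hd d)      = ⇓hd (rename-⇓ r ok d)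
  rename-⇓ r ok (⇓tl d)      = ⇓tl (rename-⇓ r ok d)
  rename-⇓ r ok (⇓true c d)  = ⇓true (rename-⇓ r ok c) (rename-⇓ r ok d)
  rename-⇓ r ok (⇓false c d) = ⇓false (rename-⇓ r ok c) (rename-⇓ r ok d)
  rename-⇓ r ok (⇓bind d f)  = ⇓bind (rename-⇓ r ok d) (rename-⇓ _ (λ { zero → refl ; (suc x) → ok x }) f)
  rename-⇓ r ok (⇓while d w) = ⇓while (rename-⇓ r ok d) (rename-while r ok w)

  rename-while : ∀ {m n} {ρ : Vec Tree m} {σ : Vec Tree n} (r : Fin m → Fin n) →
                 (∀ x → lookup σ (r x) ≡ lookup ρ x) →
                 ∀ {c b u v t} → ρ ⊢while c , b from u ⇓ v ⟨ t ⟩ →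
                 σ ⊢while rename (lift 1 r) c
                        , rename (lift 1 r) b from u ⇓ v ⟨ t ⟩
  rename-while r ok (stop c)     = stop (rename-⇓ _ (λ { zero → refl ; (suc x) → ok x }) c)
  rename-while r ok (step c b w) = step (rename-⇓ _ (λ { zero → refl ; (suc x) → ok x }) c)
    (rename-⇓ _ (λ { zero → refl ; (suc x) → ok x }) b) (rename-while r ok w)

infix 4 _⇝_

-- e ⇝ f: some program turns e a into f a in time polynomial in the size of e a.
-- The index type A lets a program be specified on the intended inputs only.
record _⇝_ {A : Set} (e f : A → Tree) : Set where
  constructor computes
  field
    code : Program
    cost : Poly
    -- Time does not bound the size of the result (cons shares its arguments), so both are tracked.
    run  : ∀ a → ∃ λ t → (code on e a ⇓ f a ⟨ t ⟩) × t + size (f a) ≤ ⟦ cost ⟧ (size (e a))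

  size-bound : ∀ a → size (f a) ≤ ⟦ cost ⟧ (size (e a))
  size-bound a = ≤-trans (m≤n+m _ (proj₁ (run a))) (proj₂ (proj₂ (run a)))

open _⇝_

private variable
  A B : Set
  e f g : A → Tree

castᶜ : (∀ a → f a ≡ g a) → e ⇝ f → e ⇝ g
castᶜ {e = e} eq p = computes (code p) (cost p) λ a → let t , d , le = run p a in
  t , subst (λ v → code p on e a ⇓ v ⟨ t ⟩) (eq a) d , subst (λ v → t + size v ≤ _) (eq a) le

at : (h : B → A) → e ⇝ f → (λ b → e (h b)) ⇝ (λ b → f (h b))
at h p = computes (code p) (cost p) (λ b → run p (h b))

idᶜ : e ⇝ e
idᶜ = computes (var zero) (con 1 ⊞ 𝕏) λ a → 1 , ⇓var , ≤-refl

nilᶜ : e ⇝ (λ _ → leaf)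
nilᶜ = computes nil (con 2) λ a → 1 , ⇓nil , ≤-refl

pair : e ⇝ f → e ⇝ g → e ⇝ (λ a → node (f a) (g a))
pair {f = f} {g = g} p q = computes (cons (code p) (code q)) (con 2 ⊞ cost p ⊞ cost q) λ a →
  let s , c , sle = run p a ; t , d , tle = run q a in
  1 + s + t , ⇓cons c d ,
  ≤-trans (≤-reflexive (shuffle s t (size (f a)) (size (g a)))) (+-mono-≤ (+-monoʳ-≤ 2 sle) tle)
  where
  shuffle : ∀ s t u v → 1 + s + t + (1 + u + v) ≡ 2 + (s + u) + (t + v)
  shuffle = solve-∀

size-left : ∀ t → size (left t) ≤ size t
size-left leaf       = ≤-refl
size-left (node l r) = ≤-trans (m≤m+n _ (size r)) (n≤1+n _)

size-right : ∀ t → size (right t) ≤ size t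
size-right leaf       = ≤-refl
size-right (node l r) = ≤-trans (m≤n+m _ (size l)) (n≤1+n _)

fst : e ⇝ (λ a → node (f a) (g a)) → e ⇝ f
fst {f = f} {g = g} p = computes (hd (code p)) (con 1 ⊞ cost p) λ a → let t , d , le = run p a in
  1 + t , ⇓hd d , s≤s (≤-trans (+-monoʳ-≤ t (size-left (node (f a) (g a)))) le)

snd : e ⇝ (λ a → node (f a) (g a)) → e ⇝ g
snd {f = f} {g = g} p = computes (tl (code p)) (con 1 ⊞ cost p) λ a → let t , d , le = run p a in
  1 + t , ⇓tl d , s≤s (≤-trans (+-monoʳ-≤ t (size-right (node (f a) (g a)))) le)

ifᶜ : {b : A → Bool} {f g : A → Tree} → e ⇝ (λ a → encodeBool (b a)) → e ⇝ f → e ⇝ g →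
      e ⇝ (λ a → if b a then f a else g a)
ifᶜ {e = e} {b} {f} {g} c p q = computes code′ cost′ run′
  where
  code′ = cond (code c) (code p) (code q)
  cost′ = con 1 ⊞ cost c ⊞ (cost p ⊞ cost q)
  run′ : ∀ a → ∃ λ t → (code′ on e a ⇓ (if b a then f a else g a) ⟨ t ⟩)
                       × t + size (if b a then f a else g a) ≤ ⟦ cost′ ⟧ (size (e a))
  run′ a with b a | run c a
  ... | true  | s , d , sle = let t , d′ , tle = run p a in 1 + s + t , ⇓true d d′ ,
        ≤-trans (≤-reflexive (+-assoc (1 + s) t _))
                (+-mono-≤ (s≤s (≤-trans (m≤m+n s _) sle)) (≤-trans tle (m≤m+n _ _)))
  ... | false | s , d , sle = let t , d′ , tle = run q a in 1 + s + t , ⇓false d d′ ,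
        ≤-trans (≤-reflexive (+-assoc (1 + s) t _))
                (+-mono-≤ (s≤s (≤-trans (m≤m+n s _) sle)) (≤-trans tle (m≤n+m _ _)))

infixl 5 _⨾_

_⨾_ : e ⇝ f → f ⇝ g → e ⇝ g
_⨾_ {f = f} {g = g} p q = computes (bind (code p) (rename (λ _ → zero) (code q))) (con 1 ⊞ cost p ⊞ cost q ⊚ cost p) λ a →
  let s , c , sle = run p a ; t , d , tle = run q a in
  1 + s + t , ⇓bind c (rename-⇓ (λ _ → zero) (λ { zero → refl }) d) ,
  ≤-trans (≤-reflexive (+-assoc (1 + s) t _))
          (+-mono-≤ (s≤s (≤-trans (m≤m+n s _) sle)) (≤-trans tle (⟦⟧-mono (cost q) (size-bound p a))))

encodeList : {B : Set} → (B → Tree) → List B → Tree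
encodeList enc []       = leaf
encodeList enc (x ∷ xs) = node (enc x) (encodeList enc xs)

-- A loop over a list; rs are the elements still to come, ys those already treated, last one first.
module Loop {A : Set} {B : A → Set} (enc : ∀ a → B a → Tree) (e : A → Tree)
  (h : ∀ a → List (B a) → List (B a) → Tree)
  (body : _⇝_ {Σ A λ a → B a × List (B a) × List (B a)}
              (λ (a , b , rs , ys) → node (node (enc a b) (h a (b ∷ rs) ys)) (e a))
              (λ (a , b , rs , ys) → h a rs (b ∷ ys)))
  where

  len : ∀ {a} → List (B a) → ℕ
  len {a} xs = size (encodeList (enc a) xs)

  -- The innermost variable holds the `state`; the outer one is the input `e a`, which the body
  -- receives in every round.
  test iteration : Exp 2
  test      = hd (var zero)
  iteration = cons (tl (hd (var zero)))
                   (bind (cons (cons (hd (hd (var zero))) (tl (var zero))) (var (suc zero)))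
                         (rename (λ _ → zero) (code body)))

  state : ∀ a → List (B a) → List (B a) → Tree
  state a rs ys = node (encodeList (enc a) rs) (h a rs ys)

  move : ∀ r b y → r + suc (b + y) ≡ suc (b + r + y)
  move = solve-∀

  -- Moving an element from `rs` to `ys` preserves the total size, so `N` is an invariant and one
  -- bound `K` serves all rounds. Besides the body, a round costs 16; the last test costs 3.
  iterate : ∀ a N K →
    (∀ b rs ys → len (b ∷ rs) + len ys ≤ N →
       ⟦ cost body ⟧ (size (node (node (enc a b) (h a (b ∷ rs) ys)) (e a))) ≤ K) →
    ∀ rs ys → len rs + len ys ≤ N → ∃ λ t →
      ((e a ∷ᵛ []ᵛ) ⊢while test , iteration from state a rs ys ⇓ state a [] (rs ʳ++ ys) ⟨ t ⟩)
      × t ≤ 3 + len rs * (16 + K)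
  iterate a N K small []       ys le = 3 , stop (⇓hd ⇓var) , m≤m+n 3 _
  iterate a N K small (b ∷ rs) ys le =
    let t , d , tle = run body (a , b , rs , ys)
        k , w , kle = iterate a N K small rs (b ∷ ys) (≤-trans (≤-reflexive (move (len rs) (size (enc a b)) (len ys))) le)
        t≤K = ≤-trans (m≤m+n t _) (≤-trans tle (small b rs ys le))
    in 1 + 2 + (13 + t) + k ,
       step (⇓hd ⇓var)
            (⇓cons (⇓tl (⇓hd ⇓var))
                   (⇓bind (⇓cons (⇓cons (⇓hd (⇓hd ⇓var)) (⇓tl ⇓var)) ⇓var)
                          (rename-⇓ (λ _ → zero) (λ { zero → refl }) d)))
            w ,
       (begin
         16 + t + k                        ≤⟨ +-mono-≤ (+-monoʳ-≤ 16 t≤K) kle ⟩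
         16 + K + (3 + len rs * (16 + K))  ≡⟨ shift (16 + K) _ ⟩
         3 + suc (len rs) * (16 + K)       ≤⟨ +-monoʳ-≤ 3 (*-monoˡ-≤ (16 + K) (s≤s (m≤n+m (len rs) (size (enc a b))))) ⟩
         3 + len (b ∷ rs) * (16 + K)       ∎)
    where
    open ≤-Reasoning
    shift : ∀ x y → x + (3 + y) ≡ 3 + (x + y)
    shift = solve-∀

  -- The bound `P` on all intermediate values is a hypothesis because the cost of the body only
  -- limits the growth in one round: iterating a polynomial linearly often need not stay polynomial.
  loopᶜ : {xs : ∀ a → List (B a)} →
          e ⇝ (λ a → encodeList (enc a) (xs a)) → e ⇝ (λ a → h a (xs a) []) →
          (P : Poly) → (∀ a rs ys → size (h a rs ys) ≤ ⟦ P ⟧ (size (e a) + (len rs + len ys))) →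
          e ⇝ (λ a → h a [] (reverse (xs a)))
  loopᶜ {xs} list init P h≤ = computes
    (tl (while (cons (code list) (code init)) test iteration)) cost′ λ a →
    let l , c , lle = run list a
        i , d , ile = run init a
        s = size (e a)
        -- The 1 is the size of the initially empty list of treated elements.
        N = ⟦ cost list ⊞ con 1 ⟧ s
        n≤ = size-bound list a
        t , w , tle = iterate a N (⟦ Kᴾ ⟧ s)
          (λ b rs ys le → ⟦⟧-mono (cost body) (+-monoˡ-≤ s (s≤s (s≤s (+-mono-≤
             (≤-trans (≤-trans (≤-trans (m≤m+n _ (len rs)) (n≤1+n _)) (m≤m+n _ (len ys))) le)
             (≤-trans (h≤ a (b ∷ rs) ys) (⟦⟧-mono P (+-monoʳ-≤ s le))))))))
          (xs a) [] (+-monoˡ-≤ 1 n≤)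
    in 1 + (1 + (1 + l + i) + t) , ⇓tl (⇓while (⇓cons c d) w) ,
       (begin
         1 + (1 + (1 + l + i) + t) + size (h a [] (reverse (xs a)))
           ≤⟨ +-mono-≤ (s≤s (+-mono-≤ (s≤s (s≤s (+-mono-≤ (≤-trans (m≤m+n l _) lle) (≤-trans (m≤m+n i _) ile))))
                                      (≤-trans tle (+-monoʳ-≤ 3 (*-monoˡ-≤ (16 + ⟦ Kᴾ ⟧ s) n≤)))))
                       (≤-trans (h≤ a [] (reverse (xs a))) (⟦⟧-mono P (+-monoʳ-≤ s (reverse≤ a N (xs a) [] (+-monoˡ-≤ 1 n≤))))) ⟩
         1 + (1 + (1 + ⟦ cost list ⟧ s + ⟦ cost init ⟧ s) + (3 + ⟦ cost list ⟧ s * (16 + ⟦ Kᴾ ⟧ s))) + ⟦ P ⟧ (s + N)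
           ≡⟨ collect (⟦ cost list ⟧ s) (⟦ cost init ⟧ s) (⟦ cost list ⟧ s * (16 + ⟦ Kᴾ ⟧ s)) (⟦ P ⟧ (s + N)) ⟩
         ⟦ cost′ ⟧ s ∎)
    where
    open ≤-Reasoning
    Kᴾ    = cost body ⊚ (con 2 ⊞ (cost list ⊞ con 1 ⊞ P ⊚ (𝕏 ⊞ (cost list ⊞ con 1))) ⊞ 𝕏)
    cost′ = con 6 ⊞ cost list ⊞ cost init ⊞ cost list ⊠ (con 16 ⊞ Kᴾ) ⊞ P ⊚ (𝕏 ⊞ (cost list ⊞ con 1))
    collect : ∀ l i m p → 1 + (1 + (1 + l + i) + (3 + m)) + p ≡ 6 + l + i + m + p
    collect = solve-∀
    reverse≤ : ∀ a N (rs ys : List (B a)) → len rs + len ys ≤ N → 1 + len (rs ʳ++ ys) ≤ N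
    reverse≤ a N []       ys le = le
    reverse≤ a N (b ∷ rs) ys le = reverse≤ a N rs (b ∷ ys) (≤-trans (≤-reflexive (move (len rs) (size (enc a b)) (len ys))) le)

-- Booleans, options and lists

constᶜ : ∀ v → e ⇝ (λ _ → v)
constᶜ leaf       = nilᶜ
constᶜ (node u v) = pair (constᶜ u) (constᶜ v)

andᶜ : (b c : A → Bool) → e ⇝ (λ a → encodeBool (b a)) → e ⇝ (λ a → encodeBool (c a)) →
       e ⇝ (λ a → encodeBool (b a ∧ c a))
andᶜ b c p q = castᶜ (λ a → lemma (b a) (c a)) (ifᶜ p q nilᶜ)
  where
  lemma : ∀ x y → (if x then encodeBool y else leaf) ≡ encodeBool (x ∧ y)
  lemma false y = refl
  lemma true  y = refl

orᶜ : (b c : A → Bool) → e ⇝ (λ a → encodeBool (b a)) → e ⇝ (λ a → encodeBool (c a)) →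
      e ⇝ (λ a → encodeBool (b a ∨ c a))
orᶜ b c p q = castᶜ (λ a → lemma (b a) (c a)) (ifᶜ p (constᶜ (encodeBool true)) q)
  where
  lemma : ∀ x y → (if x then encodeBool true else encodeBool y) ≡ encodeBool (x ∨ y)
  lemma false y = refl
  lemma true  y = refl

notᶜ : (b : A → Bool) → e ⇝ (λ a → encodeBool (b a)) → e ⇝ (λ a → encodeBool (not (b a)))
notᶜ b p = castᶜ (λ a → lemma (b a)) (ifᶜ p nilᶜ (constᶜ (encodeBool true)))
  where
  lemma : ∀ x → (if x then leaf else encodeBool true) ≡ encodeBool (not x)
  lemma false = refl
  lemma true  = refl

if-encᶜ : {C : A → Set} (enc : ∀ a → C a → Tree) (b : A → Bool) (x y : ∀ a → C a) →
          e ⇝ (λ a → encodeBool (b a)) → e ⇝ (λ a → enc a (x a)) → e ⇝ (λ a → enc a (y a)) →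
          e ⇝ (λ a → enc a (if b a then x a else y a))
if-encᶜ enc b x y p q r = castᶜ (λ a → lemma a (b a)) (ifᶜ p q r)
  where
  lemma : ∀ a c → (if c then enc a (x a) else enc a (y a)) ≡ enc a (if c then x a else y a)
  lemma a false = refl
  lemma a true  = refl

maybeᶜ : {C : A → Set} (enc : ∀ a → C a → Tree) (m : ∀ a → Maybe (C a)) (G : ∀ a → Maybe (C a) → Tree) →
         e ⇝ (λ a → encodeMaybe (enc a) (m a)) → e ⇝ (λ a → G a nothing) →
         _⇝_ {Σ A C} (λ (a , c) → node (enc a c) (e a)) (λ (a , c) → G a (just c)) →
         e ⇝ (λ a → G a (m a))
maybeᶜ {A} {e} enc m G p q r = computes code′ cost′ run′
  where
  code′ = cond (code p) (bind (cons (tl (code p)) (var zero)) (rename (λ _ → zero) (code r))) (code q)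
  cost′ = con 1 ⊞ cost p ⊞ (cost q ⊞ (con 4 ⊞ cost p ⊞ cost r ⊚ (con 1 ⊞ cost p ⊞ 𝕏)))
  run′ : ∀ a → ∃ λ t → (code′ on e a ⇓ G a (m a) ⟨ t ⟩) × t + size (G a (m a)) ≤ ⟦ cost′ ⟧ (size (e a))
  run′ a with m a | run p a
  ... | nothing | s , d , sle = let t , d′ , tle = run q a in 1 + s + t , ⇓false d d′ ,
        ≤-trans (≤-reflexive (+-assoc (1 + s) t _))
                (+-mono-≤ (s≤s (≤-trans (m≤m+n s _) sle)) (≤-trans tle (m≤m+n _ _)))
  ... | just c  | s , d , sle = let t , d′ , tle = run r (a , c) in
        1 + s + (1 + (1 + (1 + s) + 1) + t) ,
        ⇓true d (⇓bind (⇓cons (⇓tl d) ⇓var) (rename-⇓ (λ _ → zero) (λ { zero → refl }) d′)) ,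
        (begin
          1 + s + (1 + (1 + (1 + s) + 1) + t) + size (G a (just c))
            ≡⟨ shuffle s t (size (G a (just c))) ⟩
          1 + s + (4 + s + (t + size (G a (just c))))
            ≤⟨ +-mono-≤ (s≤s s≤) (≤-trans (+-mono-≤ (+-monoʳ-≤ 4 s≤) (≤-trans tle (⟦⟧-mono (cost r)
                 (s≤s (+-monoˡ-≤ (size (e a)) c≤))))) (m≤n+m _ (⟦ cost q ⟧ (size (e a))))) ⟩
          ⟦ cost′ ⟧ (size (e a)) ∎)
        where
        open ≤-Reasoning
        s≤ = ≤-trans (m≤m+n s _) sle
        c≤ = ≤-trans (≤-trans (n≤1+n _) (n≤1+n _)) (≤-trans (m≤n+m _ s) sle)
        shuffle : ∀ s t g → 1 + s + (1 + (1 + (1 + s) + 1) + t) + g ≡ 1 + s + (4 + s + (t + g))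
        shuffle = solve-∀

module _ {A : Set} {B : A → Set} (enc : ∀ a → B a → Tree) {e : A → Tree} where

  private
    len : ∀ a → List (B a) → ℕ
    len a xs = size (encodeList (enc a) xs)

  reverseᶜ : {xs : ∀ a → List (B a)} → e ⇝ (λ a → encodeList (enc a) (xs a)) →
             e ⇝ (λ a → encodeList (enc a) (reverse (xs a)))
  reverseᶜ list = Loop.loopᶜ enc e (λ a _ ys → encodeList (enc a) ys) (fst idᶜ) list nilᶜ 𝕏
    (λ a rs ys → ≤-trans (m≤n+m (len a ys) (len a rs)) (m≤n+m _ (size (e a))))

  -- Structural recursion: h is computed from the end of the list.
  recᶜ : {xs : ∀ a → List (B a)} (h : ∀ a → List (B a) → Tree) →
         e ⇝ (λ a → encodeList (enc a) (xs a)) → e ⇝ (λ a → h a []) →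
         _⇝_ {Σ A λ a → B a × List (B a)} (λ (a , b , ys) → node (node (enc a b) (h a ys)) (e a))
             (λ (a , b , ys) → h a (b ∷ ys)) →
         (P : Poly) → (∀ a ys → size (h a ys) ≤ ⟦ P ⟧ (size (e a) + size (encodeList (enc a) ys))) →
         e ⇝ (λ a → h a (xs a))
  recᶜ {xs} h list init body P h≤ = castᶜ (λ a → cong (h a) (reverse-involutive (xs a)))
    (Loop.loopᶜ enc e (λ a _ ys → h a ys) (at (λ (a , b , _ , ys) → a , b , ys) body) (reverseᶜ list) init P
      (λ a rs ys → ≤-trans (h≤ a ys) (⟦⟧-mono P (+-monoʳ-≤ (size (e a)) (m≤n+m (len a ys) (len a rs))))))

  nonemptyᶜ : {xs : ∀ a → List (B a)} → e ⇝ (λ a → encodeList (enc a) (xs a)) →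
              e ⇝ (λ a → encodeBool (not (null (xs a))))
  nonemptyᶜ {xs} p = computes code′ (con 7 ⊞ cost p) run′
    where
    code′ = cond (code p) (cons nil nil) nil
    run′ : ∀ a → ∃ λ t → (code′ on e a ⇓ encodeBool (not (null (xs a))) ⟨ t ⟩)
                         × t + size (encodeBool (not (null (xs a)))) ≤ ⟦ con 7 ⊞ cost p ⟧ (size (e a))
    run′ a with xs a | run p a
    ... | []    | s , d , sle = 1 + s + 1 , ⇓false d ⇓nil ,
          ≤-trans (≤-reflexive (shuffle s)) (+-mono-≤ {3} {7} (s≤s (s≤s (s≤s z≤n))) (≤-trans (m≤m+n s _) sle))
          where shuffle : ∀ s → 1 + s + 1 + 1 ≡ 3 + s
                shuffle = solve-∀
    ... | _ ∷ _ | s , d , sle = 1 + s + 3 , ⇓true d (⇓cons ⇓nil ⇓nil) ,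
          ≤-trans (≤-reflexive (shuffle s)) (+-monoʳ-≤ 7 (≤-trans (m≤m+n s _) sle))
          where shuffle : ∀ s → 1 + s + 3 + 3 ≡ 7 + s
                shuffle = solve-∀

  filterᶜ : {P : ∀ a → B a → Set} (P? : ∀ a → Decidable (P a)) {xs : ∀ a → List (B a)} →
            e ⇝ (λ a → encodeList (enc a) (xs a)) →
            _⇝_ {Σ A B} (λ (a , b) → node (enc a b) (e a)) (λ (a , b) → encodeBool (does (P? a b))) →
            e ⇝ (λ a → encodeList (enc a) (filter (P? a) (xs a)))
  filterᶜ P? {xs} list body = recᶜ (λ a ys → encodeList (enc a) (filter (P? a) ys)) list nilᶜ
    (castᶜ (λ (a , b , ys) → lemma a b ys)
      (ifᶜ {b = λ (a , b , ys) → does (P? a b)} (pair (fst (fst idᶜ)) (snd idᶜ) ⨾ at (λ (a , b , ys) → a , b) body)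
           (fst idᶜ) (snd (fst idᶜ))))
    𝕏 (λ a ys → ≤-trans (bound a ys) (m≤n+m _ (size (e a))))
    where
    lemma : ∀ a b ys → (if does (P? a b) then node (enc a b) (encodeList (enc a) (filter (P? a) ys))
                                         else encodeList (enc a) (filter (P? a) ys))
                       ≡ encodeList (enc a) (filter (P? a) (b ∷ ys))
    lemma a b ys with does (P? a b)
    ... | false = refl
    ... | true  = refl
    bound : ∀ a ys → len a (filter (P? a) ys) ≤ len a ys
    bound a []       = ≤-refl
    bound a (y ∷ ys) with does (P? a y)
    ... | false = ≤-trans (bound a ys) (m≤n+m _ (suc (size (enc a y))))
    ... | true  = s≤s (+-monoʳ-≤ (size (enc a y)) (bound a ys))

  size-++ : ∀ a xs ys → len a (xs ++ ys) ≤ len a xs + len a ys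
  size-++ a []       ys = n≤1+n _
  size-++ a (x ∷ xs) ys = s≤s (≤-trans (+-monoʳ-≤ (size (enc a x)) (size-++ a xs ys)) (≤-reflexive (sym (+-assoc (size (enc a x)) _ _))))

  mapᶜ : {C : A → Set} (enc′ : ∀ a → C a → Tree) {xs : ∀ a → List (B a)} {F : ∀ a → B a → C a} →
         e ⇝ (λ a → encodeList (enc a) (xs a)) →
         _⇝_ {Σ A B} (λ (a , b) → node (enc a b) (e a)) (λ (a , b) → enc′ a (F a b)) →
         e ⇝ (λ a → encodeList (enc′ a) (map (F a) (xs a)))
  mapᶜ enc′ {xs} {F} list body = recᶜ (λ a ys → encodeList (enc′ a) (map (F a) ys)) list nilᶜ
    (pair (pair (fst (fst idᶜ)) (snd idᶜ) ⨾ at (λ (a , b , ys) → a , b) body) (snd (fst idᶜ)))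
    (con 1 ⊞ 𝕏 ⊠ (con 1 ⊞ cost body ⊚ (con 1 ⊞ 𝕏)))
    (λ a ys → ≤-trans (bound a (size (e a) + len a ys) ys (≤-reflexive (+-comm (len a ys) _)))
       (s≤s (*-monoˡ-≤ _ (m≤n+m (len a ys) (size (e a))))))
    where
    bound : ∀ a N ys → len a ys + size (e a) ≤ N →
            size (encodeList (enc′ a) (map (F a) ys)) ≤ 1 + len a ys * (1 + ⟦ cost body ⟧ (1 + N))
    bound a N []       le = s≤s z≤n
    bound a N (y ∷ ys) le = s≤s (begin
      size (enc′ a (F a y)) + size (encodeList (enc′ a) (map (F a) ys))
        ≤⟨ +-mono-≤ (≤-trans (size-bound body (a , y)) (⟦⟧-mono (cost body)
                      (s≤s (≤-trans (+-monoˡ-≤ (size (e a)) (≤-trans (m≤m+n _ (len a ys)) (n≤1+n _))) le))))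
                    (bound a N ys (≤-trans (+-monoˡ-≤ (size (e a)) (m≤n+m (len a ys) (suc (size (enc a y))))) le)) ⟩
      K + (1 + len a ys * (1 + K))      ≡⟨ +-suc K _ ⟩
      suc (len a ys) * (1 + K)          ≤⟨ *-monoˡ-≤ (1 + K) (s≤s (m≤n+m (len a ys) (size (enc a y)))) ⟩
      len a (y ∷ ys) * (1 + K)          ∎)
      where
      open ≤-Reasoning
      K = ⟦ cost body ⟧ (1 + N)

  appendᶜ : {xs ys : ∀ a → List (B a)} →
            e ⇝ (λ a → encodeList (enc a) (xs a)) → e ⇝ (λ a → encodeList (enc a) (ys a)) →
            e ⇝ (λ a → encodeList (enc a) (xs a ++ ys a))
  appendᶜ {xs} {ys} p q = recᶜ (λ a zs → encodeList (enc a) (zs ++ ys a)) p q (fst idᶜ) (cost q ⊞ 𝕏)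
    (λ a zs → ≤-trans (size-++ a zs (ys a)) (≤-trans (≤-reflexive (+-comm (len a zs) _))
      (+-mono-≤ (≤-trans (size-bound q a) (⟦⟧-mono (cost q) (m≤m+n _ _))) (m≤n+m _ (size (e a))))))

module _ {A : Set} {B : A → Set} (enc : ∀ a → B a → Tree) {e : A → Tree} where

  concatᶜ : {xss : ∀ a → List (List (B a))} → e ⇝ (λ a → encodeList (encodeList (enc a)) (xss a)) →
            e ⇝ (λ a → encodeList (enc a) (concat (xss a)))
  concatᶜ p = recᶜ (λ a → encodeList (enc a)) (λ a yss → encodeList (enc a) (concat yss)) p nilᶜ
    (appendᶜ (λ (a , _) → enc a) {xs = λ (_ , ys , _) → ys} {λ (_ , _ , yss) → concat yss} (fst (fst idᶜ)) (snd (fst idᶜ)))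
    𝕏 (λ a yss → ≤-trans (bound a yss) (m≤n+m _ (size (e a))))
    where
    bound : ∀ a yss → size (encodeList (enc a) (concat yss)) ≤ size (encodeList (encodeList (enc a)) yss)
    bound a []         = ≤-refl
    bound a (ys ∷ yss) = ≤-trans (size-++ enc {e} a ys (concat yss))
      (≤-trans (+-monoʳ-≤ _ (bound a yss)) (n≤1+n _))

  -- The list of pairs exists only in the specification; a program is given its two columns. The
  -- loop runs along the first column and carries the rest of the second one in its state.
  zipᶜ : {zs : ∀ a → List (B a × Bool)} →
         e ⇝ (λ a → encodeList (λ (b , _) → enc a b) (zs a)) → e ⇝ (λ a → encodeList (λ (_ , c) → encodeBool c) (zs a)) →
         e ⇝ (λ a → encodeList (λ (b , c) → node (enc a b) (encodeBool c)) (zs a))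
  zipᶜ {zs} p q = castᶜ (λ a → cong (encodeList _) (reverse-involutive (zs a)))
    (reverseᶜ (λ a (b , c) → node (enc a b) (encodeBool c)) {xs = λ a → reverse (zs a)} (snd
      (Loop.loopᶜ (λ a (b , c) → enc a b) e
        (λ a rs ys → node (encodeList (λ (_ , c) → encodeBool c) rs) (encodeList (λ (b , c) → node (enc a b) (encodeBool c)) ys))
        (pair (snd (fst (snd (fst idᶜ)))) (pair (pair (fst (fst idᶜ)) (fst (fst (snd (fst idᶜ))))) (snd (snd (fst idᶜ)))))
        p (pair q nilᶜ) (con 1 ⊞ con 5 ⊠ 𝕏)
        (λ a rs ys → s≤s (≤-trans (+-mono-≤ (bits a rs) (pairs a ys))
          (≤-trans (≤-reflexive (sym (*-distribˡ-+ 5 (len a rs) (len a ys)))) (*-monoʳ-≤ 5 (m≤n+m _ (size (e a))))))))))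
    where
    len : ∀ a → List (B a × Bool) → ℕ
    len a rs = size (encodeList (λ (b , _) → enc a b) rs)
    grow : ∀ s t → 1 + (1 + s + 3) + 5 * t ≤ 5 * (1 + s + t)
    grow s t = ≤-trans (m≤m+n _ (4 * s)) (≤-reflexive (lemma s t))
      where lemma : ∀ s t → 1 + (1 + s + 3) + 5 * t + 4 * s ≡ 5 * (1 + s + t)
            lemma = solve-∀
    bits : ∀ a (rs : List (B a × Bool)) → size (encodeList (λ (_ , c) → encodeBool c) rs) ≤ 5 * len a rs
    bits a []             = s≤s z≤n
    bits a ((b , c) ∷ rs) = ≤-trans
      (+-mono-≤ (s≤s (≤-trans (size-encodeBool c) (≤-trans (m≤n+m 3 (size (enc a b))) (n≤1+n _)))) (bits a rs)) (grow (size (enc a b)) _)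
    pairs : ∀ a (rs : List (B a × Bool)) → size (encodeList (λ (b , c) → node (enc a b) (encodeBool c)) rs) ≤ 5 * len a rs
    pairs a []             = s≤s z≤n
    pairs a ((b , c) ∷ rs) = ≤-trans
      (+-mono-≤ (s≤s (s≤s (+-monoʳ-≤ (size (enc a b)) (size-encodeBool c)))) (pairs a rs)) (grow (size (enc a b)) _)

module _ {A : Set} {B C : A → Set} (enc : ∀ a → B a → Tree) (enc′ : ∀ a → C a → Tree) {e : A → Tree} where

  productᶜ : {xs : ∀ a → List (B a)} {ys : ∀ a → List (C a)} →
             e ⇝ (λ a → encodeList (enc a) (xs a)) → e ⇝ (λ a → encodeList (enc′ a) (ys a)) →
             e ⇝ (λ a → encodeList (λ (x , y) → node (enc a x) (enc′ a y)) (cartesianProduct (xs a) (ys a)))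
  productᶜ {xs} {ys} p q = castᶜ (λ a → cong (encodeList _) (lemma (xs a) (ys a)))
    (concatᶜ encP {xss = λ a → map (λ x → map (x ,_) (ys a)) (xs a)}
      (mapᶜ enc (λ a → encodeList (encP a)) p
        (mapᶜ (λ (a , _) → enc′ a) (λ (a , _) → encP a) {xs = λ (a , _) → ys a} {F = λ (_ , x) → x ,_}
          (snd idᶜ ⨾ at proj₁ q) (pair (fst (snd idᶜ)) (fst idᶜ)))))
    where
    encP : ∀ a → B a × C a → Tree
    encP a (x , y) = node (enc a x) (enc′ a y)
    lemma : {U V : Set} (xs : List U) (ys : List V) → concat (map (λ x → map (x ,_) ys) xs) ≡ cartesianProduct xs ys
    lemma []       ys = refl
    lemma (x ∷ xs) ys = cong (map (x ,_) ys ++_) (lemma xs ys)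

-- Numbers

-- In the notation of `ℕᵇ` this puts one digit in front (least significant first), so it is a
-- strictly larger number at constant cost. All fresh endpoints are made this way.
odd : ℕ → ℕ
odd x = suc (2 * x)

n<odd : ∀ n → n < odd n
n<odd n = s≤s (m≤m+n n _)

encodeℕ-odd : ∀ x → encodeℕ (odd x) ≡ node (encodeBool true) (encodeℕ x)
encodeℕ-odd x = cong encodeℕᵇ (trans (cong (fromℕ ∘ odd) (sym (toℕ-fromℕ x))) (fromℕ-toℕ 1+[2 fromℕ x ]))

oddᶜ : (x : A → ℕ) → e ⇝ (λ a → encodeℕ (x a)) → e ⇝ (λ a → encodeℕ (odd (x a)))
oddᶜ x p = castᶜ (λ a → sym (encodeℕ-odd (x a))) (pair (constᶜ (encodeBool true)) p)

digits : ℕᵇ → List Bool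
digits zeroᵇ    = []
digits 2[1+ x ] = false ∷ digits x
digits 1+[2 x ] = true ∷ digits x

encode-digits : ∀ x → encodeList encodeBool (digits x) ≡ encodeℕᵇ x
encode-digits zeroᵇ    = refl
encode-digits 2[1+ x ] = cong (node _) (encode-digits x)
encode-digits 1+[2 x ] = cong (node _) (encode-digits x)

infixr 7 _⊙ᵇ_ _⊙_

_⊙ᵇ_ : ℕᵇ → ℕᵇ → ℕᵇ
zeroᵇ    ⊙ᵇ y = y
2[1+ x ] ⊙ᵇ y = 2[1+ x ⊙ᵇ y ]
1+[2 x ] ⊙ᵇ y = 1+[2 x ⊙ᵇ y ]

-- Juxtaposition of binary notations: a cheap bound for sums and products.
_⊙_ : ℕ → ℕ → ℕ
x ⊙ y = toℕ (fromℕ x ⊙ᵇ fromℕ y)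

digits-⊙ : ∀ x y → digits (x ⊙ᵇ y) ≡ digits x ++ digits y
digits-⊙ zeroᵇ    y = refl
digits-⊙ 2[1+ x ] y = cong (false ∷_) (digits-⊙ x y)
digits-⊙ 1+[2 x ] y = cong (true ∷_) (digits-⊙ x y)

⊙ᶜ : (x y : A → ℕ) → e ⇝ (λ a → encodeℕ (x a)) → e ⇝ (λ a → encodeℕ (y a)) → e ⇝ (λ a → encodeℕ (x a ⊙ y a))
⊙ᶜ x y p q = castᶜ (λ a → lemma (fromℕ (x a)) (fromℕ (y a)))
  (appendᶜ (λ _ → encodeBool) {xs = λ a → digits (fromℕ (x a))} {λ a → digits (fromℕ (y a))}
    (castᶜ (λ a → sym (encode-digits (fromℕ (x a)))) p) (castᶜ (λ a → sym (encode-digits (fromℕ (y a)))) q))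
  where
  lemma : ∀ x y → encodeList encodeBool (digits x ++ digits y) ≡ encodeℕ (toℕ (x ⊙ᵇ y))
  lemma x y = trans (cong (encodeList encodeBool) (sym (digits-⊙ x y)))
    (trans (encode-digits (x ⊙ᵇ y)) (cong encodeℕᵇ (sym (fromℕ-toℕ (x ⊙ᵇ y)))))

size-⊙ : ∀ x y → size (encodeℕ (x ⊙ y)) ≤ size (encodeℕ x) + size (encodeℕ y)
size-⊙ x y = ≤-trans (≤-reflexive (cong (size ∘ encodeℕᵇ) (fromℕ-toℕ (fromℕ x ⊙ᵇ fromℕ y)))) (lemma (fromℕ x) (fromℕ y))
  where
  lemma : ∀ x y → size (encodeℕᵇ (x ⊙ᵇ y)) ≤ size (encodeℕᵇ x) + size (encodeℕᵇ y)
  lemma zeroᵇ    y = n≤1+n _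
  lemma 2[1+ x ] y = +-monoʳ-≤ 2 (lemma x y)
  lemma 1+[2 x ] y = +-monoʳ-≤ 4 (lemma x y)

-- Each digit put in front doubles what follows it, so `y` is counted at least once in every step of
-- the induction on the digits of `x`.
+≤⊙ : ∀ x y → x + y ≤ x ⊙ y
+≤⊙ x y = subst₂ (λ u v → u + v ≤ x ⊙ y) (toℕ-fromℕ x) (toℕ-fromℕ y) (lemma (fromℕ x) (fromℕ y))
  where
  open ≤-Reasoning
  r₁ : ∀ a c → 2 * suc a + c + c ≡ 2 * suc (a + c)
  r₁ = solve-∀
  r₂ : ∀ a c → suc (2 * a) + c + c ≡ suc (2 * (a + c))
  r₂ = solve-∀
  lemma : ∀ x y → toℕ x + toℕ y ≤ toℕ (x ⊙ᵇ y)
  lemma zeroᵇ    y = ≤-refl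
  lemma 2[1+ x ] y = ≤-trans (m≤m+n _ (toℕ y)) (≤-trans (≤-reflexive (r₁ (toℕ x) (toℕ y))) (*-monoʳ-≤ 2 (s≤s (lemma x y))))
  lemma 1+[2 x ] y = ≤-trans (m≤m+n _ (toℕ y)) (≤-trans (≤-reflexive (r₂ (toℕ x) (toℕ y))) (s≤s (*-monoʳ-≤ 2 (lemma x y))))

-- If `x` has k digits, then `x + 2` is at most twice 2^k, and `y` is multiplied by 2^k in the
-- juxtaposition. The 2 is the offset that turns n ↦ 2n + 2 into an exact doubling, which makes the
-- induction work.
*≤⊙ : ∀ x y → x * y ≤ 2 * (x ⊙ y)
*≤⊙ x y = ≤-trans (*-monoˡ-≤ y (m≤n+m x 2))
  (subst₂ (λ u v → (2 + u) * v ≤ 2 * (x ⊙ y)) (toℕ-fromℕ x) (toℕ-fromℕ y) (lemma (fromℕ x) (fromℕ y)))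
  where
  r₁ : ∀ a c → (2 + 2 * suc a) * c ≡ 2 * ((2 + a) * c)
  r₁ = solve-∀
  r₂ : ∀ a c → (2 + suc (2 * a)) * c + c ≡ 2 * ((2 + a) * c)
  r₂ = solve-∀
  lemma : ∀ x y → (2 + toℕ x) * toℕ y ≤ 2 * toℕ (x ⊙ᵇ y)
  lemma zeroᵇ    y = ≤-refl
  lemma 2[1+ x ] y = ≤-trans (≤-reflexive (r₁ (toℕ x) (toℕ y)))
    (*-monoʳ-≤ 2 (≤-trans (lemma x y) (*-monoʳ-≤ 2 (n≤1+n _))))
  lemma 1+[2 x ] y = ≤-trans (m≤m+n _ (toℕ y)) (≤-trans (≤-reflexive (r₂ (toℕ x) (toℕ y)))
    (*-monoʳ-≤ 2 (≤-trans (lemma x y) (n≤1+n _))))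

-- Weights

Weight : Set
Weight = Σ ℚ (0ℚ ≤ℚ_)

encodeWeight : Weight → Tree
encodeWeight (q , _) = encodeℚ q

∑ : List Weight → ℚ
∑ []             = 0ℚ
∑ ((q , _) ∷ qs) = q +ℚ ∑ qs

+-cancelʳ-≤ℚ : ∀ r {p q} → p +ℚ r ≤ℚ q +ℚ r → p ≤ℚ q
+-cancelʳ-≤ℚ r {p} {q} le = ℚ.≮⇒≥ λ q<p → ℚ.<-irrefl refl (ℚ.<-≤-trans (ℚ.+-monoˡ-< r q<p) le)

-- The fraction is in lowest terms by construction, so no program ever has to reduce one.
natural : ℕ → Weight
natural n = mkℚ (+ n) 0 (Coprimality.sym (Coprimality.1-coprimeTo n)) , ℚ.nonNegative⁻¹ _

naturalᶜ : (x : A → ℕ) → e ⇝ (λ a → encodeℕ (x a)) → e ⇝ (λ a → encodeWeight (natural (x a)))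
naturalᶜ x p = pair (pair nilᶜ p) (constᶜ (encodeℕ 1))

-- The value is 1/(m + 1), since `mkℚ` takes the predecessor of the denominator.
unitFraction : ℕ → Weight
unitFraction m = mkℚ (+ 1) m (Coprimality.1-coprimeTo (suc m)) , ℚ.nonNegative⁻¹ _

0<unitFraction : ∀ m → 0ℚ <ℚ proj₁ (unitFraction m)
0<unitFraction m = ℚ.positive⁻¹ _

unitFractionᶜ : (x : A → ℕ) → e ⇝ (λ a → encodeℕ (suc (x a))) → e ⇝ (λ a → encodeWeight (unitFraction (x a)))
unitFractionᶜ x p = pair (constᶜ (encodeℤ (+ 1))) p

natural-+ : ∀ m n → proj₁ (natural m) +ℚ proj₁ (natural n) ≡ proj₁ (natural (m + n))
natural-+ m n = ℚ.toℚᵘ-injective (ℚᵘ.≃-trans (ℚ.toℚᵘ-homo-+ (proj₁ (natural m)) (proj₁ (natural n))) (ℚᵘ.*≡* (lemma (+ m) (+ n))))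
  where
  lemma : ∀ x y → (x ℤ.* + 1 ℤ.+ y ℤ.* + 1) ℤ.* + 1 ≡ (x ℤ.+ y) ℤ.* + 1
  lemma = ℤ-Solver.solve-∀

natural-mono : ∀ {m n} → m ≤ n → proj₁ (natural m) ≤ℚ proj₁ (natural n)
natural-mono m≤n = ℚ.*≤* (ℤ.*-monoʳ-≤-nonNeg (+ 1) (ℤ.+≤+ m≤n))

natural-cancel : ∀ {m n} → proj₁ (natural m) ≤ℚ proj₁ (natural n) → m ≤ n
natural-cancel (ℚ.*≤* le) = ℤ.drop‿+≤+ (ℤ.*-cancelʳ-≤-pos _ _ (+ 1) le)

≤natural : ∀ q → q ≤ℚ proj₁ (natural ℤ.∣ ↥ q ∣)
≤natural (mkℚ (+ n)    d c) = ℚ.*≤* (ℤ.*-monoˡ-≤-nonNeg (+ n) {+ 1} {+ suc d} (ℤ.+≤+ (s≤s z≤n)))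
≤natural (mkℚ -[1+ n ] d c) = ℚ.*≤* ℤ.-≤+

-- An integer upper bound for `∑` that is found without adding fractions: a weight is at most its
-- numerator, and `_⊙_` dominates addition.
numerators : List Weight → ℕ
numerators []             = 0
numerators ((q , _) ∷ qs) = ℤ.∣ ↥ q ∣ ⊙ numerators qs

∑≤numerators : ∀ qs → ∑ qs ≤ℚ proj₁ (natural (numerators qs))
∑≤numerators []             = ℚ.≤-refl
∑≤numerators ((q , _) ∷ qs) = ℚ.≤-trans (ℚ.+-mono-≤ (≤natural q) (∑≤numerators qs))
  (ℚ.≤-trans (ℚ.≤-reflexive (natural-+ ℤ.∣ ↥ q ∣ (numerators qs))) (natural-mono (+≤⊙ ℤ.∣ ↥ q ∣ (numerators qs))))

isNegative : ℚ → Bool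
isNegative (mkℚ (+ _)    _ _) = false
isNegative (mkℚ -[1+ _ ] _ _) = true

-- Jobs cannot have negative weights, so `u ≤ v + l` is tested by moving the negative part of `l` to
-- the left-hand side.
positivePart negativePart : ℚ → Weight
positivePart q = if isNegative q then natural 0 else (ℚ.∣ q ∣ , ℚ.0≤∣p∣ q)
negativePart q = if isNegative q then (ℚ.∣ q ∣ , ℚ.0≤∣p∣ q) else natural 0

positivePart≡ : ∀ q → proj₁ (positivePart q) ≡ q +ℚ proj₁ (negativePart q)
positivePart≡ q@(mkℚ (+ _)    _ _) = sym (ℚ.+-identityʳ q)
positivePart≡ q@(mkℚ -[1+ _ ] _ _) = sym (ℚ.+-inverseʳ q)

isNegativeᶜ : (q : A → ℚ) → e ⇝ (λ a → encodeℚ (q a)) → e ⇝ (λ a → encodeBool (isNegative (q a)))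
isNegativeᶜ q p = castᶜ (λ a → lemma (q a)) (fst (fst p))
  where
  lemma : ∀ q → encodeSign (ℤ.sign (↥ q)) ≡ encodeBool (isNegative q)
  lemma (mkℚ (+ _)    _ _) = refl
  lemma (mkℚ -[1+ _ ] _ _) = refl

absoluteᶜ : (q : A → ℚ) → e ⇝ (λ a → encodeℚ (q a)) → e ⇝ (λ a → encodeWeight (ℚ.∣ q a ∣ , ℚ.0≤∣p∣ (q a)))
absoluteᶜ q p = castᶜ (λ a → lemma (q a)) (pair (pair nilᶜ (snd (fst p))) (snd p))
  where
  lemma : ∀ q → node (node leaf (encodeℕ ℤ.∣ ↥ q ∣)) (encodeℕ (↧ₙ q)) ≡ encodeℚ ℚ.∣ q ∣
  lemma (mkℚ _ _ _) = refl

positivePartᶜ : (q : A → ℚ) → e ⇝ (λ a → encodeℚ (q a)) → e ⇝ (λ a → encodeWeight (positivePart (q a)))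
positivePartᶜ q p = if-encᶜ (λ _ → encodeWeight) (isNegative ∘ q) (λ a → natural 0) (λ a → ℚ.∣ q a ∣ , ℚ.0≤∣p∣ (q a))
  (isNegativeᶜ q p) (constᶜ (encodeWeight (natural 0))) (absoluteᶜ q p)

negativePartᶜ : (q : A → ℚ) → e ⇝ (λ a → encodeℚ (q a)) → e ⇝ (λ a → encodeWeight (negativePart (q a)))
negativePartᶜ q p = if-encᶜ (λ _ → encodeWeight) (isNegative ∘ q) (λ a → ℚ.∣ q a ∣ , ℚ.0≤∣p∣ (q a)) (λ a → natural 0)
  (isNegativeᶜ q p) (absoluteᶜ q p) (constᶜ (encodeWeight (natural 0)))

-- Distinct fractions differ by at least the inverse of the product of their denominators.
gap : ∀ u v l m → ↧ₙ v * ↧ₙ l * ↧ₙ u ≤ m → u ≤ℚ v +ℚ l +ℚ proj₁ (unitFraction m) → u ≤ℚ v +ℚ l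
gap u@(mkℚ _ _ _) v@(mkℚ _ _ _) l@(mkℚ _ _ _) m small le = ℚ.≮⇒≥ λ lt → contradiction small (<⇒≱ (bound lt))
  where
  ε = proj₁ (unitFraction m)
  N = ↥ v ℤ.* + ↧ₙ l ℤ.+ ↥ l ℤ.* + ↧ₙ v
  D = + (↧ₙ v * ↧ₙ l)
  U = + ↧ₙ u
  M = + suc m
  lt′ : v +ℚ l <ℚ u → N ℤ.* U ℤ.< ↥ u ℤ.* D
  lt′ lt with ℚᵘ.<-respˡ-≃ (ℚ.toℚᵘ-homo-+ v l) (ℚ.toℚᵘ-mono-< lt)
  ... | ℚᵘ.*<* x = x
  le′ : ↥ u ℤ.* + (↧ₙ v * ↧ₙ l * suc m) ℤ.≤ (N ℤ.* M ℤ.+ + 1 ℤ.* D) ℤ.* U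
  le′ with ℚᵘ.≤-respʳ-≃ (ℚᵘ.≃-trans (ℚ.toℚᵘ-homo-+ (v +ℚ l) ε) (ℚᵘ.+-congˡ (toℚᵘ ε) (ℚ.toℚᵘ-homo-+ v l))) (ℚ.toℚᵘ-mono-≤ le)
  ... | ℚᵘ.*≤* x = x
  bound : v +ℚ l <ℚ u → m < ↧ₙ v * ↧ₙ l * ↧ₙ u
  -- Here `N / D` is the unreduced sum of `v` and `l`. From `lt′` follows `N * U + 1 ≤ ↥ u * D`;
  -- multiplied by `M` and combined with `le′`, this leaves `M ≤ D * U`.
  bound lt = ℤ.drop‿+≤+ (ℤ.≮⇒≥ λ D<M → ℤ.<⇒≱ (ℤ.+-monoʳ-< (N ℤ.* U ℤ.* M) D<M) (begin
    N ℤ.* U ℤ.* M ℤ.+ M                            ≡⟨ r₁ (N ℤ.* U) M ⟩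
    ℤ.suc (N ℤ.* U) ℤ.* M                          ≤⟨ ℤ.*-monoʳ-≤-nonNeg M (ℤ.i<j⇒suc[i]≤j (lt′ lt)) ⟩
    ↥ u ℤ.* D ℤ.* M                                ≡⟨ ℤ.*-assoc (↥ u) D M ⟩
    ↥ u ℤ.* (D ℤ.* M)                              ≡⟨ cong (↥ u ℤ.*_) (sym (ℤ.pos-* (↧ₙ v * ↧ₙ l) (suc m))) ⟩
    ↥ u ℤ.* + (↧ₙ v * ↧ₙ l * suc m)                ≤⟨ le′ ⟩
    (N ℤ.* M ℤ.+ + 1 ℤ.* D) ℤ.* U                  ≡⟨ r₂ N M D U ⟩
    N ℤ.* U ℤ.* M ℤ.+ D ℤ.* U                      ≡⟨ cong (λ z → N ℤ.* U ℤ.* M ℤ.+ z) (sym (ℤ.pos-* (↧ₙ v * ↧ₙ l) (↧ₙ u))) ⟩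
    N ℤ.* U ℤ.* M ℤ.+ + (↧ₙ v * ↧ₙ l * ↧ₙ u)       ∎))
    where
    open ℤ.≤-Reasoning
    r₁ : ∀ x y → x ℤ.* y ℤ.+ y ≡ (+ 1 ℤ.+ x) ℤ.* y
    r₁ = ℤ-Solver.solve-∀
    r₂ : ∀ n m d u → (n ℤ.* m ℤ.+ + 1 ℤ.* d) ℤ.* u ≡ n ℤ.* u ℤ.* m ℤ.+ d ℤ.* u
    r₂ = ℤ-Solver.solve-∀

𝕏^_ : ℕ → Poly
𝕏^ zero  = con 1
𝕏^ suc k = 𝕏 ⊠ 𝕏^ k

⟦𝕏^⟧ : ∀ k x → ⟦ 𝕏^ k ⟧ x ≡ x ^ k
⟦𝕏^⟧ zero    x = refl
⟦𝕏^⟧ (suc k) x = cong (x *_) (⟦𝕏^⟧ k x)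

size-subset : ∀ {n} (enc : B → Tree) (v : Vec B n) (S : Subset n) → size (encodeSubset S) ≤ 4 * size (encodeVec enc v)
size-subset enc []ᵛ       []ᵛ      = s≤s z≤n
size-subset enc (x ∷ᵛ v) (b ∷ᵛ S) = begin
  1 + size (encodeBool b) + size (encodeSubset S)        ≤⟨ +-mono-≤ (s≤s (size-encodeBool b)) (size-subset enc v S) ⟩
  4 * 1 + 4 * size (encodeVec enc v)                     ≡⟨ sym (*-distribˡ-+ 4 1 _) ⟩
  4 * (1 + size (encodeVec enc v))                       ≤⟨ *-monoʳ-≤ 4 (s≤s (m≤n+m _ (size (enc x)))) ⟩
  4 * size (encodeVec enc (x ∷ᵛ v))                      ∎
  where
  open ≤-Reasoning

-- Sublists given by subsets of positions

pick : (L : List B) → Subset (length L) → List B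
pick []       []ᵛ          = []
pick (x ∷ L) (true  ∷ᵛ S) = x ∷ pick L S
pick (x ∷ L) (false ∷ᵛ S) = pick L S

pick-⊆ : (L : List B) (S : Subset (length L)) → pick L S ⊆ L
pick-⊆ []      []ᵛ          = []
pick-⊆ (x ∷ L) (true  ∷ᵛ S) = refl ∷ pick-⊆ L S
pick-⊆ (x ∷ L) (false ∷ᵛ S) = x ∷ʳ pick-⊆ L S

positions : {T L : List B} → T ⊆ L → ∃ λ S → pick L S ≡ T
positions []         = []ᵛ , refl
positions (y ∷ʳ T⊆L) = let S , eq = positions T⊆L in false ∷ᵛ S , eq
positions (refl ∷ T⊆L) = let S , eq = positions T⊆L in true ∷ᵛ S , cong (_ ∷_) eq

zipBits : (L : List B) → Subset (length L) → List (B × Bool)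
zipBits []      []ᵛ      = []
zipBits (x ∷ L) (b ∷ᵛ S) = (x , b) ∷ zipBits L S

encode-zip₁ : (enc : B → Tree) (L : List B) (S : Subset (length L)) → encodeList enc L ≡ encodeList (λ (b , _) → enc b) (zipBits L S)
encode-zip₁ enc []      []ᵛ      = refl
encode-zip₁ enc (x ∷ L) (b ∷ᵛ S) = cong (node _) (encode-zip₁ enc L S)

encode-zip₂ : (L : List B) (S : Subset (length L)) → encodeSubset S ≡ encodeList (λ (_ , c) → encodeBool c) (zipBits L S)
encode-zip₂ []      []ᵛ      = refl
encode-zip₂ (x ∷ L) (b ∷ᵛ S) = cong (node _) (encode-zip₂ L S)

filter-zip : (L : List B) (S : Subset (length L)) → map proj₁ (filterᵇ proj₂ (zipBits L S)) ≡ pick L S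
filter-zip []      []ᵛ          = refl
filter-zip (x ∷ L) (true  ∷ᵛ S) = cong (x ∷_) (filter-zip L S)
filter-zip (x ∷ L) (false ∷ᵛ S) = filter-zip L S

-- Interval Scheduling with Colors on lists

Compatible : ColoredJob → ColoredJob → Set
Compatible j k = ColoredJob.red j ⊥ ColoredJob.whole k × ColoredJob.red k ⊥ ColoredJob.whole j

jobWeight : ColoredJob → Weight
jobWeight j = ColoredJob.weight j , ColoredJob.0≤weight j

module _ (job : B → ColoredJob) where

  -- The jobs are images of labels, so that a solution can be read back as a list of labels.
  instanceOf : List B → ColoredInstance
  instanceOf L = record { n = length L ; jobs = Vec.map job (fromList L) }

  encode-instance : ∀ L → encodeList encodeColoredJob (map job L) ≡ encodeColoredInstance (instanceOf L)
  encode-instance []      = refl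
  encode-instance (x ∷ L) = cong (node _) (encode-instance L)

  value-pick : ∀ L S → Colored.w (instanceOf L) S ≡ ∑ (map (jobWeight ∘ job) (pick L S))
  value-pick []      []ᵛ          = refl
  value-pick (x ∷ L) (true  ∷ᵛ S) = cong (ColoredJob.weight (job x) +ℚ_) (value-pick L S)
  value-pick (x ∷ L) (false ∷ᵛ S) = trans (ℚ.+-identityˡ _) (value-pick L S)

  All-pick : ∀ (P : ColoredJob → Set) L S → (∀ k → k ∈ S → P (lookup (Vec.map job (fromList L)) k)) → All (P ∘ job) (pick L S)
  All-pick P []      []ᵛ          p = []
  All-pick P (x ∷ L) (true  ∷ᵛ S) p = p zero here ∷ All-pick P L S (λ k → p (suc k) ∘ there)
  All-pick P (x ∷ L) (false ∷ᵛ S) p = All-pick P L S (λ k → p (suc k) ∘ there)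

  lookup-pick : ∀ (P : ColoredJob → Set) L S → All (P ∘ job) (pick L S) → ∀ k → k ∈ S → P (lookup (Vec.map job (fromList L)) k)
  lookup-pick P (x ∷ L) (true  ∷ᵛ S) (p ∷ ps) zero    here        = p
  lookup-pick P (x ∷ L) (true  ∷ᵛ S) (p ∷ ps) (suc k) (there k∈S) = lookup-pick P L S ps k k∈S
  lookup-pick P (x ∷ L) (false ∷ᵛ S) ps       (suc k) (there k∈S) = lookup-pick P L S ps k k∈S

  feasible⇒compatible : ∀ L S → Colored.Feasible (instanceOf L) S → AllPairs (Compatible on job) (pick L S)
  feasible⇒compatible []      []ᵛ          F = []
  feasible⇒compatible (x ∷ L) (true  ∷ᵛ S) F =
    All-pick (Compatible (job x)) L S (λ k k∈S → F zero (suc k) here (there k∈S) λ ())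
    ∷ feasible⇒compatible L S (λ j k j∈S k∈S j≢k → F (suc j) (suc k) (there j∈S) (there k∈S) (j≢k ∘ Fin.suc-injective))
  feasible⇒compatible (x ∷ L) (false ∷ᵛ S) F =
    feasible⇒compatible L S (λ j k j∈S k∈S j≢k → F (suc j) (suc k) (there j∈S) (there k∈S) (j≢k ∘ Fin.suc-injective))

  compatible⇒feasible : ∀ L S → AllPairs (Compatible on job) (pick L S) → Colored.Feasible (instanceOf L) S
  compatible⇒feasible (x ∷ L) (true ∷ᵛ S) (p ∷ ps) zero    zero    j∈S k∈S j≢k = contradiction refl j≢k
  compatible⇒feasible (x ∷ L) (true ∷ᵛ S) (p ∷ ps) zero    (suc k) j∈S (there k∈S) j≢k = lookup-pick (Compatible (job x)) L S p k k∈S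
  compatible⇒feasible (x ∷ L) (true ∷ᵛ S) (p ∷ ps) (suc j) zero    (there j∈S) k∈S j≢k = swap (lookup-pick (Compatible (job x)) L S p j j∈S)
  compatible⇒feasible (x ∷ L) (true ∷ᵛ S) (p ∷ ps) (suc j) (suc k) (there j∈S) (there k∈S) j≢k =
    compatible⇒feasible L S ps j k j∈S k∈S (j≢k ∘ cong suc)
  compatible⇒feasible (x ∷ L) (false ∷ᵛ S) ps (suc j) (suc k) (there j∈S) (there k∈S) j≢k =
    compatible⇒feasible L S ps j k j∈S k∈S (j≢k ∘ cong suc)

-- The assumed algorithm as an oracle

module Oracle (solvable : PolynomialTimeSolvable IntervalSchedulingWithColors) where

  open MaximizationProblem IntervalSchedulingWithColors using (Optimal)
  open ColoredInstance using (n)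

  private
    program = proj₁ solvable
    c       = proj₁ (proj₂ solvable)
    k       = proj₁ (proj₂ (proj₂ solvable))

  -- The answer `nothing` cannot occur, because the empty set of jobs is always feasible.
  solution : ∀ I → Σ (Subset (n I)) λ S → ∃ λ t →
    (program on encodeColoredInstance I ⇓ node leaf (encodeSubset S) ⟨ t ⟩)
    × t ≤ c * size (encodeColoredInstance I) ^ k
    × Optimal {I} S
  solution I with proj₂ (proj₂ (proj₂ solvable)) I
  ... | just S  , answer             = S , answer
  ... | nothing , _ , _ , _ , none = contradiction (λ j k j∈∅ → contradiction j∈∅ ∉⊥) (none ∅)

  answer : ∀ I → Subset (n I)
  answer I = proj₁ (solution I)

  optimal : ∀ I → Optimal {I} (answer I)
  optimal I = proj₂ (proj₂ (proj₂ (proj₂ (solution I))))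

  answerᶜ : encodeColoredInstance ⇝ (λ I → encodeSubset (answer I))
  answerᶜ = snd {f = λ _ → leaf} (computes program (con c ⊠ 𝕏^ k ⊞ (con 2 ⊞ con 4 ⊠ 𝕏)) λ I →
    let S , t , d , le , _ = solution I in
    t , d , +-mono-≤ (≤-trans le (≤-reflexive (cong (c *_) (sym (⟦𝕏^⟧ k _)))))
                     (s≤s (s≤s (size-subset encodeColoredJob (ColoredInstance.jobs I) S))))

  module _ (job : B → ColoredJob) (L : List B) where

    best : List B
    best = pick L (answer (instanceOf job L))

    best-⊆ : best ⊆ L
    best-⊆ = pick-⊆ L _

    best-compatible : AllPairs (Compatible on job) best
    best-compatible = feasible⇒compatible job L _ (proj₁ (optimal (instanceOf job L)))

    best-maximal : ∀ {T} → T ⊆ L → AllPairs (Compatible on job) T →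
                   ∑ (map (jobWeight ∘ job) T) ≤ℚ ∑ (map (jobWeight ∘ job) best)
    best-maximal T⊆L compatible with positions T⊆L
    ... | S , refl = subst₂ _≤ℚ_ (value-pick job L S) (value-pick job L _)
      (proj₂ (optimal (instanceOf job L)) S (compatible⇒feasible job L S compatible))

  solveᶜ : {B : A → Set} (enc : ∀ a → B a → Tree) (job : ∀ a → B a → ColoredJob) (L : ∀ a → List (B a)) →
           e ⇝ (λ a → encodeList (enc a) (L a)) →
           _⇝_ {Σ A B} (λ (a , b) → node (enc a b) (e a)) (λ (a , b) → encodeColoredJob (job a b)) →
           e ⇝ (λ a → encodeSubset (answer (instanceOf (job a) (L a))))
  solveᶜ enc job L list jobᶜ =
    castᶜ (λ a → encode-instance (job a) (L a)) (mapᶜ enc (λ _ → encodeColoredJob) {xs = L} {F = job} list jobᶜ)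
    ⨾ at (λ a → instanceOf (job a) (L a)) answerᶜ

  bestᶜ : {B : A → Set} (enc : ∀ a → B a → Tree) (job : ∀ a → B a → ColoredJob) (L : ∀ a → List (B a)) →
          e ⇝ (λ a → encodeList (enc a) (L a)) →
          _⇝_ {Σ A B} (λ (a , b) → node (enc a b) (e a)) (λ (a , b) → encodeColoredJob (job a b)) →
          e ⇝ (λ a → encodeList (enc a) (best (job a) (L a)))
  bestᶜ enc job L list jobᶜ = castᶜ (λ a → cong (encodeList (enc a)) (filter-zip (L a) (S a)))
    (mapᶜ encP enc {xs = λ a → filterᵇ proj₂ (zs a)} {F = λ a → proj₁}
      (filterᶜ encP (λ a → T? ∘ proj₂) {xs = zs}
        (zipᶜ enc {zs = zs} (castᶜ (λ a → encode-zip₁ (enc a) (L a) (S a)) list)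
                            (castᶜ (λ a → encode-zip₂ (L a) (S a)) (solveᶜ enc job L list jobᶜ)))
        (snd (fst idᶜ)))
      (fst (fst idᶜ)))
    where
    S = λ a → answer (instanceOf (job a) (L a))
    zs = λ a → zipBits (L a) (S a)
    encP = λ a (p : _ × Bool) → node (enc a (proj₁ p)) (encodeBool (proj₂ p))

-- Giving the elements of a list pairwise disjoint intervals

end : ℕ → List B → ℕ
end p []       = p
end p (x ∷ xs) = odd (end p xs)

-- An element with number `q` owns `[ q , odd q ⟩`; the last element starts at `p`, and each other
-- one right after its successor in the list. The numbers grow exponentially, but their notations by
-- one digit at a time.
number : ℕ → List B → List (ℕ × B)
number p []       = []
number p (x ∷ xs) = (end p xs , x) ∷ number p xs

≤end : ∀ p (xs : List B) → p ≤ end p xs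
≤end p []       = ≤-refl
≤end p (x ∷ xs) = ≤-trans (≤end p xs) (<⇒≤ (n<odd _))

number-within : ∀ p (xs : List B) → All (λ (q , _) → p ≤ q × odd q ≤ end p xs) (number p xs)
number-within p []       = []
number-within p (x ∷ xs) = (≤end p xs , ≤-refl) ∷ All.map (λ (l , r) → l , ≤-trans r (<⇒≤ (n<odd _))) (number-within p xs)

number-apart : ∀ p (xs : List B) → AllPairs (λ (q , _) (q′ , _) → odd q′ ≤ q) (number p xs)
number-apart p []       = []
number-apart p (x ∷ xs) = All.map proj₂ (number-within p xs) ∷ number-apart p xs

numberᶜ : {B : A → Set} (enc : ∀ a → B a → Tree) (p : A → ℕ) (xs : ∀ a → List (B a)) →
          e ⇝ (λ a → encodeℕ (p a)) → e ⇝ (λ a → encodeList (enc a) (xs a)) →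
          e ⇝ (λ a → node (encodeℕ (end (p a) (xs a)))
                          (encodeList (λ (q , x) → node (encodeℕ q) (enc a x)) (number (p a) (xs a))))
numberᶜ {A} {e} {B} enc p xs start list = recᶜ enc h list (pair start nilᶜ)
  (pair (oddᶜ (λ (a , _ , ys) → end (p a) ys) (fst (snd (fst idᶜ))))
        (pair (pair (fst (snd (fst idᶜ))) (fst (fst idᶜ))) (snd (snd (fst idᶜ)))))
  (con 1 ⊞ Qᴾ ⊞ (con 1 ⊞ 𝕏 ⊠ (con 3 ⊞ Qᴾ)))
  (λ a ys → let s≤ = ≤-trans (size-bound start a) (⟦⟧-mono (cost start) (m≤m+n (size (e a)) (len a ys)))
                l≤ = m≤n+m (len a ys) (size (e a))
                Q≤ = +-mono-≤ s≤ (*-monoʳ-≤ 4 l≤) in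
     +-mono-≤ (s≤s (≤-trans (end-size a ys) Q≤))
              (≤-trans (number-size a _ ys Q≤) (s≤s (*-monoˡ-≤ _ l≤))))
  where
  encP : ∀ a → ℕ × B a → Tree
  encP a (q , x) = node (encodeℕ q) (enc a x)
  h : ∀ a → List (B a) → Tree
  h a ys = node (encodeℕ (end (p a) ys)) (encodeList (encP a) (number (p a) ys))
  Qᴾ = cost start ⊞ con 4 ⊠ 𝕏
  len : ∀ a → List (B a) → ℕ
  len a ys = size (encodeList (enc a) ys)
  end-size : ∀ a ys → size (encodeℕ (end (p a) ys)) ≤ size (encodeℕ (p a)) + 4 * len a ys
  end-size a []       = m≤m+n _ _
  end-size a (y ∷ ys) = begin
    size (encodeℕ (odd (end (p a) ys)))                 ≡⟨ cong size (encodeℕ-odd (end (p a) ys)) ⟩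
    4 + size (encodeℕ (end (p a) ys))                   ≤⟨ +-monoʳ-≤ 4 (end-size a ys) ⟩
    4 + (size (encodeℕ (p a)) + 4 * len a ys)           ≡⟨ shuffle (size (encodeℕ (p a))) (len a ys) ⟩
    size (encodeℕ (p a)) + 4 * suc (len a ys)           ≤⟨ +-monoʳ-≤ (size (encodeℕ (p a))) (*-monoʳ-≤ 4 (s≤s (m≤n+m (len a ys) (size (enc a y))))) ⟩
    size (encodeℕ (p a)) + 4 * len a (y ∷ ys)           ∎
    where
    open ≤-Reasoning
    shuffle : ∀ s l → 4 + (s + 4 * l) ≡ s + 4 * suc l
    shuffle = solve-∀
  number-size : ∀ a Q ys → size (encodeℕ (p a)) + 4 * len a ys ≤ Q →
                size (encodeList (encP a) (number (p a) ys)) ≤ 1 + len a ys * (3 + Q)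
  number-size a Q []       le = s≤s z≤n
  number-size a Q (y ∷ ys) le = s≤s (begin
    suc (size (encodeℕ (end (p a) ys)) + s) + size (encodeList (encP a) (number (p a) ys))
      ≤⟨ +-mono-≤ (s≤s (+-mono-≤ (≤-trans (end-size a ys) le′) (m≤m*n s (3 + Q)))) (number-size a Q ys le′) ⟩
    suc (Q + s * (3 + Q)) + (1 + len a ys * (3 + Q))      ≤⟨ n≤1+n _ ⟩
    2 + (Q + s * (3 + Q)) + (1 + len a ys * (3 + Q))      ≡⟨ shuffle Q s (len a ys) ⟩
    len a (y ∷ ys) * (3 + Q)                              ∎)
    where
    open ≤-Reasoning
    s = size (enc a y)
    le′ : size (encodeℕ (p a)) + 4 * len a ys ≤ Q
    le′ = ≤-trans (+-monoʳ-≤ (size (encodeℕ (p a))) (*-monoʳ-≤ 4 (≤-trans (m≤n+m (len a ys) s) (n≤1+n _)))) le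
    shuffle : ∀ Q s l → 2 + (Q + s * (3 + Q)) + (1 + l * (3 + Q)) ≡ (1 + s + l) * (3 + Q)
    shuffle = solve-∀

-- Comparing sums of weights

∑-++ : ∀ xs ys → ∑ (xs ++ ys) ≡ ∑ xs +ℚ ∑ ys
∑-++ []             ys = sym (ℚ.+-identityˡ _)
∑-++ ((q , _) ∷ xs) ys = trans (cong (q +ℚ_) (∑-++ xs ys)) (sym (ℚ.+-assoc q (∑ xs) (∑ ys)))

∑-mono : (w : B → Weight) {T L : List B} → T ⊆ L → ∑ (map w T) ≤ℚ ∑ (map w L)
∑-mono w []           = ℚ.≤-refl
∑-mono w (y ∷ʳ T⊆L)   = ℚ.≤-trans (ℚ.≤-reflexive (sym (ℚ.+-identityˡ _))) (ℚ.+-mono-≤ (proj₂ (w y)) (∑-mono w T⊆L))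
∑-mono w (_∷_ {x} refl T⊆L) = ℚ.+-monoʳ-≤ (proj₁ (w x)) (∑-mono w T⊆L)

avoidˡ : {P : B → Set} {T Y : List B} (X : List B) → T ⊆ X ++ Y → All P T → All (¬_ ∘ P) X → T ⊆ Y
avoidˡ []      T⊆Y          p        ¬p       = T⊆Y
avoidˡ (x ∷ X) (_ ∷ʳ T⊆)    p        (_ ∷ ¬p) = avoidˡ X T⊆ p ¬p
avoidˡ (x ∷ X) (refl ∷ T⊆)  (px ∷ p) (¬px ∷ _) = contradiction px ¬px

avoidʳ : {P : B → Set} {T Y : List B} (X : List B) → T ⊆ X ++ Y → All P T → All (¬_ ∘ P) Y → T ⊆ X
avoidʳ []      []           p        ¬p        = []
avoidʳ []      (_ ∷ʳ T⊆)    p        (_ ∷ ¬p)  = avoidʳ [] T⊆ p ¬p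
avoidʳ []      (refl ∷ T⊆)  (px ∷ p) (¬px ∷ _) = contradiction px ¬px
avoidʳ (x ∷ X) (_ ∷ʳ T⊆)    p        ¬p        = x ∷ʳ avoidʳ X T⊆ p ¬p
avoidʳ (x ∷ X) (refl ∷ T⊆)  (px ∷ p) ¬p        = refl ∷ avoidʳ X T⊆ p ¬p

-- A job without blue part: between two such jobs, compatibility is plain disjointness.
block : (a b : ℕ) → a < b → Weight → ColoredJob
block a b a<b (q , 0≤q) = record { ℓ = a ; a = a ; b = b ; r = b ; ℓ≤a = ≤-refl ; a<b = a<b ; b≤r = ≤-refl ; weight = q ; 0≤weight = 0≤q }

blockᶜ : (a b : A → ℕ) (a<b : ∀ x → a x < b x) (w : A → Weight) →
         e ⇝ (λ x → encodeℕ (a x)) → e ⇝ (λ x → encodeℕ (b x)) → e ⇝ (λ x → encodeWeight (w x)) →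
         e ⇝ (λ x → encodeColoredJob (block (a x) (b x) (a<b x) (w x)))
blockᶜ a b a<b w p q r = pair p (pair p (pair q (pair q r)))

item : ℕ × Weight → ColoredJob
item (q , w) = block q (odd q) (n<odd q) w

apart : ∀ j k → ColoredJob.r k ≤ ColoredJob.ℓ j → Compatible j k
apart j k r≤ℓ =
  (λ ((a≤x , _) , (_ , x<r)) → <⇒≱ x<r (≤-trans r≤ℓ (≤-trans (ColoredJob.ℓ≤a j) a≤x))) ,
  (λ ((_ , x<b) , (ℓ≤x , _)) → <⇒≱ (<-≤-trans x<b (ColoredJob.b≤r k)) (≤-trans r≤ℓ ℓ≤x))

-- Two heavy jobs overlap each other; the first one overlaps all of X, the second one all of Y.
-- An optimal solution contains one of them, together with all the light jobs that it leaves room for.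
module Comparison (X Y : List Weight) where

  -- The light jobs of `Y` lie in `[ 0 , mid ⟩` and those of `X` in `[ odd mid , top ⟩`. The room
  -- between them, `[ mid , odd mid ⟩`, is where the two heavy jobs clash.
  mid top : ℕ
  mid = end 0 Y
  top = end (odd mid) X

  mid<top : mid < top
  mid<top = <-≤-trans (n<odd mid) (≤end (odd mid) X)

  heavy : Weight
  heavy = natural (numerators Y)

  heavyˣ heavyʸ : ColoredJob
  heavyˣ = block mid top mid<top heavy
  heavyʸ = block 0 (odd mid) (s≤s z≤n) heavy

  lightˣ lightʸ : List ColoredJob
  lightˣ = map item (number (odd mid) X)
  lightʸ = map item (number 0 Y)

  comparison : List ColoredJob
  comparison = heavyˣ ∷ heavyʸ ∷ lightˣ ++ lightʸ

  private
    ∑ʲ : List ColoredJob → ℚ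
    ∑ʲ = ∑ ∘ map jobWeight

    W = proj₁ heavy

    weights : ∀ p Z → map jobWeight (map item (number p Z)) ≡ Z
    weights p []      = refl
    weights p (z ∷ Z) = cong (z ∷_) (weights p Z)

    ∑ˣ : ∑ʲ lightˣ ≡ ∑ X
    ∑ˣ = cong ∑ (weights (odd mid) X)

    ∑ʸ : ∑ʲ lightʸ ≡ ∑ Y
    ∑ʸ = cong ∑ (weights 0 Y)

    light-compatible : ∀ p (Z : List Weight) → AllPairs Compatible (map item (number p Z))
    light-compatible p Z = AllPairs.map⁺ (AllPairs.map (λ {x} {y} → apart (item x) (item y)) (number-apart p Z))

    ¬heavy-heavy : ¬ Compatible heavyˣ heavyʸ
    ¬heavy-heavy (dis , _) = dis ((≤-refl , mid<top) , (z≤n , n<odd mid))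

    ¬heavyˣ : All (¬_ ∘ Compatible heavyˣ) lightˣ
    ¬heavyˣ = All.map⁺ (All.map (λ (l , r) (dis , _) →
      dis ((≤-trans (<⇒≤ (n<odd mid)) l , <-≤-trans (n<odd _) r) , (≤-refl , n<odd _))) (number-within (odd mid) X))

    ¬heavyʸ : All (¬_ ∘ Compatible heavyʸ) lightʸ
    ¬heavyʸ = All.map⁺ (All.map (λ (l , r) (dis , _) →
      dis ((z≤n , <-trans (<-≤-trans (n<odd _) r) (n<odd mid)) , (≤-refl , n<odd _))) (number-within 0 Y))

    choiceˣ : AllPairs Compatible (heavyʸ ∷ lightˣ)
    choiceˣ = All.map⁺ (All.map (λ {x} → swap ∘ apart (item x) heavyʸ ∘ proj₁) (number-within (odd mid) X)) ∷ light-compatible (odd mid) X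

    choiceʸ : AllPairs Compatible (heavyˣ ∷ lightʸ)
    choiceʸ = All.map⁺ (All.map (λ {x} → apart heavyˣ (item x) ∘ proj₂) (number-within 0 Y)) ∷ light-compatible 0 Y

    cancel : ∀ {x y} → W +ℚ x ≤ℚ W +ℚ y → x ≤ℚ y
    cancel {x} {y} le = +-cancelʳ-≤ℚ W (subst₂ _≤ℚ_ (ℚ.+-comm W x) (ℚ.+-comm W y) le)

  -- If `heavyˣ` is chosen, no job of `X` fits beside it, so the value is at most `W +ℚ ∑ Y`, while
  -- `heavyʸ` with all of `X` would give `W +ℚ ∑ X`. The choice of `heavyʸ` is symmetric. A tie may
  -- go either way, hence the weak inequality in both cases.
  correct : (S : Subset (length comparison)) → AllPairs Compatible (pick comparison S) →
            (∀ {T} → T ⊆ comparison → AllPairs Compatible T → ∑ʲ T ≤ℚ ∑ʲ (pick comparison S)) →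
            if Vec.head S then ∑ X ≤ℚ ∑ Y else ∑ Y ≤ℚ ∑ X
  correct (true ∷ᵛ true ∷ᵛ S) ((c ∷ _) ∷ _) maximal = contradiction c ¬heavy-heavy
  correct (true ∷ᵛ false ∷ᵛ S) (c ∷ _) maximal = subst₂ _≤ℚ_ ∑ˣ ∑ʸ (cancel (ℚ.≤-trans
    (maximal (_ ∷ʳ (refl ∷ ++⁺ʳ lightʸ ⊆-refl)) choiceˣ)
    (ℚ.+-monoʳ-≤ W (∑-mono jobWeight (avoidˡ lightˣ (pick-⊆ _ S) c ¬heavyˣ)))))
  correct (false ∷ᵛ true ∷ᵛ S) (c ∷ _) maximal = subst₂ _≤ℚ_ ∑ʸ ∑ˣ (cancel (ℚ.≤-trans
    (maximal (refl ∷ (_ ∷ʳ ++⁺ˡ lightˣ ⊆-refl)) choiceʸ)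
    (ℚ.+-monoʳ-≤ W (∑-mono jobWeight (avoidʳ lightˣ (pick-⊆ _ S) c ¬heavyʸ)))))
  -- Without heavy jobs the value is at most `∑ X +ℚ ∑ Y`, hence at most `∑ X +ℚ W`, but by
  -- maximality at least `W +ℚ ∑ Y`. This case is the reason why `W` is taken to be at least `∑ Y`.
  correct (false ∷ᵛ false ∷ᵛ S) c maximal = subst₂ _≤ℚ_ ∑ʸ ∑ˣ (cancel (begin
    W +ℚ ∑ʲ lightʸ                 ≤⟨ maximal (refl ∷ (_ ∷ʳ ++⁺ˡ lightˣ ⊆-refl)) choiceʸ ⟩
    ∑ʲ (pick (lightˣ ++ lightʸ) S) ≤⟨ ∑-mono jobWeight (pick-⊆ (lightˣ ++ lightʸ) S) ⟩
    ∑ʲ (lightˣ ++ lightʸ)          ≡⟨ cong ∑ (map-++ jobWeight lightˣ lightʸ) ⟩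
    ∑ (map jobWeight lightˣ ++ map jobWeight lightʸ) ≡⟨ ∑-++ (map jobWeight lightˣ) _ ⟩
    ∑ʲ lightˣ +ℚ ∑ʲ lightʸ         ≤⟨ ℚ.+-monoʳ-≤ (∑ʲ lightˣ) (ℚ.≤-trans (ℚ.≤-reflexive ∑ʸ) (∑≤numerators Y)) ⟩
    ∑ʲ lightˣ +ℚ W                 ≡⟨ ℚ.+-comm (∑ʲ lightˣ) W ⟩
    W +ℚ ∑ʲ lightˣ                 ∎))
    where open ℚ.≤-Reasoning

-- Comparisons of numbers by means of the oracle

module Arithmetic (solvable : PolynomialTimeSolvable IntervalSchedulingWithColors) where
  open Oracle solvable
  open Comparison

  prefer : List Weight → List Weight → Bool
  prefer X Y = Vec.head (answer (instanceOf id (comparison X Y)))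

  prefer-correct : ∀ X Y → if prefer X Y then ∑ X ≤ℚ ∑ Y else ∑ Y ≤ℚ ∑ X
  prefer-correct X Y = correct X Y (answer (instanceOf id (comparison X Y)))
    (best-compatible id (comparison X Y)) (best-maximal id (comparison X Y))

  numeratorsᶜ : (X : A → List Weight) → e ⇝ (λ a → encodeList encodeWeight (X a)) → e ⇝ (λ a → encodeℕ (numerators (X a)))
  numeratorsᶜ {A} {e} X p = recᶜ (λ _ → encodeWeight) (λ _ ys → encodeℕ (numerators ys)) p nilᶜ
    (⊙ᶜ (λ (_ , (q , _) , _) → ℤ.∣ ↥ q ∣) (λ (_ , _ , ys) → numerators ys) (snd (fst (fst (fst idᶜ)))) (snd (fst idᶜ)))
    𝕏 (λ a ys → ≤-trans (bound ys) (m≤n+m _ (size (e a))))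
    where
    bound : ∀ ys → size (encodeℕ (numerators ys)) ≤ size (encodeList encodeWeight ys)
    bound []       = ≤-refl
    bound ((q , _) ∷ ys) = ≤-trans (size-⊙ ℤ.∣ ↥ q ∣ (numerators ys)) (≤-trans (+-monoʳ-≤ _ (bound ys))
      (≤-trans (+-monoˡ-≤ _ (≤-trans (m≤n+m (size (encodeℕ ℤ.∣ ↥ q ∣)) (2 + size (encodeSign (ℤ.sign (↥ q))))) (m≤m+n _ _))) (n≤1+n _)))

  encodeItem : ℕ × Weight → Tree
  encodeItem (q , w) = node (encodeℕ q) (encodeWeight w)

  itemsᶜ : (xs : A → List (ℕ × Weight)) → e ⇝ (λ a → encodeList encodeItem (xs a)) →
           e ⇝ (λ a → encodeList encodeColoredJob (map item (xs a)))
  itemsᶜ xs r = mapᶜ (λ _ → encodeItem) (λ _ → encodeColoredJob) {xs = xs} {F = λ _ → item} r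
    (blockᶜ (λ (_ , q , _) → q) (λ (_ , q , _) → odd q) (λ (_ , q , _) → n<odd q) (λ (_ , _ , w) → w)
      (fst (fst idᶜ)) (oddᶜ (λ (_ , q , _) → q) (fst (fst idᶜ))) (snd (fst idᶜ)))

  module _ {A : Set} {e : A → Tree} (X Y : A → List Weight)
    (p : e ⇝ (λ a → encodeList encodeWeight (X a))) (q : e ⇝ (λ a → encodeList encodeWeight (Y a))) where

    private
      numberʸ : e ⇝ (λ a → node (encodeℕ (mid (X a) (Y a))) (encodeList encodeItem (number 0 (Y a))))
      numberʸ = numberᶜ (λ _ → encodeWeight) (λ _ → 0) Y nilᶜ q

      oddmidᶜ : e ⇝ (λ a → encodeℕ (odd (mid (X a) (Y a))))
      oddmidᶜ = oddᶜ (λ a → mid (X a) (Y a)) (fst numberʸ)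

      numberˣ : e ⇝ (λ a → node (encodeℕ (top (X a) (Y a))) (encodeList encodeItem (number (odd (mid (X a) (Y a))) (X a))))
      numberˣ = numberᶜ (λ _ → encodeWeight) (λ a → odd (mid (X a) (Y a))) X oddmidᶜ p

      heavyᶜ : e ⇝ (λ a → encodeWeight (heavy (X a) (Y a)))
      heavyᶜ = naturalᶜ (λ a → numerators (Y a)) (numeratorsᶜ Y q)

      heavyˣᶜ : e ⇝ (λ a → encodeColoredJob (heavyˣ (X a) (Y a)))
      heavyˣᶜ = blockᶜ (λ a → mid (X a) (Y a)) (λ a → top (X a) (Y a)) (λ a → mid<top (X a) (Y a)) (λ a → heavy (X a) (Y a))
        (fst numberʸ) (fst numberˣ) heavyᶜ

      heavyʸᶜ : e ⇝ (λ a → encodeColoredJob (heavyʸ (X a) (Y a)))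
      heavyʸᶜ = blockᶜ (λ a → 0) (λ a → odd (mid (X a) (Y a))) (λ _ → s≤s z≤n) (λ a → heavy (X a) (Y a)) nilᶜ oddmidᶜ heavyᶜ

      lightᶜ : e ⇝ (λ a → encodeList encodeColoredJob (lightˣ (X a) (Y a) ++ lightʸ (X a) (Y a)))
      lightᶜ = appendᶜ (λ _ → encodeColoredJob) {xs = λ a → lightˣ (X a) (Y a)} {ys = λ a → lightʸ (X a) (Y a)}
            (itemsᶜ (λ a → number (odd (mid (X a) (Y a))) (X a)) (snd numberˣ))
            (itemsᶜ (λ a → number 0 (Y a)) (snd numberʸ))

      encode-head : ∀ {n} (S : Subset (suc n)) → encodeSubset S ≡ node (encodeBool (Vec.head S)) (encodeSubset (Vec.tail S))
      encode-head (_ ∷ᵛ _) = refl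

      comparisonᶜ : e ⇝ (λ a → encodeList encodeColoredJob (comparison (X a) (Y a)))
      comparisonᶜ = pair heavyˣᶜ (pair heavyʸᶜ lightᶜ)

    preferᶜ : e ⇝ (λ a → encodeBool (prefer (X a) (Y a)))
    preferᶜ = fst (castᶜ (λ a → encode-head (answer (instanceOf id (comparison (X a) (Y a)))))
      (solveᶜ (λ _ → encodeColoredJob) (λ _ → id) (λ a → comparison (X a) (Y a)) comparisonᶜ (fst idᶜ)))

  -- ε is too small to matter, but it breaks ties.
  ε : Weight → Weight → ℚ → Weight
  ε (u , _) (v , _) l = unitFraction (2 * (↧ₙ v ⊙ odd (↧ₙ l ⊙ ↧ₙ u)))

  lhs rhs : Weight → Weight → ℚ → List Weight
  lhs u v l = u ∷ negativePart l ∷ []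
  rhs u v l = v ∷ positivePart l ∷ ε u v l ∷ []

  private
    ∑lhs : ∀ u v l → ∑ (lhs u v l) ≡ proj₁ u +ℚ proj₁ (negativePart l)
    ∑lhs u v l = cong (proj₁ u +ℚ_) (ℚ.+-identityʳ _)

    ∑rhs : ∀ u v l → ∑ (rhs u v l) ≡ proj₁ v +ℚ l +ℚ proj₁ (ε u v l) +ℚ proj₁ (negativePart l)
    ∑rhs u v l = trans (cong₂ (λ x y → proj₁ v +ℚ (x +ℚ y)) (positivePart≡ l) (ℚ.+-identityʳ _))
      (rearrange (proj₁ v) l (proj₁ (negativePart l)) (proj₁ (ε u v l)))
      where
      open +-*-Solver
      rearrange : ∀ v l m e → v +ℚ (l +ℚ m +ℚ e) ≡ v +ℚ l +ℚ e +ℚ m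
      rearrange = solve 4 (λ v l m e → v :+ (l :+ m :+ e) := v :+ l :+ e :+ m) refl

    ε-small : ∀ x y z → x * y * z ≤ 2 * (x ⊙ odd (y ⊙ z))
    ε-small x y z = begin
      x * y * z              ≡⟨ *-assoc x y z ⟩
      x * (y * z)            ≤⟨ *-monoʳ-≤ x (≤-trans (*≤⊙ y z) (n≤1+n _)) ⟩
      x * odd (y ⊙ z)        ≤⟨ *≤⊙ x _ ⟩
      2 * (x ⊙ odd (y ⊙ z))  ∎
      where open ≤-Reasoning

  -- On a tie `prefer` may be either value. With `ε` on the right-hand side, `false` means
  -- `v + l + ε ≤ u`, which implies `v + l < u`, and `true` means `u ≤ v + l + ε`, from which `gap`
  -- removes the `ε`.
  prefer≡≤? : ∀ u v l → prefer (lhs u v l) (rhs u v l) ≡ does (proj₁ u ℚ.≤? proj₁ v +ℚ l)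
  prefer≡≤? u@(u′ , _) v@(v′ , _) l = decide (prefer (lhs u v l) (rhs u v l)) (prefer-correct (lhs u v l) (rhs u v l))
    where
    open ℚ.≤-Reasoning
    decide : ∀ b → (if b then ∑ (lhs u v l) ≤ℚ ∑ (rhs u v l) else ∑ (rhs u v l) ≤ℚ ∑ (lhs u v l)) → b ≡ does (u′ ℚ.≤? v′ +ℚ l)
    decide true le = sym (dec-true (u′ ℚ.≤? v′ +ℚ l) (gap u′ v′ l _ (ε-small (↧ₙ v′) (↧ₙ l) (↧ₙ u′))
      (+-cancelʳ-≤ℚ (proj₁ (negativePart l)) (subst₂ _≤ℚ_ (∑lhs u v l) (∑rhs u v l) le))))
    decide false le = sym (dec-false (u′ ℚ.≤? v′ +ℚ l) λ u≤v+l → ℚ.<-irrefl refl (begin-strict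
      v′ +ℚ l                      ≡⟨ sym (ℚ.+-identityʳ _) ⟩
      v′ +ℚ l +ℚ 0ℚ                <⟨ ℚ.+-monoʳ-< (v′ +ℚ l) (0<unitFraction _) ⟩
      v′ +ℚ l +ℚ proj₁ (ε u v l)   ≤⟨ +-cancelʳ-≤ℚ (proj₁ (negativePart l)) (subst₂ _≤ℚ_ (∑rhs u v l) (∑lhs u v l) le) ⟩
      u′                           ≤⟨ u≤v+l ⟩
      v′ +ℚ l                      ∎))

  module _ {A : Set} {e : A → Tree} (u v : A → Weight) (l : A → ℚ)
    (p : e ⇝ (λ a → encodeWeight (u a))) (q : e ⇝ (λ a → encodeWeight (v a))) (r : e ⇝ (λ a → encodeℚ (l a))) where

    private
      d₁ d₂ d₃ : A → ℕ
      d₁ a = ↧ₙ (proj₁ (u a))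
      d₂ a = ↧ₙ (proj₁ (v a))
      d₃ a = ↧ₙ (l a)

      -- The denominator of `ε` is one more than twice a juxtaposition, that is, `odd` of it. So the
      -- factor 2 that `*≤⊙` demands costs just one digit.
      denominatorᶜ : e ⇝ (λ a → encodeℕ (odd (d₂ a ⊙ odd (d₃ a ⊙ d₁ a))))
      denominatorᶜ = oddᶜ (λ a → d₂ a ⊙ odd (d₃ a ⊙ d₁ a)) (⊙ᶜ d₂ (λ a → odd (d₃ a ⊙ d₁ a)) (snd q)
          (oddᶜ (λ a → d₃ a ⊙ d₁ a) (⊙ᶜ d₃ d₁ (snd r) (snd p))))

      εᶜ : e ⇝ (λ a → encodeWeight (ε (u a) (v a) (l a)))
      εᶜ = unitFractionᶜ (λ a → 2 * (d₂ a ⊙ odd (d₃ a ⊙ d₁ a))) denominatorᶜ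

      lhsᶜ : e ⇝ (λ a → encodeList encodeWeight (lhs (u a) (v a) (l a)))
      lhsᶜ = pair p (pair (negativePartᶜ l r) nilᶜ)

      rhsᶜ : e ⇝ (λ a → encodeList encodeWeight (rhs (u a) (v a) (l a)))
      rhsᶜ = pair q (pair (positivePartᶜ l r) (pair εᶜ nilᶜ))

    ≤+ᶜ : e ⇝ (λ a → encodeBool (does (proj₁ (u a) ℚ.≤? proj₁ (v a) +ℚ l a)))
    ≤+ᶜ = castᶜ (λ a → cong encodeBool (prefer≡≤? (u a) (v a) (l a)))
      (preferᶜ (λ a → lhs (u a) (v a) (l a)) (λ a → rhs (u a) (v a) (l a)) lhsᶜ rhsᶜ)

  ≤ᶜ : (x y : A → ℕ) → e ⇝ (λ a → encodeℕ (x a)) → e ⇝ (λ a → encodeℕ (y a)) →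
       e ⇝ (λ a → encodeBool (does (x a ≤? y a)))
  ≤ᶜ x y p q = castᶜ (λ a → cong encodeBool (lemma (x a) (y a)))
    (≤+ᶜ (natural ∘ x) (natural ∘ y) (λ _ → 0ℚ) (naturalᶜ x p) (naturalᶜ y q) (constᶜ (encodeℚ 0ℚ)))
    where
    lemma : ∀ m n → does (proj₁ (natural m) ℚ.≤? proj₁ (natural n) +ℚ 0ℚ) ≡ does (m ≤? n)
    lemma m n = does-⇔ (mk⇔ (λ le → natural-cancel (ℚ.≤-trans le (ℚ.≤-reflexive (ℚ.+-identityʳ _))))
                            (λ le → ℚ.≤-trans (natural-mono le) (ℚ.≤-reflexive (sym (ℚ.+-identityʳ _))))) (_ ℚ.≤? _) (m ≤? n)

-- Sums over subsets

p─∅≡p : ∀ {n} (p : Subset n) → p ─ ∅ ≡ p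
p─∅≡p []ᵛ      = refl
p─∅≡p (b ∷ᵛ p) = cong (b ∷ᵛ_) (p─∅≡p p)

p∪∅≡p : ∀ {n} (p : Subset n) → p ∪ ∅ ≡ p
p∪∅≡p []ᵛ          = refl
p∪∅≡p (true ∷ᵛ p)  = cong (true ∷ᵛ_) (p∪∅≡p p)
p∪∅≡p (false ∷ᵛ p) = cong (false ∷ᵛ_) (p∪∅≡p p)

exchange : ∀ x y z → x +ℚ (y +ℚ z) ≡ y +ℚ (x +ℚ z)
exchange = solve 3 (λ x y z → x :+ (y :+ z) := y :+ (x :+ z)) refl
  where open +-*-Solver

totalWeight-remove : ∀ {n} (w : Fin n → ℚ) {S k} → k ∈ S → totalWeight w S ≡ w k +ℚ totalWeight w (S - k)
totalWeight-remove w {true ∷ᵛ S} here = cong (w zero +ℚ_)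
  (trans (sym (ℚ.+-identityˡ _)) (cong (λ p → 0ℚ +ℚ totalWeight (w ∘ suc) p) (sym (p─∅≡p S))))
totalWeight-remove w {b ∷ᵛ S} {suc k} (there k∈S) =
  trans (cong ((if b then w zero else 0ℚ) +ℚ_) (totalWeight-remove (w ∘ suc) k∈S))
        (exchange (if b then w zero else 0ℚ) (w (suc k)) _)

totalWeight-insert : ∀ {n} (w : Fin n → ℚ) S k → k ∉ S → totalWeight w (S ∪ ⁅ k ⁆) ≡ w k +ℚ totalWeight w S
totalWeight-insert w (true ∷ᵛ S)  zero    k∉S = contradiction here k∉S
totalWeight-insert w (false ∷ᵛ S) zero    k∉S = cong (w zero +ℚ_)
  (trans (cong (totalWeight (w ∘ suc)) (p∪∅≡p S)) (sym (ℚ.+-identityˡ _)))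
totalWeight-insert w (true ∷ᵛ S)  (suc k) k∉S =
  trans (cong (w zero +ℚ_) (totalWeight-insert (w ∘ suc) S k (k∉S ∘ there))) (exchange (w zero) (w (suc k)) _)
totalWeight-insert w (false ∷ᵛ S) (suc k) k∉S =
  trans (cong (0ℚ +ℚ_) (totalWeight-insert (w ∘ suc) S k (k∉S ∘ there))) (exchange 0ℚ (w (suc k)) _)

remove-∉ : ∀ {n} (S : Subset n) k → k ∉ S → S - k ≡ S
remove-∉ (true ∷ᵛ S)  zero    k∉S = contradiction here k∉S
remove-∉ (false ∷ᵛ S) zero    k∉S = cong (false ∷ᵛ_) (p─∅≡p S)
remove-∉ (b ∷ᵛ S)     (suc k) k∉S = cong (b ∷ᵛ_) (remove-∉ S k (k∉S ∘ there))

elements : ∀ {n} → Subset n → List (Fin n)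
elements []ᵛ          = []
elements (true ∷ᵛ S)  = zero ∷ map suc (elements S)
elements (false ∷ᵛ S) = map suc (elements S)

∑-elements : ∀ {n} (w : Fin n → Weight) S → ∑ (map w (elements S)) ≡ totalWeight (proj₁ ∘ w) S
∑-elements w []ᵛ          = refl
∑-elements w (true ∷ᵛ S)  = cong (proj₁ (w zero) +ℚ_) (trans (cong ∑ (sym (map-∘ (elements S)))) (∑-elements (w ∘ suc) S))
∑-elements w (false ∷ᵛ S) = trans (cong ∑ (sym (map-∘ (elements S)))) (trans (∑-elements (w ∘ suc) S) (sym (ℚ.+-identityˡ _)))

elements-⊆ : ∀ {n} (S : Subset n) → elements S ⊆ allFin n
elements-⊆ []ᵛ          = []
elements-⊆ (true ∷ᵛ S)  = refl ∷ ⊆-trans (map⁺ suc (elements-⊆ S)) (⊆-reflexive (map-tabulate id suc))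
elements-⊆ (false ∷ᵛ S) = zero ∷ʳ ⊆-trans (map⁺ suc (elements-⊆ S)) (⊆-reflexive (map-tabulate id suc))

elements-∈ : ∀ {n} (S : Subset n) → All (_∈ S) (elements S)
elements-∈ []ᵛ          = []
elements-∈ (true ∷ᵛ S)  = here ∷ All.map⁺ (All.map there (elements-∈ S))
elements-∈ (false ∷ᵛ S) = All.map⁺ (All.map there (elements-∈ S))

elements-pairs : ∀ {n} (S : Subset n) → AllPairs (λ j k → j ∈ S × k ∈ S × j ≢ k) (elements S)
elements-pairs []ᵛ          = []
elements-pairs (true ∷ᵛ S)  = All.map⁺ (All.map (λ k∈S → here , there k∈S , λ ()) (elements-∈ S))
  ∷ AllPairs.map⁺ (AllPairs.map (λ (p , q , r) → there p , there q , r ∘ Fin.suc-injective) (elements-pairs S))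
elements-pairs (false ∷ᵛ S) = AllPairs.map⁺ (AllPairs.map (λ (p , q , r) → there p , there q , r ∘ Fin.suc-injective) (elements-pairs S))

-- Membership in the form of a filter and an emptiness test, each of which has a program.
occurs : ∀ {n} → List (Fin n) → Fin n → Bool
occurs is k = not (null (filter (k Fin.≟_) is))

occurs⇒∈ : ∀ {n} (is : List (Fin n)) k → occurs is k ≡ true → k List.∈ is
occurs⇒∈ (i ∷ is) k eq with k Fin.≟ i
... | yes k≡i = here k≡i
... | no  _   = there (occurs⇒∈ is k eq)

∉⇒¬occurs : ∀ {n} (is : List (Fin n)) k → All (k ≢_) is → occurs is k ≡ false
∉⇒¬occurs []       k []           = refl
∉⇒¬occurs (i ∷ is) k (k≢i ∷ k∉is) with k Fin.≟ i
... | yes k≡i = contradiction k≡i k≢i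
... | no  _   = ∉⇒¬occurs is k k∉is

sum-single : ∀ {n} (w : Fin n → ℚ) i → sum (λ k → if does (k Fin.≟ i) then w k else 0ℚ) ≡ w i
sum-single {suc n} w zero = trans (cong (w zero +ℚ_) (sum-replicate-zero n)) (ℚ.+-identityʳ _)
sum-single w (suc i)      = trans (ℚ.+-identityˡ _) (sum-single (w ∘ suc) i)

sum-occurs : ∀ {n} (w : Fin n → Weight) is → AllPairs _≢_ is →
             sum (λ k → if occurs is k then proj₁ (w k) else 0ℚ) ≡ ∑ (map w is)
sum-occurs {n} w [] [] = sum-replicate-zero n
sum-occurs w (i ∷ is) (i∉is ∷ distinct) =
  trans (sum-cong-≗ split) (trans (∑-distrib-+ (λ k → if does (k Fin.≟ i) then proj₁ (w k) else 0ℚ) _)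
    (cong₂ _+ℚ_ (sum-single (proj₁ ∘ w) i) (sum-occurs w is distinct)))
  where
  split : ∀ k → (if occurs (i ∷ is) k then proj₁ (w k) else 0ℚ)
                ≡ (if does (k Fin.≟ i) then proj₁ (w k) else 0ℚ) +ℚ (if occurs is k then proj₁ (w k) else 0ℚ)
  split k with k Fin.≟ i
  ... | no  _    = sym (ℚ.+-identityˡ _)
  ... | yes refl = sym (trans (cong (λ b → proj₁ (w k) +ℚ (if b then proj₁ (w k) else 0ℚ)) (∉⇒¬occurs is k i∉is)) (ℚ.+-identityʳ _))

-- A sublist has to respect the order of the product. Since `js` is in the order of `xs`, each pair
-- is taken from its own row, and the rows come in the right order.
⊆-product : {B C : Set} (c : B → C) {js xs : List B} {ys : List C} → (∀ j → c j List.∈ ys) → js ⊆ xs →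
            map (λ j → j , c j) js ⊆ cartesianProduct xs ys
⊆-product c c∈ []          = []
⊆-product c c∈ (x ∷ʳ js⊆)  = ++⁺ˡ _ (⊆-product c c∈ js⊆)
⊆-product c c∈ (_∷_ {x} refl js⊆) = ++⁺ (map⁺ (x ,_) (from∈ (c∈ x))) (⊆-product c c∈ js⊆)

AllPairs-lookup : {B : Set} {R : B → B → Set} → (∀ {x y} → R x y → R y x) →
                  ∀ {xs x y} → AllPairs R xs → x List.∈ xs → y List.∈ xs → x ≢ y → R x y
AllPairs-lookup R-sym (r ∷ rs) (here refl) (here refl) x≢y = contradiction refl x≢y
AllPairs-lookup R-sym (r ∷ rs) (here refl) (there y∈)  x≢y = All.lookup r y∈
AllPairs-lookup R-sym (r ∷ rs) (there x∈)  (here refl) x≢y = R-sym (All.lookup r x∈)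
AllPairs-lookup R-sym (r ∷ rs) (there x∈)  (there y∈)  x≢y = AllPairs-lookup R-sym rs x∈ y∈ x≢y

maximum : ∀ {m} (w : Fin m → ℚ) {P : Fin m → Set} → Decidable P →
          (∃ λ g → P g × ∀ f → P f → w f ≤ℚ w g) ⊎ (∀ f → ¬ P f)
maximum {zero}  w P? = inj₂ λ ()
maximum {suc m} w P? with P? zero | maximum (w ∘ suc) (P? ∘ suc)
... | no ¬p | inj₂ none = inj₂ λ { zero → ¬p ; (suc f) → none f }
... | no ¬p | inj₁ (g , pg , max) = inj₁ (suc g , pg , λ { zero p → contradiction p ¬p ; (suc f) → max f })
... | yes p | inj₂ none = inj₁ (zero , p , λ { zero _ → ℚ.≤-refl ; (suc f) pf → contradiction pf (none f) })
... | yes p | inj₁ (g , pg , max) with ℚ.≤-total (w zero) (w (suc g))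
...   | inj₁ le = inj₁ (suc g , pg , λ { zero _ → le ; (suc f) → max f })
...   | inj₂ ge = inj₁ (zero , p , λ { zero _ → ℚ.≤-refl ; (suc f) pf → ℚ.≤-trans (max f pf) ge })

-- The colored instances of a robust instance

⊥⇒≤ : ∀ {a b c d} → a < b → c < d → [ a , b ⟩ ⊥ [ c , d ⟩ → b ≤ c ⊎ d ≤ a
⊥⇒≤ {a} {b} {c} {d} a<b c<d dis with b ≤? c | d ≤? a
... | yes b≤c | _       = inj₁ b≤c
... | no _    | yes d≤a = inj₂ d≤a
... | no b≰c  | no d≰a  with ≤-total a c
...   | inj₁ a≤c = contradiction ((a≤c , ≰⇒> b≰c) , (≤-refl , c<d)) dis
...   | inj₂ c≤a = contradiction ((≤-refl , a<b) , (c≤a , ≰⇒> d≰a)) dis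

-- The number that `number` assigns to an entry, as a function of its index; `number-tabulate`
-- connects the two.
position : ∀ {B : Set} {m} → ℕ → Vec B m → Fin m → ℕ
position p (x ∷ᵛ v) zero    = end p (toList v)
position p (x ∷ᵛ v) (suc i) = position p v i

≤position : ∀ {B : Set} {m} p (v : Vec B m) i → p ≤ position p v i
≤position p (x ∷ᵛ v) zero    = ≤end p (toList v)
≤position p (x ∷ᵛ v) (suc i) = ≤position p v i

position<end : ∀ {B : Set} {m} p (v : Vec B m) i → odd (position p v i) ≤ end p (toList v)
position<end p (x ∷ᵛ v) zero    = ≤-refl
position<end p (x ∷ᵛ v) (suc i) = ≤-trans (position<end p v i) (<⇒≤ (n<odd _))

position-apart : ∀ {B : Set} {m} p (v : Vec B m) {i j} → i ≢ j →
                 odd (position p v i) ≤ position p v j ⊎ odd (position p v j) ≤ position p v i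
position-apart p (x ∷ᵛ v) {zero}  {zero}  i≢j = contradiction refl i≢j
position-apart p (x ∷ᵛ v) {zero}  {suc j} i≢j = inj₂ (position<end p v j)
position-apart p (x ∷ᵛ v) {suc i} {zero}  i≢j = inj₁ (position<end p v i)
position-apart p (x ∷ᵛ v) {suc i} {suc j} i≢j = position-apart p v (i≢j ∘ cong suc)

-- An upper bound for all right endpoints, so that positions counted from here on are beyond every
-- job.
ends : List Job → ℕ
ends []       = 0
ends (j ∷ js) = Job.b j ⊙ ends js

b≤ends : ∀ {m} (v : Vec Job m) i → Job.b (lookup v i) ≤ ends (toList v)
b≤ends (j ∷ᵛ v) zero    = ≤-trans (m≤m+n _ _) (+≤⊙ (Job.b j) (ends (toList v)))
b≤ends (j ∷ᵛ v) (suc i) = ≤-trans (b≤ends v i) (≤-trans (m≤n+m _ _) (+≤⊙ (Job.b j) (ends (toList v))))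

-- Empty jobs are moved to the right of all the others, where they get some room.
start stop⁺ : ℕ → ℕ → ℕ → ℕ
start p a b = if does (b ≤? a) then p else a
stop⁺ p a b = if does (b ≤? a) then odd p else b

-- The graph of `start` and `stop⁺`, which replaces reasoning about `if` by pattern matching.
data Placed (p a b : ℕ) : ℕ → ℕ → Set where
  moved : b ≤ a → Placed p a b p (odd p)
  kept  : a < b → Placed p a b a b

placed : ∀ p a b → Placed p a b (start p a b) (stop⁺ p a b)
placed p a b = decide (b ≤? a)
  where
  decide : (d : Dec (b ≤ a)) → Placed p a b (if does d then p else a) (if does d then odd p else b)
  decide (yes b≤a) = moved b≤a
  decide (no  b≰a) = kept (≰⇒> b≰a)

placed-< : ∀ {p a b l h} → Placed p a b l h → l < h
placed-< (moved _)  = n<odd _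
placed-< (kept a<b) = a<b

placed⇒⊥ : ∀ {p a b l h p′ a′ b′ l′ h′} → Placed p a b l h → Placed p′ a′ b′ l′ h′ →
           h ≤ l′ ⊎ h′ ≤ l → [ a , b ⟩ ⊥ [ a′ , b′ ⟩
placed⇒⊥ (moved b≤a) _           _          ((a≤x , x<b) , _) = <⇒≱ x<b (≤-trans b≤a a≤x)
placed⇒⊥ (kept _)    (moved b≤a) _          (_ , (a≤x , x<b)) = <⇒≱ x<b (≤-trans b≤a a≤x)
placed⇒⊥ (kept _)    (kept _)    (inj₁ b≤a) ((_ , x<b) , (a≤x , _)) = <⇒≱ x<b (≤-trans b≤a a≤x)
placed⇒⊥ (kept _)    (kept _)    (inj₂ b≤a) ((a≤x , _) , (_ , x<b)) = <⇒≱ x<b (≤-trans b≤a a≤x)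

⊥⇒placed : ∀ {p a b l h p′ a′ b′ l′ h′} → Placed p a b l h → Placed p′ a′ b′ l′ h′ →
           b ≤ p′ → b′ ≤ p → odd p ≤ p′ ⊎ odd p′ ≤ p → [ a , b ⟩ ⊥ [ a′ , b′ ⟩ → h ≤ l′ ⊎ h′ ≤ l
⊥⇒placed (moved _)  (moved _)    _    _    apart _   = apart
⊥⇒placed (moved _)  (kept _)     _    b′≤p _     _   = inj₂ b′≤p
⊥⇒placed (kept _)   (moved _)    b≤p′ _    _     _   = inj₁ b≤p′
⊥⇒placed (kept a<b) (kept a′<b′) _    _    _     dis = ⊥⇒≤ a<b a′<b′ dis

-- An empty job of weight 0 is a replacement that is as good as ∅.
dummy : Job
dummy = record { a = 0 ; b = 0 ; a≤b = z≤n ; weight = 0ℚ ; 0≤weight = ℚ.≤-refl }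

module Reduction (I : RobustInstance) where
  open RobustInstance I
  open Robust I

  m : ℕ
  m = 2 + n

  -- There are two dummies because `g₁` and `g₂` have to differ, although both may stand for ∅.
  jobs⁺ : Vec Job m
  jobs⁺ = dummy ∷ᵛ dummy ∷ᵛ jobs

  pos lo hi : Fin m → ℕ
  pos = position (ends (toList jobs⁺)) jobs⁺

  private
    a b : Fin m → ℕ
    a i = Job.a (lookup jobs⁺ i)
    b i = Job.b (lookup jobs⁺ i)

  lo i = start (pos i) (a i) (b i)
  hi i = stop⁺ (pos i) (a i) (b i)

  lo<hi : ∀ i → lo i < hi i
  lo<hi i = placed-< (placed (pos i) (a i) (b i))

  wt : Fin m → Weight
  wt i = Job.weight (lookup jobs⁺ i) , Job.0≤weight (lookup jobs⁺ i)

  w⁺ : Fin m → ℚ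
  w⁺ i = proj₁ (wt i)

  Disjoint : Fin m → Fin m → Set
  Disjoint i j = hi i ≤ lo j ⊎ hi j ≤ lo i

  disjoint?⁺ : ∀ i j → Dec (Disjoint i j)
  disjoint?⁺ i j = (hi i ≤? lo j) ⊎-dec (hi j ≤? lo i)

  ¬Disjoint-refl : ∀ {i} → ¬ Disjoint i i
  ¬Disjoint-refl {i} = [ <⇒≱ (lo<hi i) , <⇒≱ (lo<hi i) ]′

  Disjoint⇒⊥ : ∀ i j → Disjoint i j → [ a i , b i ⟩ ⊥ [ a j , b j ⟩
  Disjoint⇒⊥ i j = placed⇒⊥ (placed (pos i) (a i) (b i)) (placed (pos j) (a j) (b j))

  -- The condition `i ≢ j` matters: an empty job is disjoint from itself, whereas its placed
  -- interval is not.
  ⊥⇒Disjoint : ∀ i j → i ≢ j → [ a i , b i ⟩ ⊥ [ a j , b j ⟩ → Disjoint i j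
  ⊥⇒Disjoint i j i≢j = ⊥⇒placed (placed (pos i) (a i) (b i)) (placed (pos j) (a j) (b j))
    (≤-trans (b≤ends jobs⁺ i) (≤position _ jobs⁺ j)) (≤-trans (b≤ends jobs⁺ j) (≤position _ jobs⁺ i))
    (position-apart _ jobs⁺ i≢j)

  inj : Fin n → Fin m
  inj k = suc (suc k)

  weightᵐ : Maybe (Fin n) → ℚ
  weightᵐ = maybe′ (λ k → w⁺ (inj k)) 0ℚ

  removed : Maybe (Fin n) → Subset n → ℚ
  removed nothing  S = 0ℚ
  removed (just k) S = if does (k ∈? S) then w⁺ (inj k) else 0ℚ

  removed-∈ : ∀ {k S} → k ∈ S → removed (just k) S ≡ w⁺ (inj k)
  removed-∈ {k} {S} k∈S = cong (if_then w⁺ (inj k) else 0ℚ) (dec-true (k ∈? S) k∈S)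

  removed-∉ : ∀ {k S} → k ∉ S → removed (just k) S ≡ 0ℚ
  removed-∉ {k} {S} k∉S = cong (if_then w⁺ (inj k) else 0ℚ) (dec-false (k ∈? S) k∉S)

  w-⊖ : ∀ i S → w S ≡ removed i S +ℚ w (S ⊖ i)
  w-⊖ nothing  S = sym (ℚ.+-identityˡ _)
  w-⊖ (just k) S with k ∈? S
  ... | yes k∈S = totalWeight-remove _ k∈S
  ... | no  k∉S = sym (trans (ℚ.+-identityˡ _) (cong w (remove-∉ S k k∉S)))

  ∈-⊖⁻ : ∀ {j} i (S : Subset n) → j ∈ S ⊖ i → j ∈ S × just j ≢ i
  ∈-⊖⁻ nothing  S j∈ = j∈ , λ ()
  ∈-⊖⁻ (just k) S j∈ = p─q⊆p S ⁅ k ⁆ j∈ , λ { refl → x∉p-x S k j∈ }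
    where
    x∉p-x : ∀ {n} (p : Subset n) x → x ∉ p - x
    x∉p-x (_ ∷ᵛ p) (suc x) (Vec.there x∈) = x∉p-x p x x∈

  ∈-⊖⁺ : ∀ {j} i (S : Subset n) → j ∈ S → just j ≢ i → j ∈ S ⊖ i
  ∈-⊖⁺ nothing  S j∈ _   = j∈
  ∈-⊖⁺ (just k) S j∈ j≢k = x∈p∧x∉q⇒x∈p─q j∈ λ j∈k → j≢k (cong just (x∈⁅y⁆⇒x≡y k j∈k))

  ∉-⊕⁻ : ∀ {j} i (S : Subset n) → j ∉ S ⊕ i → j ∉ S × just j ≢ i
  ∉-⊕⁻ nothing  S j∉ = j∉ , λ ()
  ∉-⊕⁻ (just k) S j∉ = (λ j∈ → j∉ (x∈p∪q⁺ (inj₁ j∈))) , λ { refl → j∉ (x∈p∪q⁺ (inj₂ (x∈⁅x⁆ k))) }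

  ∉-⊕⁺ : ∀ {j} i (S : Subset n) → j ∉ S → just j ≢ i → j ∉ S ⊕ i
  ∉-⊕⁺ nothing  S j∉ _      = j∉
  ∉-⊕⁺ (just k) S j∉ j≢k j∈ = [ j∉ , (λ j∈k → j≢k (cong just (x∈⁅y⁆⇒x≡y k j∈k))) ]′ (x∈p∪q⁻ S ⁅ k ⁆ j∈)

  w-⊖⊕ : ∀ i S e → Replacement i S e → w (S ⊖ i ⊕ e) ≡ weightᵐ e +ℚ w (S ⊖ i)
  w-⊖⊕ i S nothing  _                   = sym (ℚ.+-identityˡ _)
  w-⊖⊕ i S (just k) (MaybeAll.just k∉ , _) = totalWeight-insert _ (S ⊖ i) k (λ k∈ → proj₁ (∉-⊕⁻ i S k∉) (proj₁ (∈-⊖⁻ i S k∈)))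

  -- The weight of `S ⊖ i` cancels, so the loss depends only on the replacement and on whether `i`
  -- belongs to `S`.
  loss≡ : ∀ i S e → Replacement i S e → loss i S e ≡ removed i S -ℚ weightᵐ e
  loss≡ i S e r = trans (cong₂ _-ℚ_ (w-⊖ i S) (w-⊖⊕ i S e r)) (cancel (removed i S) (weightᵐ e) (w (S ⊖ i)))
    where
    open +-*-Solver
    cancel : ∀ x y z → (x +ℚ z) -ℚ (y +ℚ z) ≡ x -ℚ y
    cancel = solve 3 (λ x y z → (x :+ z) :- (y :+ z) := x :- y) refl

  -≤⇒≤+ : ∀ {x y} → x -ℚ y ≤ℚ Λ → x ≤ℚ y +ℚ Λ
  -≤⇒≤+ {x} {y} le = subst₂ _≤ℚ_ (lemma y x) (ℚ.+-comm Λ y) (ℚ.+-monoˡ-≤ y le)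
    where
    open +-*-Solver
    lemma : ∀ y x → x -ℚ y +ℚ y ≡ x
    lemma = solve 2 (λ y x → x :- y :+ y := x) refl

  ≤+⇒-≤ : ∀ {x y} → x ≤ℚ y +ℚ Λ → x -ℚ y ≤ℚ Λ
  ≤+⇒-≤ {x} {y} le = ℚ.≤-trans (ℚ.+-monoˡ-≤ (ℚ.- y) le) (ℚ.≤-reflexive (lemma y Λ))
    where
    open +-*-Solver
    lemma : ∀ y l → y +ℚ l -ℚ y ≡ l
    lemma = solve 2 (λ y l → y :+ l :- y := l) refl

  -- `Replacement` in terms of placed intervals, with the dummies standing for ∅. That `f` is
  -- outside `S` follows from `¬Disjoint-refl`.
  Fits : Fin m → Maybe (Fin n) → Subset n → Set
  Fits f i S = (∀ k → f ≡ inj k → just k ≢ i) × (∀ j → j ∈ S → just j ≢ i → Disjoint f (inj j))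

  τ : Fin m → Maybe (Fin n)
  τ zero          = nothing
  τ (suc zero)    = nothing
  τ (suc (suc k)) = just k

  weight-τ : ∀ f → weightᵐ (τ f) ≡ w⁺ f
  weight-τ zero          = refl
  weight-τ (suc zero)    = refl
  weight-τ (suc (suc k)) = refl

  𝓕-⊖ : ∀ i S → 𝓕 S → 𝓕 (S ⊖ i)
  𝓕-⊖ i S S∈𝓕 j k j∈ k∈ = S∈𝓕 j k (proj₁ (∈-⊖⁻ i S j∈)) (proj₁ (∈-⊖⁻ i S k∈))

  fits⇒replacement : ∀ i S f → 𝓕 S → Fits f i S → Replacement i S (τ f)
  fits⇒replacement i S zero          S∈𝓕 fits = MaybeAll.nothing , 𝓕-⊖ i S S∈𝓕
  fits⇒replacement i S (suc zero)    S∈𝓕 fits = MaybeAll.nothing , 𝓕-⊖ i S S∈𝓕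
  fits⇒replacement i S (suc (suc k)) S∈𝓕 (k≢i , free) =
    MaybeAll.just (∉-⊕⁺ i S (λ k∈S → ¬Disjoint-refl {inj k} (free k k∈S (k≢i k refl))) (k≢i k refl)) ,
    λ x y x∈ y∈ x≢y → apart′ x y x≢y (split x x∈) (split y y∈)
    where
    split : ∀ x → x ∈ (S ⊖ i) ∪ ⁅ k ⁆ → x ∈ S ⊖ i ⊎ x ≡ k
    split x x∈ with x∈p∪q⁻ (S ⊖ i) ⁅ k ⁆ x∈
    ... | inj₁ x∈S = inj₁ x∈S
    ... | inj₂ x∈k = inj₂ (x∈⁅y⁆⇒x≡y k x∈k)
    apartᵏ : ∀ x → x ∈ S ⊖ i → interval k ⊥ interval x
    apartᵏ x x∈ = Disjoint⇒⊥ (inj k) (inj x) (free x (proj₁ (∈-⊖⁻ i S x∈)) (proj₂ (∈-⊖⁻ i S x∈)))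
    apart′ : ∀ x y → x ≢ y → x ∈ S ⊖ i ⊎ x ≡ k → y ∈ S ⊖ i ⊎ y ≡ k → interval x ⊥ interval y
    apart′ x y x≢y (inj₁ x∈)   (inj₁ y∈)   = 𝓕-⊖ i S S∈𝓕 x y x∈ y∈ x≢y
    apart′ x y x≢y (inj₁ x∈)   (inj₂ refl) = apartᵏ x x∈ ∘ swap
    apart′ x y x≢y (inj₂ refl) (inj₁ y∈)   = apartᵏ y y∈
    apart′ x y x≢y (inj₂ refl) (inj₂ refl) = contradiction refl x≢y

  replacement⇒fits : ∀ i S f → Replacement i S (τ f) → Fits f i S
  replacement⇒fits i S zero          _ = (λ _ ()) , λ j _ _ → ⊥⇒Disjoint zero (inj j) (λ ()) (λ { ((_ , ()) , _) })
  replacement⇒fits i S (suc zero)    _ = (λ _ ()) , λ j _ _ → ⊥⇒Disjoint (suc zero) (inj j) (λ ()) (λ { ((_ , ()) , _) })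
  replacement⇒fits i S (suc (suc k)) (MaybeAll.just k∉ , S′∈𝓕) =
    (λ { _ refl → proj₂ (∉-⊕⁻ i S k∉) }) ,
    λ j j∈S j≢i → let k≢j = λ { refl → proj₁ (∉-⊕⁻ i S k∉) j∈S } in
      ⊥⇒Disjoint (inj k) (inj j) (k≢j ∘ Fin.suc-injective ∘ Fin.suc-injective)
        (S′∈𝓕 k j (x∈p∪q⁺ (inj₂ (x∈⁅x⁆ k))) (x∈p∪q⁺ (inj₁ (∈-⊖⁺ i S j∈S j≢i))) k≢j)

  -- The minimum is attained: either at its starting value, which belongs to the replacement ∅, or
  -- at a listed replacement.
  Δ≤⇒replacement : ∀ i S → 𝓕 S → Δ i S ≤ℚ Λ → ∃ λ e → Replacement i S e × removed i S ≤ℚ weightᵐ e +ℚ Λ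
  Δ≤⇒replacement i S S∈𝓕 Δ≤Λ = [ (λ eq → found nothing (MaybeAll.nothing , 𝓕-⊖ i S S∈𝓕) eq) , listed ]′
      (argmin-sel id (loss i S nothing) (map (loss i S) (replacements i S)))
    where
    found : ∀ e → Replacement i S e → Δ i S ≡ loss i S e → ∃ λ e → Replacement i S e × removed i S ≤ℚ weightᵐ e +ℚ Λ
    found e r eq = e , r , -≤⇒≤+ (subst (_≤ℚ Λ) (trans eq (loss≡ i S e r)) Δ≤Λ)
    listed : Δ i S List.∈ map (loss i S) (replacements i S) → ∃ λ e → Replacement i S e × removed i S ≤ℚ weightᵐ e +ℚ Λ
    listed ∈ = let e , e∈ , eq = ∈-map⁻ (loss i S) ∈ in
      found e (proj₂ (∈-filter⁻ (replacement? i S) {xs = nothing ∷ map just (allFin n)} e∈)) eq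

  fits⇒Δ≤ : ∀ i S f → 𝓕 S → Fits f i S → removed i S ≤ℚ w⁺ f +ℚ Λ → Δ i S ≤ℚ Λ
  fits⇒Δ≤ i S f S∈𝓕 fits le = min≤v⁺ (loss i S nothing) (map (loss i S) (replacements i S)) (inj₂ (Any.map⁺
      (List.lose (∈-filter⁺ (replacement? i S) (candidate (τ f)) replacement)
        (subst (_≤ℚ Λ) (sym (loss≡ i S (τ f) replacement))
          (≤+⇒-≤ (subst (λ x → removed i S ≤ℚ x +ℚ Λ) (sym (weight-τ f)) le))))))
    where
    replacement = fits⇒replacement i S f S∈𝓕 fits
    candidate : ∀ e → e List.∈ nothing ∷ map just (allFin n)
    candidate nothing  = here refl
    candidate (just k) = there (∈-map⁺ just (∈-allFin k))

  copyJob : Fin m × Fin m → ColoredJob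
  copyJob (i , e) = record
    { ℓ = lo i ⊓ lo e ; a = lo i ; b = hi i ; r = hi i ⊔ hi e
    ; ℓ≤a = m⊓n≤m _ _ ; a<b = lo<hi i ; b≤r = m≤m⊔n _ _
    ; weight = w⁺ i ; 0≤weight = proj₂ (wt i) }

  -- When nothing is removed from `S`, adding either guess satisfies the bound; being distinct, one
  -- of them is left when the other breaks down.
  Good : Fin m × Fin m → Set
  Good (g₁ , g₂) = g₁ ≢ g₂ × 0ℚ ≤ℚ w⁺ g₁ +ℚ Λ × 0ℚ ≤ℚ w⁺ g₂ +ℚ Λ

  good? : Decidable Good
  good? (g₁ , g₂) = ¬? (g₁ Fin.≟ g₂) ×-dec ((0ℚ ℚ.≤? w⁺ g₁ +ℚ Λ) ×-dec (0ℚ ℚ.≤? w⁺ g₂ +ℚ Λ))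

  -- The pair `(i , i)` encodes that `g₁` replaces `i`. It passes the test that the two jobs meet,
  -- and its copy has no blue part.
  substitute : Fin m → Fin m → Fin m → Fin m
  substitute g₁ i e = if does (e Fin.≟ i) then g₁ else e

  Usable : Fin m × Fin m → Fin m × Fin m → Set
  Usable (g₁ , g₂) (i , e) = Disjoint i g₁ × Disjoint i g₂ × ¬ Disjoint i e × w⁺ i ≤ℚ w⁺ (substitute g₁ i e) +ℚ Λ

  usable? : ∀ g → Decidable (Usable g)
  usable? (g₁ , g₂) (i , e) = disjoint?⁺ i g₁ ×-dec (disjoint?⁺ i g₂ ×-dec (¬? (disjoint?⁺ i e) ×-dec (w⁺ i ℚ.≤? w⁺ (substitute g₁ i e) +ℚ Λ)))

  copies : Fin m × Fin m → List (Fin m × Fin m)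
  copies g = filter (usable? g) (cartesianProduct (allFin m) (allFin m))

  selection : List (Fin m × Fin m) → Subset n
  selection T = tabulateᵛ (λ k → occurs (map proj₁ T) (inj k))

  -- Colored solutions yield robust solutions of the same weight

  module Sound (g₁ g₂ : Fin m) (good : Good (g₁ , g₂)) (T : List (Fin m × Fin m))
    (usable : All (Usable (g₁ , g₂)) T) (compatible : AllPairs (Compatible on copyJob) T) where

    S : Subset n
    S = selection T

    chosen : ∀ {k} → k ∈ S → ∃ λ e → (inj k , e) List.∈ T
    chosen {k} k∈S with ∈-map⁻ proj₁ (occurs⇒∈ (map proj₁ T) (inj k) (trans (sym (lookup∘tabulate _ k)) ([]=⇒lookup k∈S)))
    ... | (_ , e) , ∈T , refl = e , ∈T

    separate : ∀ {j k f e} → (inj j , f) List.∈ T → (inj k , e) List.∈ T → j ≢ k → Compatible (copyJob (inj j , f)) (copyJob (inj k , e))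
    separate j∈ k∈ j≢k = AllPairs-lookup {R = Compatible on copyJob} swap compatible j∈ k∈ λ { refl → j≢k refl }

    -- The whole interval of the copy of `k` contains both `k` and its replacement `e`, and the red
    -- interval of the copy of `j` misses all of it.
    disjoint : ∀ {j k f e} → (inj j , f) List.∈ T → (inj k , e) List.∈ T → j ≢ k → Disjoint (inj j) (inj k) × Disjoint e (inj j)
    disjoint {j} {k} {f} {e} j∈ k∈ j≢k =
      ⊥⇒≤ (lo<hi (inj j)) (lo<hi (inj k)) (λ (p , (q , r)) → dis (p , (≤-trans (m⊓n≤m _ _) q , <-≤-trans r (m≤m⊔n _ _)))) ,
      ⊥⇒≤ (lo<hi e) (lo<hi (inj j)) (λ ((q , r) , p) → dis (p , (≤-trans (m⊓n≤n _ _) q , <-≤-trans r (m≤n⊔m _ _))))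
      where dis = proj₁ (separate j∈ k∈ j≢k)

    S∈𝓕 : 𝓕 S
    S∈𝓕 j k j∈S k∈S j≢k = Disjoint⇒⊥ (inj j) (inj k) (proj₁ (disjoint (proj₂ (chosen j∈S)) (proj₂ (chosen k∈S)) j≢k))

    free₁ : ∀ j → j ∈ S → Disjoint g₁ (inj j)
    free₁ j j∈S = swap⊎ (proj₁ (All.lookup usable (proj₂ (chosen j∈S))))

    free₂ : ∀ j → j ∈ S → Disjoint g₂ (inj j)
    free₂ j j∈S = swap⊎ (proj₁ (proj₂ (All.lookup usable (proj₂ (chosen j∈S)))))

    -- If `i` is ∅ or outside `S`, nothing is lost and `g₁` can be added, unless `i` is `g₁` itself;
    -- then `g₂` is added. If `i` is in `S`, its copy names the replacement: `g₁` for the pair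
    -- `(i , i)`, otherwise the job that forms the blue part.
    Δ≤ : ∀ i → Δ i S ≤ℚ Λ
    Δ≤ nothing = fits⇒Δ≤ nothing S g₁ S∈𝓕 ((λ _ _ ()) , λ j j∈S _ → free₁ j j∈S) (proj₁ (proj₂ good))
    Δ≤ (just k) with k ∈? S
    ... | no k∉S with g₁ Fin.≟ inj k
    ...   | no g₁≢k = fits⇒Δ≤ (just k) S g₁ S∈𝓕 ((λ { _ eq refl → g₁≢k eq }) , λ j j∈S _ → free₁ j j∈S)
            (subst (_≤ℚ w⁺ g₁ +ℚ Λ) (sym (removed-∉ k∉S)) (proj₁ (proj₂ good)))
    ...   | yes refl = fits⇒Δ≤ (just k) S g₂ S∈𝓕 ((λ { _ eq refl → proj₁ good (sym eq) }) , λ j j∈S _ → free₂ j j∈S)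
            (subst (_≤ℚ w⁺ g₂ +ℚ Λ) (sym (removed-∉ k∉S)) (proj₂ (proj₂ good)))
    Δ≤ (just k) | yes k∈S with chosen k∈S
    ... | e , k∈T with e Fin.≟ inj k | proj₂ (proj₂ (proj₂ (All.lookup usable k∈T)))
    ...   | yes refl | le = fits⇒Δ≤ (just k) S g₁ S∈𝓕
            ((λ { _ refl refl → ¬Disjoint-refl {g₁} (free₁ k k∈S) }) , λ j j∈S _ → free₁ j j∈S)
            (subst (_≤ℚ w⁺ g₁ +ℚ Λ) (sym (removed-∈ k∈S)) le)
    ...   | no e≢k   | le = fits⇒Δ≤ (just k) S e S∈𝓕
            ((λ { _ eq refl → e≢k eq }) , λ j j∈S j≢k → proj₂ (disjoint (proj₂ (chosen j∈S)) k∈T (j≢k ∘ cong just)))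
            (subst (_≤ℚ w⁺ e +ℚ Λ) (sym (removed-∈ k∈S)) le)

    feasible : Feasible S
    feasible = S∈𝓕 , Δ≤

    value : w S ≡ ∑ (map (jobWeight ∘ copyJob) T)
    value = begin
      w S                              ≡⟨ sum-cong-≗ (λ k → cong (if_then w⁺ (inj k) else 0ℚ) (lookup∘tabulate _ k)) ⟩
      -- `T` may contain copies of the dummies, which `selection` ignores; as they have weight 0,
      -- the first two summands vanish.
      sum (λ k → term (inj k))         ≡⟨ sym (trans (cong₂ (λ x y → x +ℚ (y +ℚ sum (λ k → term (inj k))))
                                                       (zeros (occurs (map proj₁ T) zero)) (zeros (occurs (map proj₁ T) (suc zero))))
                                                     (trans (ℚ.+-identityˡ _) (ℚ.+-identityˡ _))) ⟩
      sum term                         ≡⟨ sum-occurs wt (map proj₁ T) (AllPairs.map⁺ (AllPairs.map (λ {x} {y} → distinct x y) compatible)) ⟩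
      ∑ (map wt (map proj₁ T))         ≡⟨ cong ∑ (sym (map-∘ T)) ⟩
      ∑ (map (jobWeight ∘ copyJob) T)  ∎
      where
      open ≡-Reasoning
      term : Fin m → ℚ
      term k = if occurs (map proj₁ T) k then w⁺ k else 0ℚ
      zeros : ∀ b → (if b then 0ℚ else 0ℚ) ≡ 0ℚ
      zeros false = refl
      zeros true  = refl
      distinct : ∀ x y → Compatible (copyJob x) (copyJob y) → proj₁ x ≢ proj₁ y
      distinct (i , e) (_ , f) (dis , _) refl = dis ((≤-refl , lo<hi i) , (m⊓n≤m _ _ , <-≤-trans (lo<hi i) (m≤m⊔n _ _)))

  -- A job disjoint from both `k` and `e` is on the same side of both; if it lay between them, then
  -- `k` and `e` would be disjoint.
  hull⊥ : ∀ i k e → Disjoint i k → Disjoint i e → ¬ Disjoint k e → [ lo i , hi i ⟩ ⊥ [ lo k ⊓ lo e , hi k ⊔ hi e ⟩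
  hull⊥ i k e (inj₁ i<k) (inj₁ i<e) _       ((_ , x<h) , (l≤x , _)) = <⇒≱ x<h (≤-trans (⊓-glb i<k i<e) l≤x)
  hull⊥ i k e (inj₂ k<i) (inj₂ e<i) _       ((l≤x , _) , (_ , x<h)) = <⇒≱ x<h (≤-trans (⊔-lub k<i e<i) l≤x)
  hull⊥ i k e (inj₁ i<k) (inj₂ e<i) meet _ = meet (inj₂ (≤-trans e<i (≤-trans (<⇒≤ (lo<hi i)) i<k)))
  hull⊥ i k e (inj₂ k<i) (inj₁ i<e) meet _ = meet (inj₁ (≤-trans k<i (≤-trans (<⇒≤ (lo<hi i)) i<e)))

  -- If the replacement of i in S is disjoint from i, then it can be added to S,
  -- so that the heaviest job that can be added to S is a replacement of i as well.
  module Complete (S : Subset n) (feasible : Feasible S) where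

    private
      S∈𝓕 = proj₁ feasible

      Free : Fin m → Set
      Free f = ∀ j → j ∈ S → Disjoint f (inj j)

      free? : Decidable Free
      free? f = Fin.all? λ j → (j ∈? S) →-dec disjoint?⁺ f (inj j)

      free-zero : Free zero
      free-zero j j∈S = proj₂ (replacement⇒fits nothing S zero (MaybeAll.nothing , S∈𝓕)) j j∈S λ ()

      heaviest : ∃ λ g → Free g × ∀ f → Free f → w⁺ f ≤ℚ w⁺ g
      -- The dummy `zero` can be added to every `S`, so the maximum is not over an empty set.
      heaviest = [ id , (λ none → contradiction free-zero (none zero)) ]′ (maximum w⁺ free?)

      σ : Maybe (Fin n) → Fin m
      σ nothing  = zero
      σ (just k) = inj k

      τ-σ : ∀ e → τ (σ e) ≡ e
      τ-σ nothing  = refl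
      τ-σ (just k) = refl

      τ-just : ∀ f {k} → τ f ≡ just k → f ≡ inj k
      τ-just (suc (suc k)) refl = refl

      replace : ∀ i e f → τ f ≡ e → Replacement i S e → removed i S ≤ℚ weightᵐ e +ℚ Λ → Fits f i S × removed i S ≤ℚ w⁺ f +ℚ Λ
      replace i e f refl r le = replacement⇒fits i S f r , subst (λ x → removed i S ≤ℚ x +ℚ Λ) (weight-τ f) le

      fit : ∀ i → ∃ λ f → Fits f i S × removed i S ≤ℚ w⁺ f +ℚ Λ
      fit i = let e , r , le = Δ≤⇒replacement i S S∈𝓕 (proj₂ feasible i) in σ e , replace i e (σ e) (τ-σ e) r le

    g₁ : Fin m
    g₁ = proj₁ heaviest

    private
      free₁ : Free g₁
      free₁ = proj₁ (proj₂ heaviest)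

      enough : ∀ {x} f → Free f → x ≤ℚ w⁺ f +ℚ Λ → x ≤ℚ w⁺ g₁ +ℚ Λ
      enough f free le = ℚ.≤-trans le (ℚ.+-monoˡ-≤ Λ (proj₂ (proj₂ heaviest) f free))

      0≤g₁ : 0ℚ ≤ℚ w⁺ g₁ +ℚ Λ
      0≤g₁ = let f , (_ , fits) , le = fit nothing in enough f (λ j j∈S → fits j j∈S λ ()) le

      ∉τg₁ : ∀ j → j ∈ S → just j ≢ τ g₁
      ∉τg₁ j j∈S eq = ¬Disjoint-refl {inj j} (subst (λ f → Disjoint f (inj j)) (τ-just g₁ (sym eq)) (free₁ j j∈S))

      removed≡0 : ∀ i → (∀ j → j ∈ S → just j ≢ i) → removed i S ≡ 0ℚ
      removed≡0 nothing  _ = refl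
      removed≡0 (just k) h = removed-∉ (λ k∈S → h k k∈S refl)

      -- If `g` is a dummy and the replacement is ∅, the other dummy represents ∅. A genuine
      -- replacement differs from `g` because it must not be the job that broke down.
      another : ∀ g e → Replacement (τ g) S e → ∃ λ f → τ f ≡ e × g ≢ f
      another zero    nothing  _ = suc zero , refl , λ ()
      another (suc _) nothing  _ = zero , refl , λ ()
      another g       (just k) r = inj k , refl , λ { refl → proj₁ (replacement⇒fits (τ g) S (inj k) r) k refl refl }

      -- This is the constraint for the breakdown of `g₁`. Since `g₁` is not in `S`, nothing is
      -- removed, and the replacement is a further job that can be added to `S`.
      second : ∃ λ g → g₁ ≢ g × Free g × 0ℚ ≤ℚ w⁺ g +ℚ Λ
      second =
        let e , r , le = Δ≤⇒replacement (τ g₁) S S∈𝓕 (proj₂ feasible (τ g₁))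
            f , τf≡e , g₁≢f = another g₁ e r
            (_ , fits) , le′ = replace (τ g₁) e f τf≡e r le
        in f , g₁≢f , (λ j j∈S → fits j j∈S (∉τg₁ j j∈S)) , subst (_≤ℚ w⁺ f +ℚ Λ) (removed≡0 (τ g₁) ∉τg₁) le′

    g₂ : Fin m
    g₂ = proj₁ second

    good : Good (g₁ , g₂)
    good = proj₁ (proj₂ second) , 0≤g₁ , proj₂ (proj₂ (proj₂ second))

    private
      apart⁺ : ∀ {j k} → j ∈ S → k ∈ S → j ≢ k → Disjoint (inj j) (inj k)
      apart⁺ {j} {k} j∈S k∈S j≢k =
        ⊥⇒Disjoint (inj j) (inj k) (j≢k ∘ Fin.suc-injective ∘ Fin.suc-injective) (S∈𝓕 j k j∈S k∈S j≢k)

      Choice : Fin n → Fin m → Set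
      Choice k e = ¬ Disjoint (inj k) e × (∀ j → j ∈ S → j ≢ k → Disjoint e (inj j))
                   × w⁺ (inj k) ≤ℚ w⁺ (substitute g₁ (inj k) e) +ℚ Λ

      choice : ∀ k → k ∈ S → ∃ (Choice k)
      choice k k∈S = let f , fits , le = fit (just k) in
        decide f fits (subst (_≤ℚ w⁺ f +ℚ Λ) (removed-∈ k∈S) le) (disjoint?⁺ (inj k) f)
        where
        decide : ∀ f → Fits f (just k) S → w⁺ (inj k) ≤ℚ w⁺ f +ℚ Λ → Dec (Disjoint (inj k) f) → ∃ (Choice k)
        decide f (_ , fits) le (yes d) =
          inj k , ¬Disjoint-refl {inj k} , (λ j j∈S j≢k → apart⁺ k∈S j∈S (j≢k ∘ sym)) ,
          subst (λ g → w⁺ (inj k) ≤ℚ w⁺ g +ℚ Λ) (sym (cong (if_then g₁ else inj k) (dec-true (inj k Fin.≟ inj k) refl)))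
            (enough f free le)
          where
          free : Free f
          free j j∈S with j Fin.≟ k
          ... | yes refl = swap⊎ d
          ... | no j≢k   = fits j j∈S (j≢k ∘ just-injective)
        decide f (f≢k , fits) le (no ¬d) =
          f , ¬d , (λ j j∈S j≢k → fits j j∈S (j≢k ∘ just-injective)) ,
          subst (λ g → w⁺ (inj k) ≤ℚ w⁺ g +ℚ Λ) (sym (cong (if_then g₁ else f) (dec-false (f Fin.≟ inj k) (λ f≡k → f≢k k f≡k refl)))) le

      choose : ∀ k → Dec (k ∈ S) → Fin m
      choose k (yes k∈S) = proj₁ (choice k k∈S)
      -- An arbitrary value, as `T` lists only members of `S`.
      choose k (no _)    = zero

      choose-ok : ∀ {k} (d : Dec (k ∈ S)) → k ∈ S → Choice k (choose k d)
      choose-ok (yes k∈S) _   = proj₂ (choice _ k∈S)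
      choose-ok (no k∉S)  k∈S = contradiction k∈S k∉S

      c : Fin m → Fin m
      c (suc (suc k)) = choose k (k ∈? S)
      c _             = zero

      ok : ∀ {k} → k ∈ S → Choice k (c (inj k))
      ok {k} = choose-ok (k ∈? S)

    T : List (Fin m × Fin m)
    T = map (λ j → j , c j) (map inj (elements S))

    private
      usable : ∀ {k} → k ∈ S → Usable (g₁ , g₂) (inj k , c (inj k))
      usable {k} k∈S = swap⊎ (free₁ k k∈S) , swap⊎ (proj₁ (proj₂ (proj₂ second)) k k∈S) , proj₁ (ok k∈S) , proj₂ (proj₂ (ok k∈S))

      js⊆ : map inj (elements S) ⊆ allFin m
      js⊆ = zero ∷ʳ suc zero ∷ʳ ⊆-trans (map⁺ inj (elements-⊆ S)) (⊆-reflexive (map-tabulate id inj))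

      T⊆product : T ⊆ cartesianProduct (allFin m) (allFin m)
      T⊆product = ⊆-product c {xs = allFin m} {ys = allFin m} (λ j → ∈-allFin (c j)) js⊆

      red⊥whole : ∀ {j k} → j ∈ S → k ∈ S → j ≢ k →
                  ColoredJob.red (copyJob (inj j , c (inj j))) ⊥ ColoredJob.whole (copyJob (inj k , c (inj k)))
      red⊥whole {j} {k} j∈S k∈S j≢k = hull⊥ (inj j) (inj k) (c (inj k)) (apart⁺ j∈S k∈S j≢k)
        (swap⊎ (proj₁ (proj₂ (ok k∈S)) j j∈S j≢k)) (proj₁ (ok k∈S))

      compatible-copies : ∀ {j k} → j ∈ S × k ∈ S × j ≢ k → Compatible (copyJob (inj j , c (inj j))) (copyJob (inj k , c (inj k)))
      compatible-copies (j∈S , k∈S , j≢k) = red⊥whole j∈S k∈S j≢k , red⊥whole k∈S j∈S (j≢k ∘ sym)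

    T⊆copies : T ⊆ copies (g₁ , g₂)
    T⊆copies = subst (_⊆ copies (g₁ , g₂))
      (filter-all (usable? (g₁ , g₂)) (All.map⁺ {P = Usable (g₁ , g₂)} (All.map⁺ (All.map usable (elements-∈ S)))))
      (filter⁺ (usable? (g₁ , g₂)) (usable? (g₁ , g₂)) (λ { refl → id }) T⊆product)

    compatible : AllPairs (Compatible on copyJob) T
    compatible = AllPairs.map⁺ {R = Compatible on copyJob} (AllPairs.map⁺ (AllPairs.map compatible-copies (elements-pairs S)))

    value : ∑ (map (jobWeight ∘ copyJob) T) ≡ w S
    value = trans (cong ∑ (trans (sym (map-∘ (map inj (elements S)))) (sym (map-∘ (elements S))))) (∑-elements (wt ∘ inj) S)

-- The algorithm

-- Every tree has size at least 1, so `suc x ≤ 2 * x`. This trades the base `suc x` of `⟦⟧-bound`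
-- for `x`, at the price of the factor `2 ^ k`.
polynomialTime : (P : MaximizationProblem) → let open MaximizationProblem P in
                 (answer : ∀ I → Maybe (Solution I)) → encodeInstance ⇝ (λ I → encodeMaybe encodeSolution (answer I)) →
                 (∀ I → Correct I (answer I)) → PolynomialTimeSolvable P
polynomialTime P answer p correct = code p , c * 2 ^ k , k , λ I →
    let t , d , le = run p I
        x = size (encodeInstance I)
    in answer I , t , d , ≤-trans (≤-trans (m≤m+n t _) le) (≤-trans (bound x) (double x (1≤size (encodeInstance I)))) , correct I
  where
  open MaximizationProblem P
  open _⇝_
  c     = proj₁ (⟦⟧-bound (cost p))
  k     = proj₁ (proj₂ (⟦⟧-bound (cost p)))
  bound = proj₂ (proj₂ (⟦⟧-bound (cost p)))
  double : ∀ x → 1 ≤ x → c * suc x ^ k ≤ c * 2 ^ k * x ^ k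
  double x 1≤x = begin
    c * suc x ^ k        ≤⟨ *-monoʳ-≤ c (^-monoˡ-≤ k (+-mono-≤ 1≤x (≤-reflexive (sym (+-identityʳ x))))) ⟩
    c * (2 * x) ^ k      ≡⟨ cong (c *_) (^-distribʳ-* 2 x k) ⟩
    c * (2 ^ k * x ^ k)  ≡⟨ sym (*-assoc c (2 ^ k) (x ^ k)) ⟩
    c * 2 ^ k * x ^ k    ∎
    where open ≤-Reasoning

encode-map : {B C : Set} (enc : C → Tree) (f : B → C) (xs : List B) → encodeList enc (map f xs) ≡ encodeList (enc ∘ f) xs
encode-map enc f []       = refl
encode-map enc f (x ∷ xs) = cong (node _) (encode-map enc f xs)

encode-toList : ∀ {B : Set} {n} (enc : B → Tree) (v : Vec B n) → encodeVec enc v ≡ encodeList enc (toList v)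
encode-toList enc []ᵛ      = refl
encode-toList enc (x ∷ᵛ v) = cong (node _) (encode-toList enc v)

encode-tabulate : ∀ {B : Set} {n} (f : B → Bool) (g : Fin n → B) → encodeList encodeBool (map f (tabulate g)) ≡ encodeSubset (tabulateᵛ (f ∘ g))
encode-tabulate {n = zero}  f g = refl
encode-tabulate {n = suc n} f g = cong (node _) (encode-tabulate f (g ∘ suc))

number-tabulate : ∀ {B : Set} {n} p (v : Vec B n) → number p (toList v) ≡ tabulate (λ i → position p v i , lookup v i)
number-tabulate p []ᵛ      = refl
number-tabulate p (x ∷ᵛ v) = cong ((end p (toList v) , x) ∷_) (number-tabulate p v)

open RobustInstance using (Λ)
open Reduction

Index : RobustInstance → Set
Index I = Fin (m I)

Placement : Set
Placement = ℕ × ℕ × ℕ × Weight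

encodePlacement : Placement → Tree
encodePlacement (p , l , h , w) = node (encodeℕ p) (node (encodeℕ l) (node (encodeℕ h) (encodeWeight w)))

place : ℕ × Job → Placement
place (p , j) = p , start p (Job.a j) (Job.b j) , stop⁺ p (Job.a j) (Job.b j) , Job.weight j , Job.0≤weight j

-- An index is represented by all the data that programs need of it. The position serves as its
-- identity: by `pos-injective`, two comparisons decide whether indices are equal.
encodeIndex : ∀ I → Index I → Tree
encodeIndex I i = encodePlacement (pos I i , lo I i , hi I i , wt I i)

encodePair : ∀ I → Index I × Index I → Tree
encodePair I (i , e) = node (encodeIndex I i) (encodeIndex I e)

pos-injective : ∀ I i j → pos I i ≤ pos I j → pos I j ≤ pos I i → i ≡ j
pos-injective I i j i≤j j≤i with i Fin.≟ j
... | yes i≡j = i≡j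
... | no  i≢j with position-apart (ends (toList (jobs⁺ I))) (jobs⁺ I) i≢j
...   | inj₁ lt = contradiction j≤i (<⇒≱ (<-≤-trans (n<odd _) lt))
...   | inj₂ lt = contradiction i≤j (<⇒≱ (<-≤-trans (n<odd _) lt))

endsᶜ : (js : A → List Job) → e ⇝ (λ a → encodeList encodeJob (js a)) → e ⇝ (λ a → encodeℕ (ends (js a)))
endsᶜ {A} {e} js p = recᶜ (λ _ → encodeJob) (λ _ ys → encodeℕ (ends ys)) p nilᶜ
  (⊙ᶜ (λ (_ , j , _) → Job.b j) (λ (_ , _ , ys) → ends ys) (fst (snd (fst (fst idᶜ)))) (snd (fst idᶜ)))
  𝕏 (λ a ys → ≤-trans (bound ys) (m≤n+m _ (size (e a))))
  where
  bound : ∀ ys → size (encodeℕ (ends ys)) ≤ size (encodeList encodeJob ys)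
  bound []       = ≤-refl
  bound (j ∷ ys) = ≤-trans (size-⊙ (Job.b j) (ends ys)) (+-mono-≤ b≤ (bound ys))
    where
    b≤ : size (encodeℕ (Job.b j)) ≤ 1 + size (encodeJob j)
    b≤ = ≤-trans (≤-trans (m≤m+n _ _) (n≤1+n _)) (≤-trans (m≤n+m _ (size (encodeℕ (Job.a j)))) (≤-trans (n≤1+n _) (n≤1+n _)))

-- The reduction as a polynomial-time program

module Algorithm (solvable : PolynomialTimeSolvable IntervalSchedulingWithColors) where
  open Oracle solvable
  open Arithmetic solvable

  placeᶜ : (x : A → ℕ × Job) → e ⇝ (λ a → node (encodeℕ (proj₁ (x a))) (encodeJob (proj₂ (x a)))) →
           e ⇝ (λ a → encodePlacement (place (x a)))
  placeᶜ {A} {e} x p = pair (fst p) (pair startᶜ (pair stopᶜ (snd (snd (snd p)))))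
    where
    pᵃ aᵃ bᵃ : A → ℕ
    pᵃ a = proj₁ (x a)
    aᵃ a = Job.a (proj₂ (x a))
    bᵃ a = Job.b (proj₂ (x a))
    emptyᶜ : e ⇝ (λ a → encodeBool (does (bᵃ a ≤? aᵃ a)))
    emptyᶜ = ≤ᶜ bᵃ aᵃ (fst (snd (snd p))) (fst (snd p))
    startᶜ : e ⇝ (λ a → encodeℕ (start (pᵃ a) (aᵃ a) (bᵃ a)))
    startᶜ = if-encᶜ (λ _ → encodeℕ) (λ a → does (bᵃ a ≤? aᵃ a)) pᵃ aᵃ emptyᶜ (fst p) (fst (snd p))
    stopᶜ : e ⇝ (λ a → encodeℕ (stop⁺ (pᵃ a) (aᵃ a) (bᵃ a)))
    stopᶜ = if-encᶜ (λ _ → encodeℕ) (λ a → does (bᵃ a ≤? aᵃ a)) (odd ∘ pᵃ) bᵃ emptyᶜ (oddᶜ pᵃ (fst p)) (fst (snd (snd p)))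

  -- The preprocessed instance, from which all later programs start: every index with its placed
  -- interval and weight, together with λ.
  context : RobustInstance → Tree
  context I = node (encodeList (encodeIndex I) (allFin (m I))) (encodeℚ (Λ I))

  contextᶜ : encodeRobustInstance ⇝ context
  contextᶜ = pair (castᶜ lemma placedᶜ) (snd idᶜ)
    where
    base : RobustInstance → ℕ
    base I = ends (toList (jobs⁺ I))
    jobsᶜ : encodeRobustInstance ⇝ (λ I → encodeList encodeJob (toList (jobs⁺ I)))
    jobsᶜ = pair (constᶜ (encodeJob dummy)) (pair (constᶜ (encodeJob dummy))
      (castᶜ (λ I → encode-toList encodeJob (RobustInstance.jobs I)) (fst idᶜ)))
    numberedᶜ : encodeRobustInstance ⇝ (λ I → encodeList (λ (p , j) → node (encodeℕ p) (encodeJob j)) (number (base I) (toList (jobs⁺ I))))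
    numberedᶜ = snd (numberᶜ (λ _ → encodeJob) base (λ I → toList (jobs⁺ I)) (endsᶜ (λ I → toList (jobs⁺ I)) jobsᶜ) jobsᶜ)
    placedᶜ : encodeRobustInstance ⇝ (λ I → encodeList encodePlacement (map place (number (base I) (toList (jobs⁺ I)))))
    placedᶜ = mapᶜ (λ _ (p , j) → node (encodeℕ p) (encodeJob j)) (λ _ → encodePlacement)
      {xs = λ I → number (base I) (toList (jobs⁺ I))} {F = λ _ → place} numberedᶜ (placeᶜ proj₂ (fst idᶜ))
    lemma : ∀ I → encodeList encodePlacement (map place (number (base I) (toList (jobs⁺ I)))) ≡ encodeList (encodeIndex I) (allFin (m I))
    lemma I = trans (cong (λ xs → encodeList encodePlacement (map place xs)) (number-tabulate (base I) (jobs⁺ I)))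
      (trans (cong (encodeList encodePlacement) (trans (map-tabulate (λ i → position (base I) (jobs⁺ I) i , lookup (jobs⁺ I) i) place)
          (sym (map-tabulate id (λ i → place (position (base I) (jobs⁺ I) i , lookup (jobs⁺ I) i))))))
        (encode-map encodePlacement (λ i → place (position (base I) (jobs⁺ I) i , lookup (jobs⁺ I) i)) (allFin (m I))))

  module Tests {A : Set} {e : A → Tree} (I : A → RobustInstance) where

    disjointᶜ : (x y : ∀ a → Index (I a)) → e ⇝ (λ a → encodeIndex (I a) (x a)) → e ⇝ (λ a → encodeIndex (I a) (y a)) →
                e ⇝ (λ a → encodeBool (does (disjoint?⁺ (I a) (x a) (y a))))
    disjointᶜ x y p q = orᶜ (λ a → does (hi (I a) (x a) ≤? lo (I a) (y a))) (λ a → does (hi (I a) (y a) ≤? lo (I a) (x a)))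
      (≤ᶜ (λ a → hi (I a) (x a)) (λ a → lo (I a) (y a)) (fst (snd (snd p))) (fst (snd q)))
      (≤ᶜ (λ a → hi (I a) (y a)) (λ a → lo (I a) (x a)) (fst (snd (snd q))) (fst (snd p)))

    equalᶜ : (x y : ∀ a → Index (I a)) → e ⇝ (λ a → encodeIndex (I a) (x a)) → e ⇝ (λ a → encodeIndex (I a) (y a)) →
             e ⇝ (λ a → encodeBool (does (x a Fin.≟ y a)))
    equalᶜ x y p q = castᶜ (λ a → cong encodeBool (lemma (I a) (x a) (y a)))
      (andᶜ (λ a → does (pos (I a) (x a) ≤? pos (I a) (y a))) (λ a → does (pos (I a) (y a) ≤? pos (I a) (x a)))
        (≤ᶜ (λ a → pos (I a) (x a)) (λ a → pos (I a) (y a)) (fst p) (fst q))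
        (≤ᶜ (λ a → pos (I a) (y a)) (λ a → pos (I a) (x a)) (fst q) (fst p)))
      where
      lemma : ∀ I i j → does (pos I i ≤? pos I j) ∧ does (pos I j ≤? pos I i) ≡ does (i Fin.≟ j)
      lemma I i j = does-⇔ (mk⇔ (λ (i≤j , j≤i) → pos-injective I i j i≤j j≤i) (λ { refl → ≤-refl , ≤-refl }))
        ((pos I i ≤? pos I j) ×-dec (pos I j ≤? pos I i)) (i Fin.≟ j)

    goodᶜ : (g : ∀ a → Index (I a) × Index (I a)) → e ⇝ (λ a → encodePair (I a) (g a)) → e ⇝ (λ a → encodeℚ (Λ (I a))) →
            e ⇝ (λ a → encodeBool (does (good? (I a) (g a))))
    goodᶜ g p q = andᶜ (λ a → not (does (proj₁ (g a) Fin.≟ proj₂ (g a)))) (λ a → t₁ a ∧ t₂ a)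
      (notᶜ (λ a → does (proj₁ (g a) Fin.≟ proj₂ (g a))) (equalᶜ (proj₁ ∘ g) (proj₂ ∘ g) (fst p) (snd p)))
      (andᶜ t₁ t₂
        (≤+ᶜ (λ _ → 0ℚ , ℚ.≤-refl) (λ a → wt (I a) (proj₁ (g a))) (λ a → Λ (I a)) (constᶜ (encodeℚ 0ℚ)) (snd (snd (snd (fst p)))) q)
        (≤+ᶜ (λ _ → 0ℚ , ℚ.≤-refl) (λ a → wt (I a) (proj₂ (g a))) (λ a → Λ (I a)) (constᶜ (encodeℚ 0ℚ)) (snd (snd (snd (snd p)))) q))
      where
      t₁ t₂ : A → Bool
      t₁ a = does (0ℚ ℚ.≤? w⁺ (I a) (proj₁ (g a)) +ℚ Λ (I a))
      t₂ a = does (0ℚ ℚ.≤? w⁺ (I a) (proj₂ (g a)) +ℚ Λ (I a))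

    usableᶜ : (g x : ∀ a → Index (I a) × Index (I a)) → e ⇝ (λ a → encodePair (I a) (g a)) → e ⇝ (λ a → encodePair (I a) (x a)) →
              e ⇝ (λ a → encodeℚ (Λ (I a))) → e ⇝ (λ a → encodeBool (does (usable? (I a) (g a) (x a))))
    usableᶜ g x p q r =
      andᶜ t₁ (λ a → t₂ a ∧ (t₃ a ∧ t₄ a)) (disjointᶜ i g₁ (fst q) (fst p))
        (andᶜ t₂ (λ a → t₃ a ∧ t₄ a) (disjointᶜ i g₂ (fst q) (snd p))
          (andᶜ t₃ t₄ (notᶜ (λ a → does (disjoint?⁺ (I a) (i a) (j a))) (disjointᶜ i j (fst q) (snd q)))
            (≤+ᶜ (λ a → wt (I a) (i a)) (λ a → wt (I a) (s a)) (λ a → Λ (I a)) (snd (snd (snd (fst q)))) (snd (snd (snd sᶜ))) r)))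
      where
      g₁ g₂ i j s : ∀ a → Index (I a)
      g₁ = proj₁ ∘ g
      g₂ = proj₂ ∘ g
      i  = proj₁ ∘ x
      j  = proj₂ ∘ x
      s a = substitute (I a) (g₁ a) (i a) (j a)
      t₁ t₂ t₃ t₄ : A → Bool
      t₁ a = does (disjoint?⁺ (I a) (i a) (g₁ a))
      t₂ a = does (disjoint?⁺ (I a) (i a) (g₂ a))
      t₃ a = not (does (disjoint?⁺ (I a) (i a) (j a)))
      t₄ a = does (w⁺ (I a) (i a) ℚ.≤? w⁺ (I a) (s a) +ℚ Λ (I a))
      sᶜ : e ⇝ (λ a → encodeIndex (I a) (s a))
      sᶜ = if-encᶜ (λ a → encodeIndex (I a)) (λ a → does (j a Fin.≟ i a)) g₁ j (equalᶜ j i (snd q) (fst q)) (fst p) (snd q)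

    copyJobᶜ : (x : ∀ a → Index (I a) × Index (I a)) → e ⇝ (λ a → encodePair (I a) (x a)) →
               e ⇝ (λ a → encodeColoredJob (copyJob (I a) (x a)))
    copyJobᶜ x p = pair (castᶜ (λ a → cong encodeℕ (if-⊓ (li a) (lj a)))
        (if-encᶜ (λ _ → encodeℕ) (λ a → does (li a ≤? lj a)) li lj
          (≤ᶜ li lj (fst (snd (fst p))) (fst (snd (snd p)))) (fst (snd (fst p))) (fst (snd (snd p)))))
      (pair (fst (snd (fst p))) (pair (fst (snd (snd (fst p)))) (pair
        (castᶜ (λ a → cong encodeℕ (if-⊔ (hi′ a) (hj a)))
          (if-encᶜ (λ _ → encodeℕ) (λ a → does (hi′ a ≤? hj a)) hj hi′
            (≤ᶜ hi′ hj (fst (snd (snd (fst p)))) (fst (snd (snd (snd p))))) (fst (snd (snd (snd p)))) (fst (snd (snd (fst p))))))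
        (snd (snd (snd (fst p)))))))
      where
      li lj hi′ hj : A → ℕ
      li a = lo (I a) (proj₁ (x a))
      lj a = lo (I a) (proj₂ (x a))
      hi′ a = hi (I a) (proj₁ (x a))
      hj a = hi (I a) (proj₂ (x a))
      if-⊓ : ∀ x y → (if does (x ≤? y) then x else y) ≡ x ⊓ y
      if-⊓ x y = decide (x ≤? y)
        where
        decide : (d : Dec (x ≤ y)) → (if does d then x else y) ≡ x ⊓ y
        decide (yes x≤y) = sym (m≤n⇒m⊓n≡m x≤y)
        decide (no  x≰y) = sym (m≥n⇒m⊓n≡n (<⇒≤ (≰⇒> x≰y)))
      if-⊔ : ∀ x y → (if does (x ≤? y) then y else x) ≡ x ⊔ y
      if-⊔ x y = decide (x ≤? y)
        where
        decide : (d : Dec (x ≤ y)) → (if does d then y else x) ≡ x ⊔ y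
        decide (yes x≤y) = sym (m≤n⇒m⊔n≡n x≤y)
        decide (no  x≰y) = sym (m≥n⇒m⊔n≡m (<⇒≤ (≰⇒> x≰y)))

  weights : ∀ I → List (Index I × Index I) → List Weight
  weights I = map (jobWeight ∘ copyJob I)

  weightsᶜ : (I : A → RobustInstance) (T : ∀ a → List (Index (I a) × Index (I a))) →
             e ⇝ (λ a → encodeList (encodePair (I a)) (T a)) → e ⇝ (λ a → encodeList encodeWeight (weights (I a) (T a)))
  weightsᶜ I T p = mapᶜ (λ a → encodePair (I a)) (λ _ → encodeWeight) {xs = T} {F = λ a → jobWeight ∘ copyJob (I a)} p
    (snd (snd (snd (fst (fst idᶜ)))))

  pairs : ∀ I → List (Index I × Index I)
  pairs I = cartesianProduct (allFin (m I)) (allFin (m I))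

  pairsᶜ : context ⇝ (λ I → encodeList (encodePair I) (pairs I))
  pairsᶜ = productᶜ encodeIndex encodeIndex {xs = λ I → allFin (m I)} {ys = λ I → allFin (m I)} (fst idᶜ) (fst idᶜ)

  bestCopies : ∀ I → Index I × Index I → List (Index I × Index I)
  bestCopies I g = best (copyJob I) (copies I g)

  bestCopiesᶜ : _⇝_ {Σ RobustInstance λ I → Index I × Index I} (λ (I , g) → node (encodePair I g) (context I))
                    (λ (I , g) → encodeList (encodePair I) (bestCopies I g))
  bestCopiesᶜ = bestᶜ (λ (I , _) → encodePair I) (λ (I , _) → copyJob I) (λ (I , g) → copies I g)
    (filterᶜ (λ (I , _) → encodePair I) (λ (I , g) → usable? I g) {xs = λ (I , _) → pairs I} (snd idᶜ ⨾ at proj₁ pairsᶜ)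
      (Tests.usableᶜ (λ ((I , _) , _) → I) (λ ((_ , g) , _) → g) proj₂ (fst (snd idᶜ)) (fst idᶜ) (snd (snd (snd idᶜ)))))
    (Tests.copyJobᶜ (λ ((I , _) , _) → I) proj₂ (fst idᶜ))

  candidates : ∀ I → List (List (Index I × Index I))
  candidates I = map (bestCopies I) (filter (good? I) (pairs I))

  candidatesᶜ : context ⇝ (λ I → encodeList (encodeList (encodePair I)) (candidates I))
  candidatesᶜ = mapᶜ encodePair (λ I → encodeList (encodePair I)) {xs = λ I → filter (good? I) (pairs I)} {F = bestCopies}
    (filterᶜ encodePair good? {xs = pairs} pairsᶜ (Tests.goodᶜ proj₁ proj₂ (fst idᶜ) (snd (snd idᶜ))))
    bestCopiesᶜ

  better : ∀ I (T T′ : List (Index I × Index I)) → List (Index I × Index I)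
  better I T T′ = if prefer (weights I T) (weights I T′) then T′ else T

  heaviest : ∀ I → List (List (Index I × Index I)) → Maybe (List (Index I × Index I))
  heaviest I []       = nothing
  heaviest I (T ∷ Ts) = just (maybe′ (better I T) T (heaviest I Ts))

  heaviestᶜ : context ⇝ (λ I → encodeMaybe (encodeList (encodePair I)) (heaviest I (candidates I)))
  heaviestᶜ = recᶜ (λ I → encodeList (encodePair I)) (λ I Ts → encodeMaybe (encodeList (encodePair I)) (heaviest I Ts)) candidatesᶜ nilᶜ
    (pair nilᶜ (maybeᶜ (λ (I , _) → encodeList (encodePair I)) (λ (I , _ , Ts) → heaviest I Ts)
      (λ (I , T , _) T′ → encodeList (encodePair I) (maybe′ (better I T) T T′))
      (snd (fst idᶜ)) (fst (fst idᶜ)) betterᶜ))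
    -- The winner is one of the candidates, so intermediate results never exceed the list itself.
    𝕏 (λ I Ts → ≤-trans (bound I Ts) (m≤n+m _ (size (context I))))
    where
    Pairs : RobustInstance → Set
    Pairs I = List (Index I × Index I)
    betterᶜ : _⇝_ {Σ (Σ RobustInstance λ I → Pairs I × List (Pairs I)) λ (I , _) → Pairs I}
      (λ ((I , T , Ts) , T′) → node (encodeList (encodePair I) T′)
        (node (node (encodeList (encodePair I) T) (encodeMaybe (encodeList (encodePair I)) (heaviest I Ts))) (context I)))
      (λ ((I , T , _) , T′) → encodeList (encodePair I) (better I T T′))
    betterᶜ = if-encᶜ (λ ((I , _) , _) → encodeList (encodePair I)) (λ ((I , T , _) , T′) → prefer (weights I T) (weights I T′))
      proj₂ (λ ((_ , T , _) , _) → T)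
      (preferᶜ (λ ((I , T , _) , T′) → weights I T) (λ ((I , T , _) , T′) → weights I T′)
        (weightsᶜ (λ ((I , _) , _) → I) (λ ((_ , T , _) , _) → T) (fst (fst (snd idᶜ))))
        (weightsᶜ (λ ((I , _) , _) → I) proj₂ (fst idᶜ)))
      (fst idᶜ) (fst (fst (snd idᶜ)))
    bound : ∀ I Ts → size (encodeMaybe (encodeList (encodePair I)) (heaviest I Ts)) ≤ size (encodeList (encodeList (encodePair I)) Ts)
    bound I []       = ≤-refl
    bound I (T ∷ Ts) = choose (heaviest I Ts) (bound I Ts)
      where
      len : Pairs I → ℕ
      len = size ∘ encodeList (encodePair I)
      rest = size (encodeList (encodeList (encodePair I)) Ts)
      choose : ∀ T′ → size (encodeMaybe (encodeList (encodePair I)) T′) ≤ rest → 2 + len (maybe′ (better I T) T T′) ≤ 1 + len T + rest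
      choose nothing   le = s≤s (≤-trans (≤-reflexive (+-comm 1 (len T))) (+-monoʳ-≤ (len T) (1≤size (encodeList (encodeList (encodePair I)) Ts))))
      choose (just T′) le = pick′ (prefer (weights I T) (weights I T′))
        where
        pick′ : ∀ b → 2 + len (if b then T′ else T) ≤ 1 + len T + rest
        pick′ true  = ≤-trans le (m≤n+m rest (1 + len T))
        pick′ false = choose nothing le′
          where le′ = 1≤size (encodeList (encodeList (encodePair I)) Ts)

  -- The result is `nothing` only if no guess is good, and by `candidate` there is no feasible
  -- solution then.
  answerᴿ : ∀ I → Maybe (Subset (RobustInstance.n I))
  answerᴿ I = Maybe.map (selection I) (heaviest I (candidates I))

  selectionᶜ : _⇝_ {Σ RobustInstance λ I → List (Index I × Index I)} (λ (I , T) → node (encodeList (encodePair I) T) (context I))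
                   (λ (I , T) → encodeSubset (selection I T))
  selectionᶜ = castᶜ (λ (I , T) → encode-tabulate (occurs (map proj₁ T)) (λ k → suc (suc k)))
    -- The bits are computed for all indices; the two outer `snd` drop those of the dummies.
    (snd (snd (mapᶜ (λ (I , _) → encodeIndex I) (λ _ → encodeBool) {xs = λ (I , _) → allFin (m I)} {F = λ (_ , T) → occurs (map proj₁ T)}
      (fst (snd idᶜ)) occursᶜ)))
    where
    firstsᶜ : _⇝_ {Σ (Σ RobustInstance λ I → List (Index I × Index I)) λ (I , _) → Index I}
      (λ ((I , T) , k) → node (encodeIndex I k) (node (encodeList (encodePair I) T) (context I)))
      (λ ((I , T) , k) → encodeList (encodeIndex I) (map proj₁ T))
    firstsᶜ = mapᶜ (λ ((I , _) , _) → encodePair I) (λ ((I , _) , _) → encodeIndex I) {xs = λ ((_ , T) , _) → T} {F = λ _ → proj₁}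
      (fst (snd idᶜ)) (fst (fst idᶜ))
    occursᶜ : _⇝_ {Σ (Σ RobustInstance λ I → List (Index I × Index I)) λ (I , _) → Index I}
      (λ ((I , T) , k) → node (encodeIndex I k) (node (encodeList (encodePair I) T) (context I)))
      (λ ((I , T) , k) → encodeBool (occurs (map proj₁ T) k))
    occursᶜ = nonemptyᶜ (λ ((I , _) , _) → encodeIndex I) {xs = λ ((_ , T) , k) → filter (k Fin.≟_) (map proj₁ T)}
      (filterᶜ (λ ((I , _) , _) → encodeIndex I) (λ (_ , k) → k Fin.≟_) {xs = λ ((_ , T) , _) → map proj₁ T} firstsᶜ
        (Tests.equalᶜ (λ (((I , _) , _) , _) → I) (λ ((_ , k) , _) → k) proj₂ (fst (snd idᶜ)) (fst idᶜ)))

  answerᴿᶜ : encodeRobustInstance ⇝ (λ I → encodeMaybe encodeSubset (answerᴿ I))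
  answerᴿᶜ = contextᶜ ⨾ maybeᶜ (λ I → encodeList (encodePair I)) (λ I → heaviest I (candidates I))
    (λ I T → encodeMaybe encodeSubset (Maybe.map (selection I) T)) heaviestᶜ nilᶜ (pair nilᶜ selectionᶜ)

  -- Optimality of the answer

  open MaximizationProblem RobustIntervalScheduling using (Correct)

  private
    ∑ᵂ : ∀ I → List (Index I × Index I) → ℚ
    ∑ᵂ I T = ∑ (weights I T)

  HeaviestIn : ∀ I → List (List (Index I × Index I)) → Maybe (List (Index I × Index I)) → Set
  HeaviestIn I Ts nothing  = Ts ≡ []
  HeaviestIn I Ts (just T) = T List.∈ Ts × All (λ T′ → ∑ᵂ I T′ ≤ℚ ∑ᵂ I T) Ts

  heaviest-correct : ∀ I Ts → HeaviestIn I Ts (heaviest I Ts)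
  heaviest-correct I []       = refl
  heaviest-correct I (T ∷ Ts) = extend (heaviest I Ts) (heaviest-correct I Ts)
    where
    choose : ∀ T′ → T′ List.∈ Ts → All (λ T″ → ∑ᵂ I T″ ≤ℚ ∑ᵂ I T′) Ts → ∀ b →
             (if b then ∑ᵂ I T ≤ℚ ∑ᵂ I T′ else ∑ᵂ I T′ ≤ℚ ∑ᵂ I T) → HeaviestIn I (T ∷ Ts) (just (if b then T′ else T))
    choose T′ T′∈ all true  le = there T′∈ , le ∷ all
    choose T′ T′∈ all false le = here refl , ℚ.≤-refl ∷ All.map (λ le′ → ℚ.≤-trans le′ le) all
    extend : ∀ T′ → HeaviestIn I Ts T′ → HeaviestIn I (T ∷ Ts) (just (maybe′ (better I T) T T′))
    extend nothing   refl        = here refl , ℚ.≤-refl ∷ []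
    extend (just T′) (T′∈ , all) = choose T′ T′∈ all (prefer (weights I T) (weights I T′)) (prefer-correct (weights I T) (weights I T′))

  -- For the guess read off from `S` by `Complete`, the copies that encode `S` are a competitor of
  -- the optimal colored solution.
  candidate : ∀ I S → Robust.Feasible I S → ∃ λ T → T List.∈ candidates I × Robust.w I S ≤ℚ ∑ᵂ I T
  candidate I S feasible = bestCopies I guess , guess∈ , le
    where
    open Complete I S feasible
    guess : Index I × Index I
    guess = g₁ , g₂
    guess∈ : bestCopies I guess List.∈ candidates I
    guess∈ = ∈-map⁺ (bestCopies I) (∈-filter⁺ (good? I) (∈-cartesianProduct⁺ (∈-allFin g₁) (∈-allFin g₂)) good)
    le : Robust.w I S ≤ℚ ∑ᵂ I (bestCopies I guess)
    le = ℚ.≤-trans (ℚ.≤-reflexive (sym value)) (best-maximal (copyJob I) (copies I guess) T⊆copies compatible)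

  Represents : ∀ I → List (Index I × Index I) → Set
  Represents I T = Robust.Feasible I (selection I T) × Robust.w I (selection I T) ≡ ∑ᵂ I T

  bestCopies-represents : ∀ I g → Good I g → Represents I (bestCopies I g)
  bestCopies-represents I (g₁ , g₂) good = feasible , value
    where
    open Sound I g₁ g₂ good (bestCopies I (g₁ , g₂))
      (All-resp-⊆ (best-⊆ (copyJob I) (copies I (g₁ , g₂))) (All.all-filter (usable? I (g₁ , g₂)) (pairs I)))
      (best-compatible (copyJob I) (copies I (g₁ , g₂)))

  candidates-represent : ∀ I T → T List.∈ candidates I → Represents I T
  candidates-represent I T T∈ = let g , g∈ , eq = ∈-map⁻ (bestCopies I) T∈ in
    subst (Represents I) (sym eq) (bestCopies-represents I g (proj₂ (∈-filter⁻ (good? I) {xs = pairs I} g∈)))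

  correct : ∀ I → Correct I (answerᴿ I)
  correct I = conclude (heaviest I (candidates I)) (heaviest-correct I (candidates I))
    where
    conclude : ∀ T → HeaviestIn I (candidates I) T → Correct I (Maybe.map (selection I) T)
    conclude nothing none S feasible = let T , T∈ , _ = candidate I S feasible in contradiction (subst (T List.∈_) none T∈) λ ()
    conclude (just T) (T∈ , all) = let feasible , value = candidates-represent I T T∈ in
      feasible , λ S feasible′ → let T′ , T′∈ , le = candidate I S feasible′ in
        ℚ.≤-trans le (ℚ.≤-trans (All.lookup all T′∈) (ℚ.≤-reflexive (sym value)))

theorem7 : PolynomialTimeSolvable IntervalSchedulingWithColors → PolynomialTimeSolvable RobustIntervalScheduling
theorem7 solvable = polynomialTime RobustIntervalScheduling answerᴿ answerᴿᶜ correct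
  where open Algorithm solvable
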